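{- For any $q\equiv0\pmod 3$, $q\ge9$, in $\mathrm{PG}(3,q)$, for the twisted cubic $\mathcal{C}$, the external lines meeting the axis of $\Gamma$ form three orbits under $G_q$ of sizes $q^3-q$, $(q^2-1)/2$, $(q^2-1)/2$. The $(q^3-q)$-orbit and the two $(q^2-1)/2$-orbits can be represented in the form $\{\ell_1\varphi\mid\varphi\in G_q\}$ and $\{\ell_j\varphi\mid\varphi\in G_q\}$, $j=2,3$, respectively, where $\ell_1$ is the line through $P_0^{A}$ and $\mathbf{P}(0,0,1,1)$, $\ell_2$ is the line through $P_0^{A}$ and $\mathbf{P}(1,0,1,0)$, $\ell_3$ is the line through $P_0^{A}$ and $\mathbf{P}(1,0,\rho,0)$, with $P_0^{A}=\mathbf{P}(0,1,0,0)$ and $\rho$ a non-square element of $\mathbb{F}_q$. The subgroup of $G_q$ fixing $\ell_1$ is trivial. The lines $\ell_2$ and $\ell_3$ are fixed by the same subgroup of $G_q$, of size $2q$; an element $\Psi$ of this subgroup has a matrix of the form \[ \left[ \begin{array}{cccc} 1&0&0&0\\ 0&d&0&0\\ 0&-bd&d^2&0\\ b^3&b^2d&bd^2&d^3 \end{array} \right], \quad b \in \mathbb{F}_q,\ d \in \{1,-1\}. \]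
   Context: Let $\mathbf{P}(x_0,x_1,x_2,x_3)$ denote the point of $\mathrm{PG}(3,q)$ with homogeneous coordinates $x_i\in\mathbb{F}_q$. Let $\mathcal{C}=\{P(t): t\in\mathbb{F}_q\cup\{\infty\}\}$ be the twisted cubic, where $P(t)=\mathbf{P}(t^3,t^2,t,1)$ for $t\in\mathbb{F}_q$ and $P(\infty)=\mathbf{P}(1,0,0,0)$. Let $G_q$ be the group of projectivities of $\mathrm{PG}(3,q)$ fixing $\mathcal{C}$; for $q\ge5$, $G_q\cong PGL(2,q)$, and a projectivity of $G_q$ acts on points by $[x_0,x_1,x_2,x_3]\mapsto[x_0,x_1,x_2,x_3]M$ where $M$ has the general form \[ M=\left[ \begin{array}{cccc} a^3&a^2c&ac^2&c^3\\ 3a^2b&a^2d+2abc&bc^2+2acd&3c^2d\\ 3ab^2&b^2c+2abd&ad^2+2bcd&3cd^2\\ b^3&b^2d&bd^2&d^3 \end{array} \right],\quad a,b,c,d\in\mathbb{F}_q,\ ad-bc\ne0, \] defined up to a nonzero scalar factor. The osculating plane at $P(t)$ is $x_0-3tx_1+3t^2x_2-t^3x_3=0$ for $t\in\mathbb{F}_q$ and $x_3=0$ for $t=\infty$; they form the osculating developable $\Gamma$. For $q\equiv0\pmod3$ all $q+1$ osculating planes pass through a single line, the axis of $\Gamma$, with equations $x_0=x_3=0$. An external line here is a line of $\mathrm{PG}(3,q)$ containing no point of $\mathcal{C}$. -}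

module Defs where

open import Algebra.Bundles using (CommutativeRing)
open import Algebra.Structures using (IsCommutativeRing)
open import Data.Bool.Base using (if_then_else_)
open import Data.Fin.Base using (Fin)
open import Data.Fin.Patterns using (0F; 1F; 2F; 3F)
open import Data.Fin.Properties using () renaming (_≟_ to _≟ᶠ_)
open import Data.Maybe.Base using (Maybe; just; nothing)
open import Data.Nat.Base as ℕ using (ℕ)
open import Data.Nat.DivMod as ℕ using ()
open import Data.Product.Base using (Σ; ∃-syntax; _×_; _,_; proj₁; proj₂)
open import Data.Sum.Base using (_⊎_)
open import Data.Vec.Functional using (Vector; _∷_; [])
open import Function.Bundles using (Inverse; _↔_; _⇔_; mk⇔; Equivalence)
open import Level using (Level; suc)
open import Relation.Binary.Bundles using (Setoid)
import Relation.Binary.Construct.On as On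
open import Relation.Binary.PropositionalEquality
  using (_≡_; _≢_; _≗_; refl; sym; trans; cong; cong₂; module ≡-Reasoning)
import Relation.Binary.PropositionalEquality as ≡
open import Relation.Nullary using (¬_; does)

private
  variable
    a p ℓ : Level

HasSize : Setoid a ℓ → ℕ → Set _
HasSize S n = Inverse S (≡.setoid (Fin n))

subsetoid : (S : Setoid a ℓ) → (Setoid.Carrier S → Set p) → Setoid _ _
subsetoid S P = On.setoid {B = Σ (Setoid.Carrier S) P} S proj₁

record FiniteField (c : Level) (q : ℕ) : Set (suc c) where
  infixl 7 _*_
  infixl 6 _+_
  infix  8 -_
  field
    Carrier           : Set c
    _+_ _*_           : Carrier → Carrier → Carrier
    -_                : Carrier → Carrier
    0# 1#             : Carrier
    isCommutativeRing : IsCommutativeRing _≡_ _+_ _*_ -_ 0# 1#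
    1≢0               : 1# ≢ 0#
    inverse           : ∀ x → x ≢ 0# → ∃[ y ] x * y ≡ 1#
    enumeration       : Carrier ↔ Fin q

  commutativeRing : CommutativeRing c c
  commutativeRing = record { isCommutativeRing = isCommutativeRing }

module TwistedCubic {c : Level} {q : ℕ} (𝔽 : FiniteField c q) where

  open FiniteField 𝔽
  open CommutativeRing commutativeRing
    using (*-assoc; *-comm; *-identityˡ; *-identityʳ; zeroˡ; zeroʳ; +-identityˡ; +-identityʳ; semiring)
  open import Algebra.Properties.Semiring.Sum semiring
    using (sum; sum-syntax; sum-cong-≗; sum-replicate-zero; ∑-comm; *-distribˡ-sum; *-distribʳ-sum)

  F : Set c
  F = Carrier

  NonSquare : F → Set c
  NonSquare x = ∀ y → y * y ≢ x

  Vec⁴ : Set c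
  Vec⁴ = Vector F 4

  Mat⁴ : Set c
  Mat⁴ = Vector Vec⁴ 4

  ⟨_,_,_,_⟩ : {A : Set c} → A → A → A → A → Vector A 4
  ⟨ x₀ , x₁ , x₂ , x₃ ⟩ = x₀ ∷ x₁ ∷ x₂ ∷ x₃ ∷ []

  𝟘 : Vec⁴
  𝟘 _ = 0#

  𝕀 : Mat⁴
  𝕀 i j = if does (i ≟ᶠ j) then 1# else 0#

  infixl 7 _·_ _⊗_
  infix  4 _≐_ _∝_ _∝ᴹ_

  _·_ : Vec⁴ → Mat⁴ → Vec⁴
  (x · M) j = ∑[ i < 4 ] (x i * M i j)

  _⊗_ : Mat⁴ → Mat⁴ → Mat⁴
  (M ⊗ N) i = M i · N

  _≐_ : Mat⁴ → Mat⁴ → Set c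
  M ≐ N = ∀ i j → M i j ≡ N i j

  _∝_ : Vec⁴ → Vec⁴ → Set c
  x ∝ y = ∃[ k ] (k ≢ 0# × ∀ i → x i ≡ k * y i)

  _∝ᴹ_ : Mat⁴ → Mat⁴ → Set c
  M ∝ᴹ N = ∃[ k ] (k ≢ 0# × ∀ i j → M i j ≡ k * N i j)

  *-nonzero : ∀ {x y} → x ≢ 0# → y ≢ 0# → x * y ≢ 0#
  *-nonzero {x} {y} x≢0 y≢0 xy≡0 with inverse x x≢0
  ... | x⁻¹ , xx⁻¹≡1 = y≢0 (begin
    y               ≡⟨ *-identityˡ y ⟨
    1# * y          ≡⟨ cong (_* y) (trans (*-comm x⁻¹ x) xx⁻¹≡1) ⟨
    x⁻¹ * x * y     ≡⟨ *-assoc x⁻¹ x y ⟩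
    x⁻¹ * (x * y)   ≡⟨ cong (x⁻¹ *_) xy≡0 ⟩
    x⁻¹ * 0#        ≡⟨ zeroʳ x⁻¹ ⟩
    0#              ∎)
    where open ≡-Reasoning

  unscale : ∀ {k k⁻¹ x y} → k * k⁻¹ ≡ 1# → x ≡ k * y → y ≡ k⁻¹ * x
  unscale {k} {k⁻¹} {x} {y} kk⁻¹≡1 x≡ky = begin
    y               ≡⟨ *-identityˡ y ⟨
    1# * y          ≡⟨ cong (_* y) (trans (*-comm k⁻¹ k) kk⁻¹≡1) ⟨
    k⁻¹ * k * y     ≡⟨ *-assoc k⁻¹ k y ⟩
    k⁻¹ * (k * y)   ≡⟨ cong (k⁻¹ *_) x≡ky ⟨
    k⁻¹ * x         ∎
    where open ≡-Reasoning

  inverse-nonzero : ∀ {k k⁻¹} → k * k⁻¹ ≡ 1# → k⁻¹ ≢ 0#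
  inverse-nonzero {k} kk⁻¹≡1 refl = 1≢0 (trans (sym kk⁻¹≡1) (zeroʳ k))

  ∝ᴹ-refl : ∀ {M} → M ∝ᴹ M
  ∝ᴹ-refl {M} = 1# , 1≢0 , λ i j → sym (*-identityˡ (M i j))

  ∝ᴹ-sym : ∀ {M N} → M ∝ᴹ N → N ∝ᴹ M
  ∝ᴹ-sym (k , k≢0 , e) with inverse k k≢0
  ... | k⁻¹ , kk⁻¹≡1 = k⁻¹ , inverse-nonzero kk⁻¹≡1 , λ i j → unscale kk⁻¹≡1 (e i j)

  ∝ᴹ-trans : ∀ {L M N} → L ∝ᴹ M → M ∝ᴹ N → L ∝ᴹ N
  ∝ᴹ-trans {N = N} (k , k≢0 , e) (l , l≢0 , f) =
    k * l , *-nonzero k≢0 l≢0 ,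
    λ i j → trans (e i j) (trans (cong (k *_) (f i j)) (sym (*-assoc k l (N i j))))

  ·-𝕀 : ∀ x → x · 𝕀 ≗ x
  ·-𝕀 x 0F rewrite *-identityʳ (x 0F) | zeroʳ (x 1F) | zeroʳ (x 2F) | zeroʳ (x 3F)
                 | +-identityʳ 0# | +-identityʳ 0# | +-identityʳ 0# = +-identityʳ (x 0F)
  ·-𝕀 x 1F rewrite *-identityʳ (x 1F) | zeroʳ (x 0F) | zeroʳ (x 2F) | zeroʳ (x 3F)
                 | +-identityʳ 0# | +-identityʳ 0# | +-identityˡ (x 1F + 0#) = +-identityʳ (x 1F)
  ·-𝕀 x 2F rewrite *-identityʳ (x 2F) | zeroʳ (x 0F) | zeroʳ (x 1F) | zeroʳ (x 3F)
                 | +-identityʳ 0# | +-identityʳ (x 2F) | +-identityˡ (x 2F) = +-identityˡ (x 2F)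
  ·-𝕀 x 3F rewrite *-identityʳ (x 3F) | zeroʳ (x 0F) | zeroʳ (x 1F) | zeroʳ (x 2F)
                 | +-identityʳ (x 3F) | +-identityˡ (x 3F) | +-identityˡ (x 3F) = +-identityˡ (x 3F)

  ·-congˡ : ∀ x y M → x ≗ y → x · M ≗ y · M
  ·-congˡ x y M e j = sum-cong-≗ (λ i → cong (_* M i j) (e i))

  ·-congʳ : ∀ x M N → M ≐ N → x · M ≗ x · N
  ·-congʳ x M N e j = sum-cong-≗ (λ i → cong (x i *_) (e i j))

  ·-assoc : ∀ x M N → (x · M) · N ≗ x · (M ⊗ N)
  ·-assoc x M N j = begin
    ∑[ k < 4 ] (∑[ i < 4 ] (x i * M i k) * N k j)
      ≡⟨ sum-cong-≗ (λ k → *-distribʳ-sum (N k j) (λ i → x i * M i k)) ⟩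
    ∑[ k < 4 ] ∑[ i < 4 ] (x i * M i k * N k j)
      ≡⟨ ∑-comm (λ k i → x i * M i k * N k j) ⟩
    ∑[ i < 4 ] ∑[ k < 4 ] (x i * M i k * N k j)
      ≡⟨ sum-cong-≗ (λ i → sum-cong-≗ (λ k → *-assoc (x i) (M i k) (N k j))) ⟩
    ∑[ i < 4 ] ∑[ k < 4 ] (x i * (M i k * N k j))
      ≡⟨ sum-cong-≗ (λ i → *-distribˡ-sum (x i) (λ k → M i k * N k j)) ⟨
    ∑[ i < 4 ] (x i * ∑[ k < 4 ] (M i k * N k j)) ∎
    where open ≡-Reasoning

  𝟘-· : ∀ M → 𝟘 · M ≗ 𝟘
  𝟘-· M j = trans (sum-cong-≗ (λ i → zeroˡ (M i j))) (sum-replicate-zero 4)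

  scale-· : ∀ k x M → (λ i → k * x i) · M ≗ λ j → k * (x · M) j
  scale-· k x M j =
    trans (sum-cong-≗ (λ i → *-assoc k (x i) (M i j))) (sym (*-distribˡ-sum k (λ i → x i * M i j)))

  cancel : ∀ M N → M ⊗ N ≐ 𝕀 → ∀ x → (x · M) · N ≗ x
  cancel M N e x j = trans (·-assoc x M N j) (trans (·-congʳ x (M ⊗ N) 𝕀 e j) (·-𝕀 x j))

  record Point : Set c where
    constructor point
    field
      coords  : Vec⁴
      nonzero : ¬ (coords ≗ 𝟘)

  open Point public

  infix 4 _≈ᴾ_ _∈_ _≈ᴸ_

  _≈ᴾ_ : Point → Point → Set c
  X ≈ᴾ Y = coords X ∝ coords Y

  -- A line is presented by two distinct points on it; _≈ᴸ_ identifies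
  -- presentations of the same set of points.
  record Line : Set c where
    constructor line
    field
      P Q      : Point
      distinct : ¬ (P ≈ᴾ Q)

  _∈_ : Point → Line → Set c
  X ∈ line P Q _ = ∃[ α ] ∃[ β ] ∀ i → coords X i ≡ α * coords P i + β * coords Q i

  _≈ᴸ_ : Line → Line → Set c
  ℓ ≈ᴸ m = ∀ X → X ∈ ℓ ⇔ X ∈ m

  lineSetoid : Setoid c c
  lineSetoid = record
    { Carrier       = Line
    ; _≈_           = _≈ᴸ_
    ; isEquivalence = record
      { refl  = λ X → mk⇔ (λ z → z) (λ z → z)
      ; sym   = λ e X → mk⇔ (Equivalence.from (e X)) (Equivalence.to (e X))
      ; trans = λ e f X → mk⇔ (λ z → Equivalence.to (f X) (Equivalence.to (e X) z))
                              (λ z → Equivalence.from (e X) (Equivalence.from (f X) z))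
      }
    }

  record Projectivity : Set c where
    field
      matrix  : Mat⁴
      matrix⁻ : Mat⁴
      invʳ    : matrix ⊗ matrix⁻ ≐ 𝕀
      invˡ    : matrix⁻ ⊗ matrix ≐ 𝕀

  open Projectivity public

  projectivitySetoid : Setoid c c
  projectivitySetoid = record
    { Carrier       = Projectivity
    ; _≈_           = λ φ ψ → matrix φ ∝ᴹ matrix ψ
    ; isEquivalence = record
      { refl  = ∝ᴹ-refl
      ; sym   = ∝ᴹ-sym
      ; trans = ∝ᴹ-trans
      }
    }

  _⟪_⟫ᴾ : Point → Projectivity → Point
  X ⟪ φ ⟫ᴾ = point (coords X · matrix φ) λ xM≗𝟘 → nonzero X λ i →
    trans (sym (cancel (matrix φ) (matrix⁻ φ) (invʳ φ) (coords X) i))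
          (trans (·-congˡ (coords X · matrix φ) 𝟘 (matrix⁻ φ) xM≗𝟘 i) (𝟘-· (matrix⁻ φ) i))

  _⟪_⟫ᴸ : Line → Projectivity → Line
  line P Q P≉Q ⟪ φ ⟫ᴸ = line (P ⟪ φ ⟫ᴾ) (Q ⟪ φ ⟫ᴾ) λ { (k , k≢0 , e) → P≉Q (k , k≢0 , λ i → begin
      coords P i
        ≡⟨ cancel (matrix φ) (matrix⁻ φ) (invʳ φ) (coords P) i ⟨
      ((coords P · matrix φ) · matrix⁻ φ) i
        ≡⟨ ·-congˡ (coords P · matrix φ) (λ j → k * (coords Q · matrix φ) j) (matrix⁻ φ) e i ⟩
      ((λ j → k * (coords Q · matrix φ) j) · matrix⁻ φ) i
        ≡⟨ scale-· k (coords Q · matrix φ) (matrix⁻ φ) i ⟩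
      k * ((coords Q · matrix φ) · matrix⁻ φ) i
        ≡⟨ cong (k *_) (cancel (matrix φ) (matrix⁻ φ) (invʳ φ) (coords Q) i) ⟩
      k * coords Q i ∎) }
    where open ≡-Reasoning

  pattern ∞ = nothing

  cubicPoint : Maybe F → Point
  cubicPoint (just t) = point ⟨ t * t * t , t * t , t , 1# ⟩ (λ e → 1≢0 (e 3F))
  cubicPoint ∞        = point ⟨ 1# , 0# , 0# , 0# ⟩          (λ e → 1≢0 (e 0F))

  OnCubic : Point → Set c
  OnCubic X = ∃[ t ] X ≈ᴾ cubicPoint t

  InG : Projectivity → Set c
  InG φ = ∀ X → OnCubic X ⇔ OnCubic (X ⟪ φ ⟫ᴾ)

  OnOsculatingPlane : Maybe F → Point → Set c
  OnOsculatingPlane (just t) X =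
    x 0F + - (3# * t * x 1F) + 3# * (t * t) * x 2F + - (t * t * t * x 3F) ≡ 0#
    where
    x = coords X
    3# = 1# + 1# + 1#
  OnOsculatingPlane ∞        X = coords X 3F ≡ 0#

  -- The axis of Γ as a point set: the intersection of all osculating planes.
  -- This is a line exactly when the characteristic is 3.
  OnAxis : Point → Set c
  OnAxis X = ∀ t → OnOsculatingPlane t X

  -- The axis is itself disjoint from the cubic, but it is not counted among the
  -- external lines meeting the axis (it is fixed by the whole of G_q).
  record ExternalMeetingAxis (ℓ : Line) : Set c where
    field
      external  : ∀ X → X ∈ ℓ → ¬ OnCubic X
      meetsAxis : ∃[ X ] (X ∈ ℓ × OnAxis X)
      notAxis   : ¬ (∀ X → X ∈ ℓ ⇔ OnAxis X)

  Orbit : Line → Line → Set c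
  Orbit ℓ m = ∃[ φ ] (InG φ × m ≈ᴸ ℓ ⟪ φ ⟫ᴸ)

  orbitSetoid : Line → Setoid c c
  orbitSetoid ℓ = subsetoid lineSetoid (Orbit ℓ)

  Fixes : Projectivity → Line → Set c
  Fixes φ ℓ = ℓ ⟪ φ ⟫ᴸ ≈ᴸ ℓ

  stabilizerSetoid : Line → Setoid c c
  stabilizerSetoid ℓ = subsetoid projectivitySetoid (λ φ → InG φ × Fixes φ ℓ)

  -- The set of external lines meeting the axis is the disjoint union of the
  -- orbits of m₁, m₂, m₃, and these have the stated sizes.
  record OrbitDecomposition (m₁ m₂ m₃ : Line) : Set c where
    field
      covers     : ∀ ℓ → ExternalMeetingAxis ℓ ⇔ (Orbit m₁ ℓ ⊎ Orbit m₂ ℓ ⊎ Orbit m₃ ℓ)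
      disjoint₁₂ : ∀ ℓ → ¬ (Orbit m₁ ℓ × Orbit m₂ ℓ)
      disjoint₁₃ : ∀ ℓ → ¬ (Orbit m₁ ℓ × Orbit m₃ ℓ)
      disjoint₂₃ : ∀ ℓ → ¬ (Orbit m₂ ℓ × Orbit m₃ ℓ)
      size₁      : HasSize (orbitSetoid m₁) (q ℕ.^ 3 ℕ.∸ q)
      size₂      : HasSize (orbitSetoid m₂) ((q ℕ.^ 2 ℕ.∸ 1) ℕ./ 2)
      size₃      : HasSize (orbitSetoid m₃) ((q ℕ.^ 2 ℕ.∸ 1) ℕ./ 2)

  P₀ᴬ : Point
  P₀ᴬ = point ⟨ 0# , 1# , 0# , 0# ⟩ (λ e → 1≢0 (e 1F))

  P₀ᴬ≉ : ∀ X → coords X 1F ≡ 0# → ¬ (P₀ᴬ ≈ᴾ X)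
  P₀ᴬ≉ X x₁≡0 (k , _ , e) = 1≢0 (trans (e 1F) (trans (cong (k *_) x₁≡0) (zeroʳ k)))

  R₁ R₂ : Point
  R₁ = point ⟨ 0# , 0# , 1# , 1# ⟩ (λ e → 1≢0 (e 2F))
  R₂ = point ⟨ 1# , 0# , 1# , 0# ⟩ (λ e → 1≢0 (e 0F))

  R₃ : F → Point
  R₃ ρ = point ⟨ 1# , 0# , ρ , 0# ⟩ (λ e → 1≢0 (e 0F))

  ℓ₁ ℓ₂ : Line
  ℓ₁ = line P₀ᴬ R₁ (P₀ᴬ≉ R₁ refl)
  ℓ₂ = line P₀ᴬ R₂ (P₀ᴬ≉ R₂ refl)

  ℓ₃ : F → Line
  ℓ₃ ρ = line P₀ᴬ (R₃ ρ) (P₀ᴬ≉ (R₃ ρ) refl)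

  Ψ-matrix : F → F → Mat⁴
  Ψ-matrix b d =
    ⟨ ⟨ 1#        , 0#          , 0#          , 0#        ⟩
    , ⟨ 0#        , d           , 0#          , 0#        ⟩
    , ⟨ 0#        , - (b * d)   , d * d       , 0#        ⟩
    , ⟨ b * b * b , b * b * d   , b * (d * d) , d * d * d ⟩
    ⟩

  PlusMinusOne : F → Set c
  PlusMinusOne d = d ≡ 1# ⊎ d ≡ - 1#

{-# OPTIONS --safe #-}

-- In characteristic 3 the matrix M of g = (a b ; c d) maps the cubic point v(y) to v(g y) and
-- the axis point (0, x₁, -x₂, 0) to det g times the axis point of g x. An external line meeting
-- the axis at the point of x lies in the plane of the axis and v(y) for a unique cubic point
-- v(y), and it is determined by x, y and a displacement w ≠ 0 from v(y), where w has degree 1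
-- in x and 3 in y and g multiplies it by (det g)². If x and y are independent, a unique g up to
-- scalars takes ℓ₁ to the line, giving one regular orbit, of size q³ - q; if x = y, the class
-- of w modulo squares is the only invariant, giving the orbits of ℓ₂ and ℓ₃.
-- That every projectivity fixing the cubic has this form follows by reducing to one that fixes
-- two cubic points and comparing coefficients in the equations x₀x₂ = x₁², x₁x₃ = x₂².

module Submission where

open import Defs
open import Algebra.Bundles using (CommutativeRing)
import Algebra.Properties.Ring as RingProperties
open import Data.Bool.Base using (Bool; true; false)
open import Data.Empty using (⊥; ⊥-elim)
open import Data.Fin.Base as Fin using (Fin; punchOut)
open import Data.Fin.Patterns using (0F; 1F; 2F; 3F; 4F; 5F)
import Data.Fin.Permutation as Perm
open import Data.Fin.Properties
  using (any?; *↔×; <⇒notInjective; punchOut-injective; toℕ-injective)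
  renaming (_≟_ to _≟ᶠ_; suc-injective to suc-injectiveᶠ)
open import Data.List.Base using (List; []; _∷_; length; lookup)
open import Data.List.Membership.Propositional.Properties using (∈-lookup)
open import Data.List.Relation.Unary.All as All using (All; []; _∷_)
open import Data.Maybe.Base using (Maybe; just; nothing)
open import Data.Nat as ℕ using (ℕ; zero; suc; _≤_)
open import Data.Nat.Divisibility using (_∣_; ∣m+n∣m⇒∣n; ∣m⇒∣m*n; n∣m*n; ∣1⇒≡1)
import Data.Nat.DivMod as ℕ
import Data.Nat.Properties as ℕ
open import Data.Nat.Tactic.RingSolver using () renaming (solve-∀ to ℕ-solve-∀)
open import Data.Product using (Σ; ∃-syntax; _×_; _,_; proj₁; proj₂; map₂)
open import Data.Product.Function.NonDependent.Propositional using (_×-↔_)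
open import Data.Sum.Base using (_⊎_; inj₁; inj₂; [_,_]′) renaming (map to map⊎; map₂ to map₂⊎)
open import Data.Vec.Base using (Vec)
open import Data.Vec.N-ary using (N-ary; Eq; Eqʰ; curryⁿ)
open import Function.Base using (_⟨_⟩_; _∘_; id)
open import Function.Bundles using (Inverse; _↔_; _⇔_; mk⇔; mk↔ₛ′; Equivalence)
import Function.Construct.Composition as Compose
import Function.Construct.Identity as Identity
import Function.Construct.Symmetry as Symmetry
open import Function.Definitions using (Injective)
open import Level using (Level)
open import Relation.Binary.Bundles using (Setoid)
open import Relation.Binary.Definitions using (DecidableEquality; tri<; tri≈; tri>)
open import Relation.Binary.PropositionalEquality
  using (_≡_; _≢_; _≗_; refl; sym; trans; cong; cong₂; subst; module ≡-Reasoning)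
import Relation.Binary.PropositionalEquality as ≡
open import Relation.Nullary using (¬_; Dec; yes; no; contradiction)
open import Relation.Nullary.Decidable using (map′; ¬?; _×-dec_)
open import Relation.Unary using (Decidable)
open import Tactic.RingSolver.Core.AlmostCommutativeRing
  using (AlmostCommutativeRing; fromCommutativeRing)
open import Tactic.RingSolver.Core.Expression as Expression using (Expr; Κ; Ι; _⊕_; _⊗_; _⊛_; ⊝_)
open import Tactic.RingSolver.Core.Polynomial.Parameters using (Homomorphism)

-- A single scalar `w` suffices because the displacement matters only modulo the axis point of the
-- line, so it can be recorded by its determinant with that point. Labels turn every question about
-- lines into equations between scalars with two rescaling factors, one for x and one for y. When x
-- = y these factors coincide and `w` changes by a fourth power, which is why its square class
-- survives.
--
-- Characteristic 3 enters twice: terms with coefficient 3 vanish, and cubing is a bijection, so the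
-- parameters of the cubic point can be read off from the outer coordinates of any point of the line
-- off the axis. The field comes only with its size, so the characteristic has to be extracted from
-- 3 dividing q by counting.
--
-- A size is an explicit bijection with a `Fin`, so each orbit is parametrised by normal forms of
-- group elements: (q + 1) q (q - 1) of them for `ℓ₁`, and for `ℓ₂` and `ℓ₃` the q + 1 points times
-- the (q - 1) / 2 nonzero elements up to sign, since only the square of the determinant is visible
-- on such a line.

-- A ring solver with coefficients modulo 3

data ℤ₃ : Set where
  z0 z1 z2 : ℤ₃

CharacteristicThree : ∀ {c q} → FiniteField c q → Set c
CharacteristicThree 𝔽 = 1# + 1# + 1# ≡ 0#
  where open FiniteField 𝔽

module CharacteristicThreeSolver {c : Level} {q : ℕ} (𝔽 : FiniteField c q)
  (1+1+1≡0 : CharacteristicThree 𝔽) where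

  open FiniteField 𝔽
  open CommutativeRing commutativeRing
    using (ring; setoid; semiring; +-assoc; +-identityˡ; +-identityʳ; *-identityˡ; *-identityʳ;
           zeroˡ; zeroʳ; -‿inverseˡ; -‿inverseʳ)
  open RingProperties ring using (-0#≈0#; -‿involutive; -‿+-comm; -1*x≈-x)
  open ≡-Reasoning

  infixl 6 _+₃_
  infixl 7 _*₃_

  _+₃_ _*₃_ : ℤ₃ → ℤ₃ → ℤ₃
  z0 +₃ y  = y
  z1 +₃ z0 = z1
  z1 +₃ z1 = z2
  z1 +₃ z2 = z0
  z2 +₃ z0 = z2
  z2 +₃ z1 = z0
  z2 +₃ z2 = z1
  z0 *₃ y  = z0
  z1 *₃ y  = y
  z2 *₃ z0 = z0
  z2 *₃ z1 = z2
  z2 *₃ z2 = z1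

  -₃_ : ℤ₃ → ℤ₃
  -₃ z0 = z0
  -₃ z1 = z2
  -₃ z2 = z1

  embed : ℤ₃ → Carrier
  embed z0 = 0#
  embed z1 = 1#
  embed z2 = - 1#

  1+1≡-1 : 1# + 1# ≡ - 1#
  1+1≡-1 = begin
    1# + 1#                ≡⟨ +-identityʳ _ ⟨
    1# + 1# + 0#           ≡⟨ cong (1# + 1# +_) (-‿inverseʳ 1#) ⟨
    1# + 1# + (1# + - 1#)  ≡⟨ +-assoc _ _ _ ⟨
    1# + 1# + 1# + - 1#    ≡⟨ cong (_+ - 1#) 1+1+1≡0 ⟩
    0# + - 1#              ≡⟨ +-identityˡ _ ⟩
    - 1#                   ∎

  embed-+ : ∀ x y → embed (x +₃ y) ≡ embed x + embed y
  embed-+ z0 y  = sym (+-identityˡ _)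
  embed-+ z1 z0 = sym (+-identityʳ _)
  embed-+ z1 z1 = sym 1+1≡-1
  embed-+ z1 z2 = sym (-‿inverseʳ _)
  embed-+ z2 z0 = sym (+-identityʳ _)
  embed-+ z2 z1 = sym (-‿inverseˡ _)
  embed-+ z2 z2 = begin
    1#           ≡⟨ -‿involutive 1# ⟨
    - - 1#       ≡⟨ cong -_ 1+1≡-1 ⟨
    - (1# + 1#)  ≡⟨ -‿+-comm 1# 1# ⟨
    - 1# + - 1#  ∎

  embed-* : ∀ x y → embed (x *₃ y) ≡ embed x * embed y
  embed-* z0 y  = sym (zeroˡ _)
  embed-* z1 y  = sym (*-identityˡ _)
  embed-* z2 z0 = sym (zeroʳ _)
  embed-* z2 z1 = sym (*-identityʳ _)
  embed-* z2 z2 = trans (sym (-‿involutive 1#)) (sym (-1*x≈-x (- 1#)))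

  embed-neg : ∀ x → embed (-₃ x) ≡ - embed x
  embed-neg z0 = sym -0#≈0#
  embed-neg z1 = refl
  embed-neg z2 = sym (-‿involutive 1#)

  isZero : ℤ₃ → Bool
  isZero z0 = true
  isZero _  = false

  almostCommutativeRing : AlmostCommutativeRing c c
  -- Zero is never tested in the field itself; the solver tests coefficients, which live in `ℤ₃`.
  almostCommutativeRing = fromCommutativeRing commutativeRing (λ _ → nothing)

  -- With coefficients in `ℤ₃` normal forms drop every multiple of 3, so identities special to
  -- characteristic 3, such as additivity of cubing, are closed by `refl`.
  homomorphism : Homomorphism _ _ c c
  homomorphism = record
    { from = record
      { rawRing = record
        { Carrier = ℤ₃ ; _≈_ = _≡_ ; _+_ = _+₃_ ; _*_ = _*₃_ ; -_ = -₃_ ; 0# = z0 ; 1# = z1 }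
      ; isZero = isZero
      }
    ; to = almostCommutativeRing
    ; morphism = record
      { ⟦_⟧    = embed
      ; +-homo = embed-+
      ; *-homo = embed-*
      ; -‿homo = embed-neg
      ; 0-homo = refl
      ; 1-homo = refl
      }
    ; Zero-C⟶Zero-R = λ { z0 _ → refl }
    }

  open Expression.Eval (AlmostCommutativeRing.rawRing almostCommutativeRing) embed using (⟦_⟧)
  open import Algebra.Properties.Semiring.Exp.TCOptimised semiring using (^-congˡ)
  open import Tactic.RingSolver.Core.Polynomial.Base (Homomorphism.from homomorphism)
  open import Tactic.RingSolver.Core.Polynomial.Semantics homomorphism renaming (⟦_⟧ to ⟦_⟧ₚ)
  open import Tactic.RingSolver.Core.Polynomial.Homomorphism homomorphism

  normalise : ∀ {n} → Expr ℤ₃ n → Poly n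
  normalise (Κ x)   = κ x
  normalise (Ι x)   = ι x
  normalise (x ⊕ y) = normalise x ⊞ normalise y
  normalise (x ⊗ y) = normalise x ⊠ normalise y
  normalise (⊝ x)   = ⊟ normalise x
  normalise (x ⊛ i) = normalise x ⊡ i

  ⟦_⇓⟧ : ∀ {n} → Expr ℤ₃ n → Vec Carrier n → Carrier
  ⟦ e ⇓⟧ = ⟦ normalise e ⟧ₚ

  normalise-correct : ∀ {n} (e : Expr ℤ₃ n) ρ → ⟦ e ⇓⟧ ρ ≡ ⟦ e ⟧ ρ
  normalise-correct (Κ x)   ρ = κ-hom x ρ
  normalise-correct (Ι x)   ρ = ι-hom x ρ
  normalise-correct (x ⊕ y) ρ = ⊞-hom (normalise x) (normalise y) ρ
    ⟨ trans ⟩ cong₂ _+_ (normalise-correct x ρ) (normalise-correct y ρ)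
  normalise-correct (x ⊗ y) ρ = ⊠-hom (normalise x) (normalise y) ρ
    ⟨ trans ⟩ cong₂ _*_ (normalise-correct x ρ) (normalise-correct y ρ)
  normalise-correct (⊝ x)   ρ = ⊟-hom (normalise x) ρ ⟨ trans ⟩ cong -_ (normalise-correct x ρ)
  normalise-correct (x ⊛ i) ρ = ⊡-hom (normalise x) i ρ ⟨ trans ⟩ ^-congˡ i (normalise-correct x ρ)

  import Relation.Binary.Reflection setoid Ι ⟦_⟧ ⟦_⇓⟧ normalise-correct as Reflection
  open Reflection public using (_⊜_)

  -- Abstract, so that with-abstractions never unfold the proofs found by the solver.
  abstract
    solve : ∀ n (f : N-ary n (Expr ℤ₃ n) (Expr ℤ₃ n × Expr ℤ₃ n)) →
      Eqʰ n _≡_ (curryⁿ ⟦ proj₁ (Reflection.close n f) ⇓⟧) (curryⁿ ⟦ proj₂ (Reflection.close n f) ⇓⟧) →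
      Eq n _≡_ (curryⁿ ⟦ proj₁ (Reflection.close n f) ⟧) (curryⁿ ⟦ proj₂ (Reflection.close n f) ⟧)
    solve = Reflection.solve

-- Counting finite types and free cyclic actions

module FiniteCounting where

  private
    variable
      a b p ℓ : Level
      A B : Set a
      m n : ℕ

  -- If `j` were missed, deleting it from the codomain would leave an injection into a smaller set.
  injective⇒surjective : (f : Fin n → Fin n) → Injective _≡_ _≡_ f → ∀ j → ∃[ i ] f i ≡ j
  injective⇒surjective {suc n} f inj j with any? (λ i → f i ≟ᶠ j)
  ... | yes hit  = hit
  ... | no  miss = contradiction (λ {i k} → f′-injective {i} {k}) (<⇒notInjective (ℕ.n<1+n n))
    where
    j≢f : ∀ i → j ≢ f i
    j≢f i j≡fi = miss (i , sym j≡fi)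
    f′-injective : Injective _≡_ _≡_ (λ i → punchOut (j≢f i))
    f′-injective {i} {k} e = inj (punchOut-injective (j≢f i) (j≢f k) e)

  -- The length `k` is an output: its value becomes known only by comparison with a count of the
  -- whole type, as in `transversal`.
  enumerate : {P : Fin n → Set p} → Decidable P →
    ∃[ k ] Σ (Fin k → Fin n) λ h →
      Injective _≡_ _≡_ h × (∀ i → P (h i)) × (∀ j → P j → ∃[ i ] h i ≡ j)
  enumerate {n = zero}  P? = 0 , (λ ()) , (λ { {()} }) , (λ ()) , λ ()
  enumerate {n = suc n} {P = P} P? with enumerate (P? ∘ Fin.suc) | P? 0F
  ... | k , h , inj , sound , complete | no ¬P0 = k , Fin.suc ∘ h , inj ∘ suc-injectiveᶠ , sound , complete′
    where
    complete′ : ∀ j → P j → ∃[ i ] Fin.suc (h i) ≡ j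
    complete′ 0F          P0 = contradiction P0 ¬P0
    complete′ (Fin.suc j) Pj = map₂ (cong Fin.suc) (complete j Pj)
  ... | k , h , inj , sound , complete | yes P0 = suc k , h′ , inj′ , sound′ , complete′
    where
    h′ : Fin (suc k) → Fin (suc n)
    h′ 0F          = 0F
    h′ (Fin.suc i) = Fin.suc (h i)
    inj′ : Injective _≡_ _≡_ h′
    inj′ {0F}        {0F}        _ = refl
    inj′ {Fin.suc i} {Fin.suc j} e = cong Fin.suc (inj (suc-injectiveᶠ e))
    sound′ : ∀ i → P (h′ i)
    sound′ 0F          = P0
    sound′ (Fin.suc i) = sound i
    complete′ : ∀ j → P j → ∃[ i ] h′ i ≡ j
    complete′ 0F          _  = 0F , refl
    complete′ (Fin.suc j) Pj with complete j Pj
    ... | i , e = Fin.suc i , cong Fin.suc e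

  -- Sizes are proved from the parametrising side: `HasSize` wants a map out of the setoid, whereas
  -- representatives come as a map into it. Injectivity up to the setoid equality is what makes the
  -- inverse respect that equality.
  bijection⇒inverse : (S : Setoid a ℓ) → let open Setoid S in (f : B → Carrier) →
    (∀ {i j} → f i ≈ f j → i ≡ j) → (∀ s → ∃[ i ] f i ≈ s) → Inverse S (≡.setoid B)
  bijection⇒inverse S f inj surj = record
    { to        = λ s → proj₁ (surj s)
    ; from      = f
    ; to-cong   = λ {s} {t} s≈t → inj (S.trans (proj₂ (surj s)) (S.trans s≈t (S.sym (proj₂ (surj t)))))
    ; from-cong = λ { refl → S.refl }
    ; inverse   = (λ y≈fx → inj (S.trans (proj₂ (surj _)) y≈fx))
                , λ { {x} refl → proj₂ (surj x) }
    }
    where module S = Setoid S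

  suc↔Maybe : Fin (suc n) ↔ Maybe (Fin n)
  suc↔Maybe = mk↔ₛ′
    (λ { 0F → nothing ; (Fin.suc i) → just i })
    (λ { nothing → 0F ; (just i) → Fin.suc i })
    (λ { nothing → refl ; (just i) → refl })
    (λ { 0F → refl ; (Fin.suc i) → refl })

  Maybe-↔ : A ↔ B → Maybe A ↔ Maybe B
  Maybe-↔ A↔B = mk↔ₛ′
    (λ { nothing → nothing ; (just x) → just (to x) })
    (λ { nothing → nothing ; (just y) → just (from y) })
    (λ { nothing → refl ; (just y) → cong just (strictlyInverseˡ y) })
    (λ { nothing → refl ; (just x) → cong just (strictlyInverseʳ x) })
    where open Inverse A↔B

  module FiniteType (A↔Fin : A ↔ Fin n) where

    open Inverse A↔Fin public using () renaming (to to index; from to element)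

    index-injective : ∀ {x y} → index x ≡ index y → x ≡ y
    index-injective {x} {y} e = begin
      x                   ≡⟨ Inverse.strictlyInverseʳ A↔Fin x ⟨
      element (index x)   ≡⟨ cong element e ⟩
      element (index y)   ≡⟨ Inverse.strictlyInverseʳ A↔Fin y ⟩
      y                   ∎
      where open ≡-Reasoning

    element-injective : ∀ {i j} → element i ≡ element j → i ≡ j
    element-injective {i} {j} e = begin
      i                   ≡⟨ Inverse.strictlyInverseˡ A↔Fin i ⟨
      index (element i)   ≡⟨ cong index e ⟩
      index (element j)   ≡⟨ Inverse.strictlyInverseˡ A↔Fin j ⟩
      j                   ∎
      where open ≡-Reasoning

    element-index : ∀ x → element (index x) ≡ x
    element-index = Inverse.strictlyInverseʳ A↔Fin

    infix 4 _≟_ _≺_ _≺?_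

    _≟_ : DecidableEquality A
    x ≟ y = map′ index-injective (cong index) (index x ≟ᶠ index y)

    -- An arbitrary linear order carried over from the enumeration; it serves to choose one element
    -- in each orbit of a cyclic action.
    _≺_ : A → A → Set
    x ≺ y = index x Fin.< index y

    _≺?_ : ∀ x y → Dec (x ≺ y)
    x ≺? y = Fin.toℕ (index x) ℕ.<? Fin.toℕ (index y)

    ≺-asym : ∀ {x y} → x ≺ y → ¬ (y ≺ x)
    ≺-asym = ℕ.<-asym

    ≺-connex : ∀ x y → x ≢ y → x ≺ y ⊎ y ≺ x
    ≺-connex x y x≢y with ℕ.<-cmp (Fin.toℕ (index x)) (Fin.toℕ (index y))
    ... | tri< x≺y _ _ = inj₁ x≺y
    ... | tri> _ _ y≺x = inj₂ y≺x
    ... | tri≈ _ e _   = contradiction (index-injective (toℕ-injective e)) x≢y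

    search : {P : A → Set p} → Decidable P → Dec (∃[ x ] P x)
    search {P = P} P? = map′
      (λ (i , Pi) → element i , Pi)
      (λ (x , Px) → index x , subst P (sym (element-index x)) Px)
      (any? (P? ∘ element))

    endo-surjective : (f : A → A) → Injective _≡_ _≡_ f → ∀ y → ∃[ x ] f x ≡ y
    endo-surjective f inj y with injective⇒surjective (index ∘ f ∘ element)
      (element-injective ∘ inj ∘ index-injective) (index y)
    ... | i , e = element i , index-injective e

    -- act is thought of as the action of a cyclic group of order m that is free off
    -- the fixed point o, and P as the choice of one element in each free orbit.
    transversal : (o : A) {P : A → Set p} → Decidable P →
      (act act⁻ : Fin m → A → A) →
      (∀ j x → act j (act⁻ j x) ≡ x) → (∀ j x → act⁻ j (act j x) ≡ x) →
      (∀ j → ¬ P (act j o)) →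
      (∀ x → x ≢ o → ∃[ j ] P (act j x)) →
      (∀ x {i j} → P (act i x) → P (act j x) → i ≡ j) →
      ∃[ k ] n ≡ suc (k ℕ.* m) × Σ (Fin k → A) λ h →
        Injective _≡_ _≡_ h × (∀ i → P (h i)) × (∀ x → P x → ∃[ i ] h i ≡ x)
    transversal {m = m} o {P} P? act act⁻ act-act⁻ act⁻-act ¬Po meets unique
      with enumerate (P? ∘ element)
    ... | k , h , h-inj , sound , complete =
      k , sym (Perm.↔⇒≡ suc[k*m]↔n) , element ∘ h , h-inj ∘ element-injective , sound , complete′
      where
      complete′ : ∀ x → P x → ∃[ i ] element (h i) ≡ x
      complete′ x Px = map₂ (λ e → trans (cong element e) (element-index x))
        (complete (index x) (subst P (sym (element-index x)) Px))

      P-act : ∀ i j → P (act j (act⁻ j (element (h i))))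
      P-act i j = subst P (sym (act-act⁻ j _)) (sound i)

      -- Every element other than `o` is a translate of exactly one chosen element by exactly one
      -- group element, so 1 + k m elements are matched with `A`.
      g : Maybe (Fin k × Fin m) → A
      g nothing        = o
      g (just (i , j)) = act⁻ j (element (h i))

      g-injective : ∀ {u v} → g u ≡ g v → u ≡ v
      g-injective {nothing}      {nothing}      _ = refl
      g-injective {nothing}      {just (i , j)} e = ⊥-elim (¬Po j (subst (P ∘ act j) (sym e) (P-act i j)))
      g-injective {just (i , j)} {nothing}      e = ⊥-elim (¬Po j (subst (P ∘ act j) e (P-act i j)))
      g-injective {just (i , j)} {just (i′ , j′)} e
        with unique (g (just (i , j))) (P-act i j) (subst (P ∘ act j′) (sym e) (P-act i′ j′))
      ... | refl with h-inj (element-injective (begin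
            element (h i)                    ≡⟨ act-act⁻ j _ ⟨
            act j (act⁻ j (element (h i)))   ≡⟨ cong (act j) e ⟩
            act j (act⁻ j (element (h i′)))  ≡⟨ act-act⁻ j _ ⟩
            element (h i′)                   ∎))
        where open ≡-Reasoning
      ... | refl = refl

      g-surjective : ∀ x → ∃[ u ] g u ≡ x
      g-surjective x with x ≟ o
      ... | yes x≡o = nothing , sym x≡o
      ... | no  x≢o with meets x x≢o
      ... | j , Pjx with complete′ (act j x) Pjx
      ... | i , e = just (i , j) , trans (cong (act⁻ j) e) (act⁻-act j x)

      suc[k*m]↔n : Fin (suc (k ℕ.* m)) ↔ Fin n
      suc[k*m]↔n = Compose.inverse suc↔Maybe (Compose.inverse (Maybe-↔ *↔×)
        (Compose.inverse (Symmetry.inverse (bijection⇒inverse (≡.setoid A) g g-injective g-surjective)) A↔Fin))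

open FiniteCounting

-- The characteristic from the size of the field

-- Cauchy's argument: if 3 ≠ 0, then σ (x , y) = (y , - (x + y)) has order 3 on F × F and
-- fixes only the origin, so that q² ≡ 1 (mod 3).
module Cauchy {c : Level} {q : ℕ} (𝔽 : FiniteField c q) where

  open FiniteField 𝔽
  open CommutativeRing commutativeRing
    using (ring; +-assoc; +-comm; +-identityˡ; +-identityʳ; *-identityˡ; *-assoc; *-comm;
           distribʳ; zeroʳ; -‿inverseˡ; -‿inverseʳ)
  open RingProperties ring using (-‿involutive; -‿+-comm)
  open ≡-Reasoning

  pairs : (Carrier × Carrier) ↔ Fin (q ℕ.* q)
  pairs = Compose.inverse (enumeration ×-↔ enumeration) (Symmetry.inverse *↔×)

  open FiniteType pairs

  σ σ² : Carrier × Carrier → Carrier × Carrier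
  σ (x , y) = y , - (x + y)
  σ² = σ ∘ σ

  -x+y+x : ∀ x y → - (x + y) + x ≡ - y
  -x+y+x x y = begin
    - (x + y) + x        ≡⟨ cong (_+ x) (-‿+-comm x y) ⟨
    - x + - y + x        ≡⟨ cong (_+ x) (+-comm (- x) (- y)) ⟩
    - y + - x + x        ≡⟨ +-assoc (- y) (- x) x ⟩
    - y + (- x + x)      ≡⟨ cong (- y +_) (-‿inverseˡ x) ⟩
    - y + 0#             ≡⟨ +-identityʳ (- y) ⟩
    - y                  ∎

  y-x+y : ∀ x y → - (y + - (x + y)) ≡ x
  y-x+y x y = begin
    - (y + - (x + y))    ≡⟨ cong -_ (+-comm y (- (x + y))) ⟩
    - (- (x + y) + y)    ≡⟨ cong (λ z → - (- z + y)) (+-comm x y) ⟩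
    - (- (y + x) + y)    ≡⟨ cong -_ (-x+y+x y x) ⟩
    - - x                ≡⟨ -‿involutive x ⟩
    x                    ∎

  σσ² : ∀ z → σ (σ² z) ≡ z
  σσ² (x , y) = cong₂ _,_ (y-x+y x y) (begin
    - (- (x + y) + - (y + - (x + y)))  ≡⟨ cong (λ z → - (- (x + y) + z)) (y-x+y x y) ⟩
    - (- (x + y) + x)                  ≡⟨ cong -_ (-x+y+x x y) ⟩
    - - y                              ≡⟨ -‿involutive y ⟩
    y                                  ∎)

  act act⁻ : Fin 3 → Carrier × Carrier → Carrier × Carrier
  act 0F  = id
  act 1F  = σ
  act 2F  = σ²
  act⁻ 0F = id
  act⁻ 1F = σ²
  act⁻ 2F = σ

  act-act⁻ : ∀ j z → act j (act⁻ j z) ≡ z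
  act-act⁻ 0F z = refl
  act-act⁻ 1F z = σσ² z
  act-act⁻ 2F z = σσ² z

  act⁻-act : ∀ j z → act⁻ j (act j z) ≡ z
  act⁻-act 0F z = refl
  act⁻-act 1F z = σσ² z
  act⁻-act 2F z = σσ² z

  Least : Carrier × Carrier → Set
  Least z = z ≺ σ z × z ≺ σ² z

  Least? : Decidable Least
  Least? z = (z ≺? σ z) ×-dec (z ≺? σ² z)

  Least-act : ∀ j z → Least (act j z) → ∀ i → i ≢ j → act j z ≺ act i z
  Least-act 0F z (p , r) 0F i≢j = contradiction refl i≢j
  Least-act 0F z (p , r) 1F i≢j = p
  Least-act 0F z (p , r) 2F i≢j = r
  Least-act 1F z (p , r) 0F i≢j = subst (σ z ≺_) (σσ² z) r
  Least-act 1F z (p , r) 1F i≢j = contradiction refl i≢j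
  Least-act 1F z (p , r) 2F i≢j = p
  Least-act 2F z (p , r) 0F i≢j = subst (σ² z ≺_) (σσ² z) p
  Least-act 2F z (p , r) 1F i≢j = subst (σ² z ≺_) (cong σ (σσ² z)) r
  Least-act 2F z (p , r) 2F i≢j = contradiction refl i≢j

  Least-unique : ∀ z {i j} → Least (act i z) → Least (act j z) → i ≡ j
  Least-unique z {i} {j} p r with i ≟ᶠ j
  ... | yes i≡j = i≡j
  ... | no  i≢j = contradiction (Least-act j z r i i≢j) (≺-asym (Least-act i z p j (i≢j ∘ sym)))

  -- Since σ is a bijection, z ≠ σ z makes all three orbit elements distinct. Comparing neighbours
  -- around the orbit, three comparisons in the same direction would form a cycle, so some element
  -- lies below both others.
  Least-exists : ∀ z → z ≢ σ z → ∃[ j ] Least (act j z)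
  Least-exists z z≢σz
    with ≺-connex z (σ z) z≢σz
       | ≺-connex (σ z) (σ² z) (λ e → z≢σz (trans (sym (σσ² z)) (trans (cong σ² e) (cong σ (σσ² z)))))
       | ≺-connex (σ² z) z (λ e → z≢σz (trans (sym (σσ² z)) (cong σ e)))
  ... | inj₁ p | inj₁ r | inj₁ s = contradiction s (≺-asym (ℕ.<-trans p r))
  ... | inj₁ p | inj₂ r | inj₁ s = 2F , subst (σ² z ≺_) (sym (σσ² z)) s , subst (σ² z ≺_) (sym (cong σ (σσ² z))) r
  ... | inj₁ p | _      | inj₂ s = 0F , p , s
  ... | inj₂ p | inj₁ r | _      = 1F , r , subst (σ z ≺_) (sym (σσ² z)) p
  ... | inj₂ p | inj₂ r | inj₁ s = 2F , subst (σ² z ≺_) (sym (σσ² z)) s , subst (σ² z ≺_) (sym (cong σ (σσ² z))) r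
  ... | inj₂ p | inj₂ r | inj₂ s = contradiction p (≺-asym (ℕ.<-trans s r))

  -- A fixed pair has x = y and y = - 2 y, so 3 y = 0, and 3 is then invertible.
  fixed⇒0 : 1# + 1# + 1# ≢ 0# → ∀ z → z ≡ σ z → z ≡ (0# , 0#)
  fixed⇒0 3≢0 (x , y) e = cong₂ _,_ (trans x≡y y≡0) y≡0
    where
    x≡y : x ≡ y
    x≡y = cong proj₁ e
    3y≡0 : (1# + 1# + 1#) * y ≡ 0#
    3y≡0 = begin
      (1# + 1# + 1#) * y         ≡⟨ distribʳ y (1# + 1#) 1# ⟩
      (1# + 1#) * y + 1# * y     ≡⟨ cong (_+ 1# * y) (distribʳ y 1# 1#) ⟩
      1# * y + 1# * y + 1# * y   ≡⟨ cong (λ u → u + u + u) (*-identityˡ y) ⟩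
      y + y + y                  ≡⟨ cong (y + y +_) (cong proj₂ e) ⟩
      y + y + - (x + y)          ≡⟨ cong (λ u → y + y + - (u + y)) x≡y ⟩
      y + y + - (y + y)          ≡⟨ -‿inverseʳ (y + y) ⟩
      0#                         ∎
    y≡0 : y ≡ 0#
    y≡0 with inverse (1# + 1# + 1#) 3≢0
    ... | 3⁻¹ , 33⁻¹≡1 = begin
      y                            ≡⟨ *-identityˡ y ⟨
      1# * y                       ≡⟨ cong (_* y) (trans (*-comm 3⁻¹ _) 33⁻¹≡1) ⟨
      3⁻¹ * (1# + 1# + 1#) * y     ≡⟨ *-assoc 3⁻¹ _ y ⟩
      3⁻¹ * ((1# + 1# + 1#) * y)   ≡⟨ cong (3⁻¹ *_) 3y≡0 ⟩
      3⁻¹ * 0#                     ≡⟨ zeroʳ 3⁻¹ ⟩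
      0#                           ∎

  σ0 : σ (0# , 0#) ≡ (0# , 0#)
  σ0 = cong (0# ,_) (trans (sym (+-identityʳ _)) (-x+y+x 0# 0# ⟨ trans ⟩ -0≡0))
    where
    -0≡0 : - 0# ≡ 0#
    -0≡0 = trans (sym (+-identityˡ _)) (-‿inverseʳ 0#)

  ¬Least0 : ∀ j → ¬ Least (act j (0# , 0#))
  ¬Least0 0F (p , _) = ℕ.<-irrefl refl (subst ((0# , 0#) ≺_) σ0 p)
  ¬Least0 1F (p , _) = ℕ.<-irrefl refl (subst (σ (0# , 0#) ≺_) (cong σ σ0) p)
  ¬Least0 2F (p , _) = ℕ.<-irrefl refl (subst (σ² (0# , 0#) ≺_) (cong σ² σ0) p)

  3∣q⇒1+1+1≡0 : 3 ∣ q → 1# + 1# + 1# ≡ 0#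
  3∣q⇒1+1+1≡0 3∣q with FiniteType._≟_ enumeration (1# + 1# + 1#) 0#
  ... | yes 3≡0 = 3≡0
  ... | no  3≢0
    with transversal (0# , 0#) Least? act act⁻ act-act⁻ act⁻-act ¬Least0
           (λ z z≢0 → Least-exists z (z≢0 ∘ fixed⇒0 3≢0 z)) Least-unique
  ... | k , q²≡1+3k , _ = contradiction (∣1⇒≡1 3∣1) λ ()
    where
    3∣1 : 3 ∣ 1
    -- 3 divides both q² = 3 k + 1 and 3 k.
    3∣1 = ∣m+n∣m⇒∣n (subst (3 ∣_) (trans q²≡1+3k (ℕ.+-comm 1 (k ℕ.* 3))) (∣m⇒∣m*n q 3∣q)) (n∣m*n k)

-- Cubes, squares and polynomials over a finite field of characteristic 3

module FieldArithmetic {c : Level} {q : ℕ} (𝔽 : FiniteField c q)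
  (1+1+1≡0 : CharacteristicThree 𝔽) where

  open FiniteField 𝔽
  open CommutativeRing commutativeRing public
    using (+-identityʳ; *-identityˡ; *-identityʳ; zeroˡ; zeroʳ;
           *-assoc; *-comm; +-comm; -‿inverseʳ; ring)
  open RingProperties ring public using (-0#≈0#; -‿involutive)
  open TwistedCubic 𝔽 using (*-nonzero; inverse-nonzero; NonSquare)
  open CharacteristicThreeSolver 𝔽 1+1+1≡0 public using (solve; _⊜_)
  open FiniteType enumeration public
  open ≡-Reasoning

  abstract
    -- A certificate of ideal membership: x - y is exhibited as a combination of the differences of
    -- the two sides of known equations. The multipliers are found by hand, and the remaining
    -- polynomial identity goes to the solver. Most equations below are derived in this way.
    combine₁ : ∀ {x y p₁ q₁} k₁ → p₁ ≡ q₁ → x ≡ y + k₁ * (p₁ + - q₁) → x ≡ y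
    combine₁ {x} {y} {p₁} k₁ refl e = begin
      x                         ≡⟨ e ⟩
      y + k₁ * (p₁ + - p₁)      ≡⟨ cong (λ z → y + k₁ * z) (-‿inverseʳ p₁) ⟩
      y + k₁ * 0#               ≡⟨ cong (y +_) (zeroʳ k₁) ⟩
      y + 0#                    ≡⟨ +-identityʳ y ⟩
      y                         ∎

  combine₂ : ∀ {x y p₁ q₁ p₂ q₂} k₁ k₂ → p₁ ≡ q₁ → p₂ ≡ q₂ →
    x ≡ y + k₁ * (p₁ + - q₁) + k₂ * (p₂ + - q₂) → x ≡ y
  combine₂ k₁ k₂ h₁ h₂ e = combine₁ k₁ h₁ (combine₁ k₂ h₂ e)

  combine₃ : ∀ {x y p₁ q₁ p₂ q₂ p₃ q₃} k₁ k₂ k₃ → p₁ ≡ q₁ → p₂ ≡ q₂ → p₃ ≡ q₃ →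
    x ≡ y + k₁ * (p₁ + - q₁) + k₂ * (p₂ + - q₂) + k₃ * (p₃ + - q₃) → x ≡ y
  combine₃ k₁ k₂ k₃ h₁ h₂ h₃ e = combine₁ k₁ h₁ (combine₂ k₂ k₃ h₂ h₃ e)

  no-zero-divisors : ∀ {x y} → x * y ≡ 0# → x ≡ 0# ⊎ y ≡ 0#
  no-zero-divisors {x} {y} xy≡0 with x ≟ 0# | y ≟ 0#
  ... | yes x≡0 | _       = inj₁ x≡0
  ... | no  _   | yes y≡0 = inj₂ y≡0
  ... | no  x≢0 | no  y≢0 = contradiction xy≡0 (*-nonzero x≢0 y≢0)

  cofactor-zero : ∀ {x y} → x ≢ 0# → x * y ≡ 0# → y ≡ 0#
  cofactor-zero x≢0 xy≡0 with no-zero-divisors xy≡0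
  ... | inj₁ x≡0 = contradiction x≡0 x≢0
  ... | inj₂ y≡0 = y≡0

  factor≢0ʳ : ∀ {x y} → x * y ≢ 0# → y ≢ 0#
  factor≢0ʳ {x} xy≢0 refl = xy≢0 (zeroʳ x)

  difference-zero : ∀ {x y} → x + - y ≡ 0# → x ≡ y
  difference-zero {x} {y} e = combine₁ 1# e
    (solve 2 (λ x y → x ⊜ y ⊕ Κ z1 ⊗ (x ⊕ ⊝ y ⊕ ⊝ Κ z0)) refl x y)

  *-cancelˡ : ∀ {k x y} → k ≢ 0# → k * x ≡ k * y → x ≡ y
  *-cancelˡ {k} {x} {y} k≢0 e = difference-zero (cofactor-zero k≢0 (combine₁ 1# e
    (solve 3 (λ k x y → k ⊗ (x ⊕ ⊝ y) ⊜ Κ z0 ⊕ Κ z1 ⊗ (k ⊗ x ⊕ ⊝ (k ⊗ y))) refl k x y)))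

  cube≡0 : ∀ {x} → x * x * x ≡ 0# → x ≡ 0#
  cube≡0 e with no-zero-divisors e
  ... | inj₂ x≡0  = x≡0
  ... | inj₁ xx≡0 = [ id , id ]′ (no-zero-divisors xx≡0)

  -- Frobenius: in characteristic 3 the cube of x - y is x³ - y³.
  cube-injective : ∀ {x y} → x * x * x ≡ y * y * y → x ≡ y
  cube-injective {x} {y} e = difference-zero (cube≡0 (combine₁ 1# e
    (solve 2 (λ x y → let d = x ⊕ ⊝ y in
      d ⊗ d ⊗ d ⊜ Κ z0 ⊕ Κ z1 ⊗ (x ⊗ x ⊗ x ⊕ ⊝ (y ⊗ y ⊗ y))) refl x y)))

  abstract
    -- Frobenius is onto because the field is finite. These roots turn the outer coordinates of a
    -- vector into the parameters of a cubic point.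
    cubeRoot : ∀ x → ∃[ y ] y * y * y ≡ x
    cubeRoot = endo-surjective (λ y → y * y * y) cube-injective

  ≡± : ∀ {x y} → x * x ≡ y * y → x ≡ y ⊎ x ≡ - y
  ≡± {x} {y} e with no-zero-divisors {x + - y} {x + y} (combine₁ 1# e
    (solve 2 (λ x y → (x ⊕ ⊝ y) ⊗ (x ⊕ y) ⊜ Κ z0 ⊕ Κ z1 ⊗ (x ⊗ x ⊕ ⊝ (y ⊗ y))) refl x y))
  ... | inj₁ x-y≡0 = inj₁ (difference-zero x-y≡0)
  ... | inj₂ x+y≡0 = inj₂ (difference-zero (trans (cong (x +_) (-‿involutive y)) x+y≡0))

  x≡-x⇒x≡0 : ∀ {x} → x ≡ - x → x ≡ 0#
  x≡-x⇒x≡0 {x} e = combine₁ (- 1#) e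
    (solve 1 (λ x → x ⊜ Κ z0 ⊕ ⊝ Κ z1 ⊗ (x ⊕ ⊝ (⊝ x))) refl x)

  1≢-1 : 1# ≢ - 1#
  1≢-1 = 1≢0 ∘ x≡-x⇒x≡0

  -- A choice of one element from each pair x, - x with x ≠ 0, made by the enumeration order; no
  -- compatibility with the field operations is intended.
  Positive : Carrier → Set
  Positive x = x ≺ - x

  Positive? : Decidable Positive
  Positive? x = x ≺? - x

  ¬Positive-0 : ¬ Positive 0#
  ¬Positive-0 p = ℕ.<-irrefl refl (subst (0# ≺_) -0#≈0# p)

  Positive⇒≢0 : ∀ {x} → Positive x → x ≢ 0#
  Positive⇒≢0 p refl = ¬Positive-0 p

  Positive-neg : ∀ {x} → Positive (- x) → - x ≺ x
  Positive-neg {x} = subst (- x ≺_) (-‿involutive x)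

  ± : Fin 2 → Carrier → Carrier
  ± 0F x = x
  ± 1F x = - x

  abstract
    -- Negation moves every nonzero element because 2 ≠ 0, so it is a free action of a group of
    -- order 2 off 0. Hence there are k = (q - 1) / 2 chosen elements, the factor that makes the two
    -- small orbits half as large.
    signs : ∃[ k ] q ≡ suc (k ℕ.* 2) × Σ (Fin k → Carrier) λ h →
      Injective _≡_ _≡_ h × (∀ i → Positive (h i)) × (∀ x → Positive x → ∃[ i ] h i ≡ x)
    signs = transversal 0# Positive? ± ± ±± ±± ¬P0 meets unique
      where
      ±± : ∀ j x → ± j (± j x) ≡ x
      ±± 0F x = refl
      ±± 1F x = -‿involutive x
      ¬P0 : ∀ j → ¬ Positive (± j 0#)
      ¬P0 0F = ¬Positive-0
      ¬P0 1F = ¬Positive-0 ∘ subst Positive -0#≈0#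
      meets : ∀ x → x ≢ 0# → ∃[ j ] Positive (± j x)
      meets x x≢0 with ≺-connex x (- x) (x≢0 ∘ x≡-x⇒x≡0)
      ... | inj₁ x≺-x = 0F , x≺-x
      ... | inj₂ -x≺x = 1F , subst (- x ≺_) (sym (-‿involutive x)) -x≺x
      unique : ∀ x {i j} → Positive (± i x) → Positive (± j x) → i ≡ j
      unique x {0F} {0F} p r = refl
      unique x {1F} {1F} p r = refl
      unique x {0F} {1F} p r = contradiction (Positive-neg r) (≺-asym p)
      unique x {1F} {0F} p r = contradiction (Positive-neg p) (≺-asym r)

  square-injective-on-Positive : ∀ {x y} → Positive x → Positive y → x * x ≡ y * y → x ≡ y
  square-injective-on-Positive {x} {y} p r e with ≡± e
  ... | inj₁ x≡y  = x≡y
  ... | inj₂ refl = contradiction (Positive-neg p) (≺-asym r)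

  abstract
    square-of-Positive : ∀ {x} → x ≢ 0# → ∃[ y ] Positive y × y * y ≡ x * x
    square-of-Positive {x} x≢0 with ≺-connex x (- x) (x≢0 ∘ x≡-x⇒x≡0)
    ... | inj₁ x≺-x = x , x≺-x , refl
    ... | inj₂ -x≺x = - x , subst (- x ≺_) (sym (-‿involutive x)) -x≺x ,
      solve 1 (λ x → ⊝ x ⊗ ⊝ x ⊜ x ⊗ x) refl x

  NonSquare? : Decidable NonSquare
  NonSquare? ρ = map′ (λ ¬e y yy≡ρ → ¬e (y , yy≡ρ)) (λ ns (y , yy≡ρ) → ns y yy≡ρ)
    (¬? (search (λ y → (y * y) ≟ ρ)))

  abstract
    -- If every element had a root, choosing one would be an injective, hence surjective, map. Both
    -- 1 and - 1 would then be chosen roots, and each could only be the root chosen for 1.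
    nonsquare-exists : ∃[ ρ ] NonSquare ρ
    nonsquare-exists with search NonSquare?
    ... | yes found = found
    ... | no  ¬found = contradiction (trans (sym (fixes 1# 1*1)) (fixes (- 1#) -1*-1)) 1≢-1
      where
      root : ∀ x → ∃[ y ] y * y ≡ x
      root x with search (λ y → (y * y) ≟ x)
      ... | yes e = e
      ... | no ¬e = contradiction (x , λ y yy≡x → ¬e (y , yy≡x)) ¬found
      √-injective : Injective _≡_ _≡_ (proj₁ ∘ root)
      √-injective {x} {y} e = trans (sym (proj₂ (root x))) (trans (cong (λ z → z * z) e) (proj₂ (root y)))
      1*1 : 1# * 1# ≡ 1#
      1*1 = *-identityˡ 1#
      -1*-1 : - 1# * - 1# ≡ 1#
      -1*-1 = solve 0 (⊝ Κ z1 ⊗ ⊝ Κ z1 ⊜ Κ z1) refl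
      fixes : ∀ x → x * x ≡ 1# → proj₁ (root 1#) ≡ x
      fixes x xx≡1 with endo-surjective (proj₁ ∘ root) √-injective x
      ... | y , refl = cong (proj₁ ∘ root) (trans (sym xx≡1) (proj₂ (root y)))

  -- x ↦ x² on Positive elements and x ↦ ρ x² on the others is injective, hence surjective.
  abstract
    square-classes : ∀ {ρ} → NonSquare ρ → ∀ w → ∃[ e ] (w ≡ e * e ⊎ w ≡ ρ * (e * e))
    square-classes {ρ} ns w = classify w (endo-surjective f f-injective w)
      where
      select : ∀ x → Dec (Positive x) → Carrier
      select x (yes _) = x * x
      select x (no  _) = ρ * (x * x)
      f : Carrier → Carrier
      f x = select x (Positive? x)
      square≢ρ*square : ∀ {x y} → x ≢ 0# → x * x ≢ ρ * (y * y)
      square≢ρ*square {x} {y} x≢0 e with y ≟ 0#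
      ... | yes refl = *-nonzero x≢0 x≢0 (trans e (trans (cong (ρ *_) (zeroˡ 0#)) (zeroʳ ρ)))
      ... | no  y≢0 with inverse y y≢0
      -- Otherwise ρ would be the square of x / y.
      ... | y⁻¹ , yy⁻¹≡1 = ns (x * y⁻¹) (combine₂ (y⁻¹ * y⁻¹) (ρ * (y * y⁻¹ + 1#)) e yy⁻¹≡1
        (solve 4 (λ x y y⁻¹ ρ → x ⊗ y⁻¹ ⊗ (x ⊗ y⁻¹) ⊜
          ρ ⊕ y⁻¹ ⊗ y⁻¹ ⊗ (x ⊗ x ⊕ ⊝ (ρ ⊗ (y ⊗ y))) ⊕ ρ ⊗ (y ⊗ y⁻¹ ⊕ Κ z1) ⊗ (y ⊗ y⁻¹ ⊕ ⊝ Κ z1))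
          refl x y y⁻¹ ρ))
      ρ≢0 : ρ ≢ 0#
      ρ≢0 refl = ns 0# (zeroˡ 0#)
      select-injective : ∀ x y (px : Dec (Positive x)) (py : Dec (Positive y)) →
        select x px ≡ select y py → x ≡ y
      select-injective x y (yes px) (yes py) e = square-injective-on-Positive px py e
      select-injective x y (yes px) (no _)   e = contradiction e (square≢ρ*square (Positive⇒≢0 px))
      select-injective x y (no _)   (yes py) e = contradiction (sym e) (square≢ρ*square (Positive⇒≢0 py))
      select-injective x y (no ¬px) (no ¬py) e with ≡± (*-cancelˡ ρ≢0 e)
      ... | inj₁ x≡y  = x≡y
      -- One of y and - y is positive unless y = 0, so here both arguments are 0.
      ... | inj₂ refl with y ≟ 0#
      ...   | yes refl = -0#≈0#
      ...   | no  y≢0 with ≺-connex y (- y) (y≢0 ∘ x≡-x⇒x≡0)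
      ...     | inj₁ y≺-y = contradiction y≺-y ¬py
      ...     | inj₂ -y≺y = contradiction (subst (- y ≺_) (sym (-‿involutive y)) -y≺y) ¬px
      f-injective : Injective _≡_ _≡_ f
      f-injective {x} {y} = select-injective x y (Positive? x) (Positive? y)
      classify : ∀ w → ∃[ x ] f x ≡ w → ∃[ e ] (w ≡ e * e ⊎ w ≡ ρ * (e * e))
      classify w (e , fe≡w) with Positive? e
      ... | yes _ = e , inj₁ (sym fe≡w)
      ... | no  _ = e , inj₂ (sym fe≡w)

  -- Polynomials are lists of coefficients, constant term first.
  eval : List Carrier → Carrier → Carrier
  eval []       x = 0#
  eval (a ∷ as) x = a + x * eval as x

  -- quotient r as is (x · as(x) − r · as(r)) / (x − r).
  quotient : Carrier → List Carrier → List Carrier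
  quotient r []       = []
  quotient r (a ∷ as) = eval (a ∷ as) r ∷ quotient r as

  length-quotient : ∀ r as → length (quotient r as) ≡ length as
  length-quotient r []       = refl
  length-quotient r (a ∷ as) = cong suc (length-quotient r as)

  eval-quotient : ∀ r as x → x * eval as x + - (r * eval as r) ≡ (x + - r) * eval (quotient r as) x
  eval-quotient r []       x =
    solve 2 (λ x r → x ⊗ Κ z0 ⊕ ⊝ (r ⊗ Κ z0) ⊜ (x ⊕ ⊝ r) ⊗ Κ z0) refl x r
  eval-quotient r (a ∷ as) x = combine₁ x (eval-quotient r as x)
    (solve 6 (λ a x r s t u → x ⊗ (a ⊕ x ⊗ s) ⊕ ⊝ (r ⊗ (a ⊕ r ⊗ t)) ⊜
      (x ⊕ ⊝ r) ⊗ (a ⊕ r ⊗ t ⊕ x ⊗ u) ⊕ x ⊗ (x ⊗ s ⊕ ⊝ (r ⊗ t) ⊕ ⊝ ((x ⊕ ⊝ r) ⊗ u)))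
      refl a x r (eval as x) (eval as r) (eval (quotient r as) x))

  eval-zero : ∀ {as} x → All (_≡ 0#) as → eval as x ≡ 0#
  eval-zero x []            = refl
  eval-zero x (refl ∷ as≡0) = trans (cong (λ z → 0# + x * z) (eval-zero x as≡0))
    (solve 1 (λ x → Κ z0 ⊕ x ⊗ Κ z0 ⊜ Κ z0) refl x)

  constant-term-zero : ∀ {a as} r → eval (a ∷ as) r ≡ 0# → All (_≡ 0#) as → a ≡ 0#
  constant-term-zero {a} {as} r e as≡0 = combine₂ 1# (- r) e (eval-zero r as≡0)
    (solve 3 (λ a r s → a ⊜ Κ z0 ⊕ Κ z1 ⊗ (a ⊕ r ⊗ s ⊕ ⊝ Κ z0) ⊕ ⊝ r ⊗ (s ⊕ ⊝ Κ z0)) refl a r (eval as r))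

  -- The coefficients of the quotient depend on those of `as` in a unitriangular way, so vanishing
  -- is recovered from the last coefficient backwards.
  quotient-zero : ∀ r as → All (_≡ 0#) (quotient r as) → All (_≡ 0#) as
  quotient-zero r []       []        = []
  quotient-zero r (a ∷ as) (e ∷ es) = constant-term-zero r e as≡0 ∷ as≡0
    where as≡0 = quotient-zero r as es

  -- A root r can be divided out: the values of the polynomial at x and at r differ by (x - r) times
  -- the quotient, so every other root is a root of the quotient, which has one coefficient fewer.
  coefficients-zero : ∀ n as → length as ≤ n → (f : Fin n → Carrier) → Injective _≡_ _≡_ f →
    (∀ i → eval as (f i) ≡ 0#) → All (_≡ 0#) as
  coefficients-zero n       []       _           f inj roots = []
  coefficients-zero (suc n) (a ∷ as) (ℕ.s≤s |as|≤n) f inj roots =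
    constant-term-zero r (roots 0F) as≡0 ∷ as≡0
    where
    r = f 0F
    roots′ : ∀ i → eval (quotient r as) (f (Fin.suc i)) ≡ 0#
    roots′ i = cofactor-zero x≢r (trans (sym (eval-quotient r as x))
      (combine₂ 1# (- 1#) (roots (Fin.suc i)) (roots 0F)
        (solve 5 (λ a x r s t → x ⊗ s ⊕ ⊝ (r ⊗ t) ⊜ Κ z0 ⊕ Κ z1 ⊗ (a ⊕ x ⊗ s ⊕ ⊝ Κ z0)
          ⊕ ⊝ Κ z1 ⊗ (a ⊕ r ⊗ t ⊕ ⊝ Κ z0)) refl a x r (eval as x) (eval as r))))
      where
      x = f (Fin.suc i)
      x≢r : x + - r ≢ 0#
      x≢r e with inj (difference-zero e)
      ... | ()
    as≡0 : All (_≡ 0#) as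
    as≡0 = quotient-zero r as (coefficients-zero n (quotient r as)
      (subst (_≤ n) (sym (length-quotient r as)) |as|≤n) (f ∘ Fin.suc) (suc-injectiveᶠ ∘ inj) roots′)

  vanishing-polynomial : ∀ as → length as ≤ q → (∀ x → eval as x ≡ 0#) → ∀ i → lookup as i ≡ 0#
  vanishing-polynomial as |as|≤q roots i = All.lookup
    (coefficients-zero q as |as|≤q element element-injective (λ j → roots (element j))) (∈-lookup i)

-- The matrices of the group of the twisted cubic

module CubicGroup {c : Level} {q : ℕ} (𝔽 : FiniteField c q)
  (1+1+1≡0 : CharacteristicThree 𝔽) where

  open FiniteField 𝔽
  open FieldArithmetic 𝔽 1+1+1≡0
  open TwistedCubic 𝔽 renaming (_⊗_ to _⊗ᴹ_)
  open ≡-Reasoning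

  det : F → F → F → F → F
  det a b c d = a * d + - (b * c)

  -- The point of the cubic with parameter s / t.
  v : F → F → Vec⁴
  v s t = ⟨ s * s * s , s * s * t , s * (t * t) , t * t * t ⟩

  axial : F → F → Vec⁴
  axial u₁ u₂ = ⟨ 0# , u₁ , u₂ , 0# ⟩

  -- The general matrix of G_q, simplified by 3 = 0.
  𝕄 : F → F → F → F → Mat⁴
  𝕄 a b c d =
    ⟨ v a c
    , axial (a * det a b c d) (- (c * det a b c d))
    , axial (- (b * det a b c d)) (d * det a b c d)
    , v b d
    ⟩

  detᴱ : ∀ {n} (a b c d : Expr ℤ₃ n) → Expr ℤ₃ n
  detᴱ a b c d = a ⊗ d ⊕ ⊝ (b ⊗ c)

  -- The shape to which the sum in `_·_` unfolds, down to its final zero, so that solver goals match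
  -- the matrix products definitionally.
  dotᴱ : ∀ {n} (x₀ x₁ x₂ x₃ y₀ y₁ y₂ y₃ : Expr ℤ₃ n) → Expr ℤ₃ n
  dotᴱ x₀ x₁ x₂ x₃ y₀ y₁ y₂ y₃ = x₀ ⊗ y₀ ⊕ (x₁ ⊗ y₁ ⊕ (x₂ ⊗ y₂ ⊕ (x₃ ⊗ y₃ ⊕ Κ z0)))

  -- `𝕄` is the symmetric cube of the two by two matrix: its columns come from expanding the cubic
  -- monomials in a s + b t and c s + d t, with 3 = 0.
  v·𝕄 : ∀ s t a b c d → v s t · 𝕄 a b c d ≗ v (a * s + b * t) (c * s + d * t)
  v·𝕄 s t a b c d = λ
    { 0F → solve 6 (λ s t a b c d → let s′ = a ⊗ s ⊕ b ⊗ t in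
        dotᴱ (s ⊗ s ⊗ s) (s ⊗ s ⊗ t) (s ⊗ (t ⊗ t)) (t ⊗ t ⊗ t) (a ⊗ a ⊗ a) (Κ z0) (Κ z0) (b ⊗ b ⊗ b)
        ⊜ s′ ⊗ s′ ⊗ s′) refl s t a b c d
    ; 1F → solve 6 (λ s t a b c d → let s′ = a ⊗ s ⊕ b ⊗ t ; t′ = c ⊗ s ⊕ d ⊗ t ; D = detᴱ a b c d in
        dotᴱ (s ⊗ s ⊗ s) (s ⊗ s ⊗ t) (s ⊗ (t ⊗ t)) (t ⊗ t ⊗ t) (a ⊗ a ⊗ c) (a ⊗ D) (⊝ (b ⊗ D)) (b ⊗ b ⊗ d)
        ⊜ s′ ⊗ s′ ⊗ t′) refl s t a b c d
    ; 2F → solve 6 (λ s t a b c d → let s′ = a ⊗ s ⊕ b ⊗ t ; t′ = c ⊗ s ⊕ d ⊗ t ; D = detᴱ a b c d in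
        dotᴱ (s ⊗ s ⊗ s) (s ⊗ s ⊗ t) (s ⊗ (t ⊗ t)) (t ⊗ t ⊗ t) (a ⊗ (c ⊗ c)) (⊝ (c ⊗ D)) (d ⊗ D) (b ⊗ (d ⊗ d))
        ⊜ s′ ⊗ (t′ ⊗ t′)) refl s t a b c d
    ; 3F → solve 6 (λ s t a b c d → let t′ = c ⊗ s ⊕ d ⊗ t in
        dotᴱ (s ⊗ s ⊗ s) (s ⊗ s ⊗ t) (s ⊗ (t ⊗ t)) (t ⊗ t ⊗ t) (c ⊗ c ⊗ c) (Κ z0) (Κ z0) (d ⊗ d ⊗ d)
        ⊜ t′ ⊗ t′ ⊗ t′) refl s t a b c d
    }

  -- The middle rows have zero outer entries, so the axis is invariant. There the matrix acts as det
  -- g times g conjugated by a sign change of the second coordinate, which is the origin of the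
  -- minus sign in the axis point of a label.
  axial·𝕄 : ∀ u₁ u₂ a b c d → let D = det a b c d in
    axial u₁ u₂ · 𝕄 a b c d ≗ axial (D * (a * u₁ + - (b * u₂))) (D * (d * u₂ + - (c * u₁)))
  axial·𝕄 u₁ u₂ a b c d = λ
    { 0F → solve 4 (λ u₁ u₂ a b →
        dotᴱ (Κ z0) u₁ u₂ (Κ z0) (a ⊗ a ⊗ a) (Κ z0) (Κ z0) (b ⊗ b ⊗ b) ⊜ Κ z0) refl u₁ u₂ a b
    ; 1F → solve 6 (λ u₁ u₂ a b c d → let D = detᴱ a b c d in
        dotᴱ (Κ z0) u₁ u₂ (Κ z0) (a ⊗ a ⊗ c) (a ⊗ D) (⊝ (b ⊗ D)) (b ⊗ b ⊗ d)
        ⊜ D ⊗ (a ⊗ u₁ ⊕ ⊝ (b ⊗ u₂))) refl u₁ u₂ a b c d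
    ; 2F → solve 6 (λ u₁ u₂ a b c d → let D = detᴱ a b c d in
        dotᴱ (Κ z0) u₁ u₂ (Κ z0) (a ⊗ (c ⊗ c)) (⊝ (c ⊗ D)) (d ⊗ D) (b ⊗ (d ⊗ d))
        ⊜ D ⊗ (d ⊗ u₂ ⊕ ⊝ (c ⊗ u₁))) refl u₁ u₂ a b c d
    ; 3F → solve 4 (λ u₁ u₂ c d →
        dotᴱ (Κ z0) u₁ u₂ (Κ z0) (c ⊗ c ⊗ c) (Κ z0) (Κ z0) (d ⊗ d ⊗ d) ⊜ Κ z0) refl u₁ u₂ c d
    }

  axial-cong : ∀ {u₁ u₂ u₁′ u₂′} → u₁ ≡ u₁′ → u₂ ≡ u₂′ → axial u₁ u₂ ≗ axial u₁′ u₂′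
  axial-cong refl refl i = refl

  𝕄-cong : ∀ {a b c d a′ b′ c′ d′} → a ≡ a′ → b ≡ b′ → c ≡ c′ → d ≡ d′ → 𝕄 a b c d ≐ 𝕄 a′ b′ c′ d′
  𝕄-cong refl refl refl refl i j = refl

  -- Each row of the first factor is a cubic vector or an axis vector, so `v·𝕄` and `axial·𝕄`
  -- multiply it as a whole. Row vectors reverse the order: the product belongs to g′ g.
  𝕄⊗𝕄 : ∀ a b c d a′ b′ c′ d′ → 𝕄 a b c d ⊗ᴹ 𝕄 a′ b′ c′ d′ ≐
    𝕄 (a′ * a + b′ * c) (a′ * b + b′ * d) (c′ * a + d′ * c) (c′ * b + d′ * d)
  𝕄⊗𝕄 a b c d a′ b′ c′ d′ = λ
    { 0F j → v·𝕄 a c a′ b′ c′ d′ j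
    ; 1F j → trans (axial·𝕄 _ _ a′ b′ c′ d′ j) (axial-cong
        (solve 8 (λ a b c d a′ b′ c′ d′ → let D = detᴱ a b c d ; D′ = detᴱ a′ b′ c′ d′
                                              a″ = a′ ⊗ a ⊕ b′ ⊗ c ; b″ = a′ ⊗ b ⊕ b′ ⊗ d
                                              c″ = c′ ⊗ a ⊕ d′ ⊗ c ; d″ = c′ ⊗ b ⊕ d′ ⊗ d in
          D′ ⊗ (a′ ⊗ (a ⊗ D) ⊕ ⊝ (b′ ⊗ ⊝ (c ⊗ D))) ⊜ a″ ⊗ detᴱ a″ b″ c″ d″) refl a b c d a′ b′ c′ d′)
        (solve 8 (λ a b c d a′ b′ c′ d′ → let D = detᴱ a b c d ; D′ = detᴱ a′ b′ c′ d′
                                              a″ = a′ ⊗ a ⊕ b′ ⊗ c ; b″ = a′ ⊗ b ⊕ b′ ⊗ d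
                                              c″ = c′ ⊗ a ⊕ d′ ⊗ c ; d″ = c′ ⊗ b ⊕ d′ ⊗ d in
          D′ ⊗ (d′ ⊗ ⊝ (c ⊗ D) ⊕ ⊝ (c′ ⊗ (a ⊗ D))) ⊜ ⊝ (c″ ⊗ detᴱ a″ b″ c″ d″)) refl a b c d a′ b′ c′ d′) j)
    ; 2F j → trans (axial·𝕄 _ _ a′ b′ c′ d′ j) (axial-cong
        (solve 8 (λ a b c d a′ b′ c′ d′ → let D = detᴱ a b c d ; D′ = detᴱ a′ b′ c′ d′
                                              a″ = a′ ⊗ a ⊕ b′ ⊗ c ; b″ = a′ ⊗ b ⊕ b′ ⊗ d
                                              c″ = c′ ⊗ a ⊕ d′ ⊗ c ; d″ = c′ ⊗ b ⊕ d′ ⊗ d in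
          D′ ⊗ (a′ ⊗ ⊝ (b ⊗ D) ⊕ ⊝ (b′ ⊗ (d ⊗ D))) ⊜ ⊝ (b″ ⊗ detᴱ a″ b″ c″ d″)) refl a b c d a′ b′ c′ d′)
        (solve 8 (λ a b c d a′ b′ c′ d′ → let D = detᴱ a b c d ; D′ = detᴱ a′ b′ c′ d′
                                              a″ = a′ ⊗ a ⊕ b′ ⊗ c ; b″ = a′ ⊗ b ⊕ b′ ⊗ d
                                              c″ = c′ ⊗ a ⊕ d′ ⊗ c ; d″ = c′ ⊗ b ⊕ d′ ⊗ d in
          D′ ⊗ (d′ ⊗ (d ⊗ D) ⊕ ⊝ (c′ ⊗ ⊝ (b ⊗ D))) ⊜ d″ ⊗ detᴱ a″ b″ c″ d″) refl a b c d a′ b′ c′ d′) j)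
    ; 3F j → v·𝕄 b d a′ b′ c′ d′ j
    }

  𝕄-scalar : ∀ k → 𝕄 k 0# 0# k ≐ λ i j → k * k * k * 𝕀 i j
  𝕄-scalar k = λ
    { 0F 0F → sym (*-identityʳ _)
    ; 0F 1F → solve 1 (λ k → k ⊗ k ⊗ Κ z0 ⊜ k ⊗ k ⊗ k ⊗ Κ z0) refl k
    ; 0F 2F → solve 1 (λ k → k ⊗ (Κ z0 ⊗ Κ z0) ⊜ k ⊗ k ⊗ k ⊗ Κ z0) refl k
    ; 0F 3F → solve 1 (λ k → Κ z0 ⊗ Κ z0 ⊗ Κ z0 ⊜ k ⊗ k ⊗ k ⊗ Κ z0) refl k
    ; 1F 0F → sym (zeroʳ _)
    ; 1F 1F → solve 1 (λ k → k ⊗ detᴱ k (Κ z0) (Κ z0) k ⊜ k ⊗ k ⊗ k ⊗ Κ z1) refl k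
    ; 1F 2F → solve 1 (λ k → ⊝ (Κ z0 ⊗ detᴱ k (Κ z0) (Κ z0) k) ⊜ k ⊗ k ⊗ k ⊗ Κ z0) refl k
    ; 1F 3F → sym (zeroʳ _)
    ; 2F 0F → sym (zeroʳ _)
    ; 2F 1F → solve 1 (λ k → ⊝ (Κ z0 ⊗ detᴱ k (Κ z0) (Κ z0) k) ⊜ k ⊗ k ⊗ k ⊗ Κ z0) refl k
    ; 2F 2F → solve 1 (λ k → k ⊗ detᴱ k (Κ z0) (Κ z0) k ⊜ k ⊗ k ⊗ k ⊗ Κ z1) refl k
    ; 2F 3F → sym (zeroʳ _)
    ; 3F 0F → solve 1 (λ k → Κ z0 ⊗ Κ z0 ⊗ Κ z0 ⊜ k ⊗ k ⊗ k ⊗ Κ z0) refl k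
    ; 3F 1F → solve 1 (λ k → Κ z0 ⊗ Κ z0 ⊗ k ⊜ k ⊗ k ⊗ k ⊗ Κ z0) refl k
    ; 3F 2F → solve 1 (λ k → Κ z0 ⊗ (k ⊗ k) ⊜ k ⊗ k ⊗ k ⊗ Κ z0) refl k
    ; 3F 3F → sym (*-identityʳ _)
    }

  ·-linear : ∀ α β x y M → (λ i → α * x i + β * y i) · M ≗ λ j → α * (x · M) j + β * (y · M) j
  ·-linear α β x y M j = solve 14 (λ α β x₀ x₁ x₂ x₃ y₀ y₁ y₂ y₃ m₀ m₁ m₂ m₃ →
      dotᴱ (α ⊗ x₀ ⊕ β ⊗ y₀) (α ⊗ x₁ ⊕ β ⊗ y₁) (α ⊗ x₂ ⊕ β ⊗ y₂) (α ⊗ x₃ ⊕ β ⊗ y₃) m₀ m₁ m₂ m₃ ⊜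
      α ⊗ dotᴱ x₀ x₁ x₂ x₃ m₀ m₁ m₂ m₃ ⊕ β ⊗ dotᴱ y₀ y₁ y₂ y₃ m₀ m₁ m₂ m₃) refl
    α β (x 0F) (x 1F) (x 2F) (x 3F) (y 0F) (y 1F) (y 2F) (y 3F) (M 0F j) (M 1F j) (M 2F j) (M 3F j)

  ·-scaleʳ : ∀ k x M → x · (λ i j → k * M i j) ≗ λ j → k * (x · M) j
  ·-scaleʳ k x M j = solve 9 (λ k x₀ x₁ x₂ x₃ m₀ m₁ m₂ m₃ →
      dotᴱ x₀ x₁ x₂ x₃ (k ⊗ m₀) (k ⊗ m₁) (k ⊗ m₂) (k ⊗ m₃) ⊜ k ⊗ dotᴱ x₀ x₁ x₂ x₃ m₀ m₁ m₂ m₃) refl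
    k (x 0F) (x 1F) (x 2F) (x 3F) (M 0F j) (M 1F j) (M 2F j) (M 3F j)

  record GL₂ : Set c where
    constructor gl
    field
      ga gb gc gd : F
      det≢0       : det ga gb gc gd ≢ 0#

  ∥_∥ : GL₂ → F
  ∥ gl a b c d _ ∥ = det a b c d

  ∥∥≢0 : ∀ g → ∥ g ∥ ≢ 0#
  ∥∥≢0 g = GL₂.det≢0 g

  𝕄[_] : GL₂ → Mat⁴
  𝕄[ gl a b c d _ ] = 𝕄 a b c d

  -- Projectivities are taken up to scalars, so the adjugate can stand in for the inverse with
  -- polynomial entries; one division by the cube of the determinant then yields the inverse matrix.
  adj : GL₂ → GL₂
  adj (gl a b c d D≢0) = gl d (- b) (- c) a λ e → D≢0 (trans
    (solve 4 (λ a b c d → detᴱ a b c d ⊜ detᴱ d (⊝ b) (⊝ c) a) refl a b c d) e)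

  𝕄⊗𝕄-adj : ∀ g → let D = ∥ g ∥ in 𝕄[ g ] ⊗ᴹ 𝕄[ adj g ] ≐ λ i j → D * D * D * 𝕀 i j
  𝕄⊗𝕄-adj (gl a b c d _) i j = begin
    (𝕄 a b c d ⊗ᴹ 𝕄 d (- b) (- c) a) i j  ≡⟨ 𝕄⊗𝕄 a b c d d (- b) (- c) a i j ⟩
    𝕄 _ _ _ _ i j                        ≡⟨ 𝕄-cong
      (solve 4 (λ a b c d → d ⊗ a ⊕ ⊝ b ⊗ c ⊜ detᴱ a b c d) refl a b c d)
      (solve 2 (λ b d → d ⊗ b ⊕ ⊝ b ⊗ d ⊜ Κ z0) refl b d)
      (solve 2 (λ a c → ⊝ c ⊗ a ⊕ a ⊗ c ⊜ Κ z0) refl a c)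
      (solve 4 (λ a b c d → ⊝ c ⊗ b ⊕ a ⊗ d ⊜ detᴱ a b c d) refl a b c d) i j ⟩
    𝕄 D 0# 0# D i j                      ≡⟨ 𝕄-scalar D i j ⟩
    D * D * D * 𝕀 i j                    ∎
    where D = det a b c d

  𝕄-adj⊗𝕄 : ∀ g → let D = ∥ g ∥ in 𝕄[ adj g ] ⊗ᴹ 𝕄[ g ] ≐ λ i j → D * D * D * 𝕀 i j
  𝕄-adj⊗𝕄 (gl a b c d _) i j = begin
    (𝕄 d (- b) (- c) a ⊗ᴹ 𝕄 a b c d) i j  ≡⟨ 𝕄⊗𝕄 d (- b) (- c) a a b c d i j ⟩
    𝕄 _ _ _ _ i j                        ≡⟨ 𝕄-cong
      (solve 4 (λ a b c d → a ⊗ d ⊕ b ⊗ ⊝ c ⊜ detᴱ a b c d) refl a b c d)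
      (solve 2 (λ a b → a ⊗ ⊝ b ⊕ b ⊗ a ⊜ Κ z0) refl a b)
      (solve 2 (λ c d → c ⊗ d ⊕ d ⊗ ⊝ c ⊜ Κ z0) refl c d)
      (solve 4 (λ a b c d → c ⊗ ⊝ b ⊕ d ⊗ a ⊜ detᴱ a b c d) refl a b c d) i j ⟩
    𝕄 D 0# 0# D i j                      ≡⟨ 𝕄-scalar D i j ⟩
    D * D * D * 𝕀 i j                    ∎
    where D = det a b c d

  det³≢0 : ∀ g → ∥ g ∥ * ∥ g ∥ * ∥ g ∥ ≢ 0#
  det³≢0 g = *-nonzero (*-nonzero (∥∥≢0 g) (∥∥≢0 g)) (∥∥≢0 g)

  det⁻³ : GL₂ → F
  det⁻³ g = proj₁ (inverse _ (det³≢0 g))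

  det³det⁻³≡1 : ∀ g → ∥ g ∥ * ∥ g ∥ * ∥ g ∥ * det⁻³ g ≡ 1#
  det³det⁻³≡1 g = proj₂ (inverse _ (det³≢0 g))

  det⁻³≢0 : ∀ g → det⁻³ g ≢ 0#
  det⁻³≢0 g = inverse-nonzero (det³det⁻³≡1 g)

  unscaled : ∀ {k k⁻¹ x y} → k * k⁻¹ ≡ 1# → x ≡ k * y → k⁻¹ * x ≡ y
  unscaled kk⁻¹≡1 x≡ky = sym (unscale kk⁻¹≡1 x≡ky)

  projectivity : GL₂ → Projectivity
  projectivity g = record
    { matrix  = 𝕄[ g ]
    ; matrix⁻ = λ i j → det⁻³ g * 𝕄[ adj g ] i j
    ; invʳ    = λ i j → trans (·-scaleʳ (det⁻³ g) (𝕄[ g ] i) 𝕄[ adj g ] j)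
                              (unscaled (det³det⁻³≡1 g) (𝕄⊗𝕄-adj g i j))
    ; invˡ    = λ i j → trans (scale-· (det⁻³ g) (𝕄[ adj g ] i) 𝕄[ g ] j)
                              (unscaled (det³det⁻³≡1 g) (𝕄-adj⊗𝕄 g i j))
    }

  undo : ∀ {M N D k} → M ⊗ᴹ N ≐ (λ i j → D * 𝕀 i j) → D * k ≡ 1# → ∀ z i → k * ((z · M) · N) i ≡ z i
  undo {M} {N} {D} {k} MN≐D Dk≡1 z i = unscaled Dk≡1 (begin
    ((z · M) · N) i                ≡⟨ ·-assoc z M N i ⟩
    (z · (M ⊗ᴹ N)) i               ≡⟨ ·-congʳ z (M ⊗ᴹ N) _ MN≐D i ⟩
    (z · (λ i j → D * 𝕀 i j)) i    ≡⟨ ·-scaleʳ D z 𝕀 i ⟩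
    D * (z · 𝕀) i                  ≡⟨ cong (D *_) (·-𝕀 z i) ⟩
    D * z i                        ∎)

  undo-𝕄 : ∀ g z i → det⁻³ g * ((z · 𝕄[ g ]) · 𝕄[ adj g ]) i ≡ z i
  undo-𝕄 g = undo {𝕄[ g ]} {𝕄[ adj g ]} (𝕄⊗𝕄-adj g) (det³det⁻³≡1 g)

  undo-adj : ∀ g z i → det⁻³ g * ((z · 𝕄[ adj g ]) · 𝕄[ g ]) i ≡ z i
  undo-adj g = undo {𝕄[ adj g ]} {𝕄[ g ]} (𝕄-adj⊗𝕄 g) (det³det⁻³≡1 g)

  cancelʳ : ∀ φ x → (x · matrix φ) · matrix⁻ φ ≗ x
  cancelʳ φ = cancel (matrix φ) (matrix⁻ φ) (invʳ φ)

  cancelˡ : ∀ φ x → (x · matrix⁻ φ) · matrix φ ≗ x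
  cancelˡ φ = cancel (matrix⁻ φ) (matrix φ) (invˡ φ)

  inverseᴾ : Projectivity → Projectivity
  inverseᴾ φ = record { matrix = matrix⁻ φ ; matrix⁻ = matrix φ ; invʳ = invˡ φ ; invˡ = invʳ φ }

  infixl 7 _⨾_
  _⨾_ : Projectivity → Projectivity → Projectivity
  φ ⨾ ψ = record
    { matrix  = matrix φ ⊗ᴹ matrix ψ
    ; matrix⁻ = matrix⁻ ψ ⊗ᴹ matrix⁻ φ
    ; invʳ    = ⨾-inverse (matrix φ) (matrix⁻ φ) (matrix ψ) (matrix⁻ ψ) (invʳ φ) (invʳ ψ)
    ; invˡ    = ⨾-inverse (matrix⁻ ψ) (matrix ψ) (matrix⁻ φ) (matrix φ) (invˡ ψ) (invˡ φ)
    }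
    where
    ⨾-inverse : ∀ L L⁻ M M⁻ → L ⊗ᴹ L⁻ ≐ 𝕀 → M ⊗ᴹ M⁻ ≐ 𝕀 → (L ⊗ᴹ M) ⊗ᴹ (M⁻ ⊗ᴹ L⁻) ≐ 𝕀
    ⨾-inverse L L⁻ M M⁻ eL eM i j = begin
      ((L i · M) · (M⁻ ⊗ᴹ L⁻)) j    ≡⟨ ·-assoc (L i · M) M⁻ L⁻ j ⟨
      (((L i · M) · M⁻) · L⁻) j    ≡⟨ ·-congˡ _ _ L⁻ (cancel M M⁻ eM (L i)) j ⟩
      (L i · L⁻) j                 ≡⟨ eL i j ⟩
      𝕀 i j                        ∎

-- Labels of lines and the action of the group on them

module LineLabels {c : Level} {q : ℕ} (𝔽 : FiniteField c q)
  (1+1+1≡0 : CharacteristicThree 𝔽) where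

  open FiniteField 𝔽
  open FieldArithmetic 𝔽 1+1+1≡0
  open TwistedCubic 𝔽 renaming (_⊗_ to _⊗ᴹ_)
  open CubicGroup 𝔽 1+1+1≡0
  open ≡-Reasoning

  -- A label (x , y , w) with x = (x₁ , x₂) and y = (s , t) stands for the line spanned by the
  -- axis point (0 , x₁ , - x₂ , 0) and v y + (0 , u₁ , u₂ , 0), for any u with
  -- x₂ u₁ + x₁ u₂ = w; the line would contain v y if w were 0.
  record Label : Set c where
    constructor label
    field
      x₁ x₂ s t w : F

  -- The left side of `incidence` is the determinant of (x₁ , - x₂) and `u`. It therefore fixes `u`
  -- modulo the axis point, and for a valid label the vectors with `l` = 0 are the multiples of that
  -- point.
  record OnLabel (L : Label) (z : Vec⁴) : Set c where
    constructor on
    open Label L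
    field
      l u₁ u₂   : F
      equation  : ∀ i → z i ≡ l * v s t i + axial u₁ u₂ i
      incidence : x₂ * u₁ + x₁ * u₂ ≡ l * w

  NonZero² : F → F → Set c
  NonZero² x y = x ≢ 0# ⊎ y ≢ 0#

  record Valid (L : Label) : Set c where
    constructor valid
    open Label L
    field
      x≢0 : NonZero² x₁ x₂
      y≢0 : NonZero² s t
      w≢0 : w ≢ 0#

  -- w is homogeneous of degree 1 in x and of degree 3 in y.
  infix 4 _∼_
  record _∼_ (L L′ : Label) : Set c where
    constructor related
    private
      module L  = Label L
      module L′ = Label L′
    field
      k l  : F
      k≢0  : k ≢ 0#
      l≢0  : l ≢ 0#
      x₁-≡ : L.x₁ ≡ k * L′.x₁
      x₂-≡ : L.x₂ ≡ k * L′.x₂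
      s-≡  : L.s ≡ l * L′.s
      t-≡  : L.t ≡ l * L′.t
      w-≡  : L.w ≡ k * (l * l * l) * L′.w

  unscale′ : ∀ {k k⁻¹ y} → k * k⁻¹ ≡ 1# → y ≡ k⁻¹ * (k * y)
  unscale′ kk⁻¹≡1 = unscale kk⁻¹≡1 refl

  ∼-sym : ∀ {L L′} → L ∼ L′ → L′ ∼ L
  ∼-sym {label _ _ _ _ _} {label _ _ _ _ w′} (related k l k≢0 l≢0 refl refl refl refl refl)
    with inverse k k≢0 | inverse l l≢0
  ... | k⁻¹ , kk⁻¹≡1 | l⁻¹ , ll⁻¹≡1 = related k⁻¹ l⁻¹ (inverse-nonzero kk⁻¹≡1) (inverse-nonzero ll⁻¹≡1)
    (unscale′ kk⁻¹≡1) (unscale′ kk⁻¹≡1) (unscale′ ll⁻¹≡1) (unscale′ ll⁻¹≡1)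
    -- The multipliers come from k k⁻¹ r³ - 1 = r³ (k k⁻¹ - 1) + (r² + r + 1) (r - 1).
    (combine₂ (- (w′ * (r * r * r))) (- (w′ * (r * r + r + 1#))) kk⁻¹≡1 ll⁻¹≡1
      (solve 5 (λ k k⁻¹ l l⁻¹ w′ → let r = l ⊗ l⁻¹ in
        w′ ⊜ k⁻¹ ⊗ (l⁻¹ ⊗ l⁻¹ ⊗ l⁻¹) ⊗ (k ⊗ (l ⊗ l ⊗ l) ⊗ w′)
          ⊕ ⊝ (w′ ⊗ (r ⊗ r ⊗ r)) ⊗ (k ⊗ k⁻¹ ⊕ ⊝ Κ z1)
          ⊕ ⊝ (w′ ⊗ (r ⊗ r ⊕ r ⊕ Κ z1)) ⊗ (r ⊕ ⊝ Κ z1))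
        refl k k⁻¹ l l⁻¹ w′))
    where r = l * l⁻¹

  ∼-trans : ∀ {L L′ L″} → L ∼ L′ → L′ ∼ L″ → L ∼ L″
  ∼-trans {label _ _ _ _ _} {label _ _ _ _ _} {label _ _ _ _ w″}
    (related k l k≢0 l≢0 refl refl refl refl refl) (related k′ l′ k′≢0 l′≢0 refl refl refl refl refl) =
    related (k * k′) (l * l′) (*-nonzero k≢0 k′≢0) (*-nonzero l≢0 l′≢0)
      (sym (*-assoc k k′ _)) (sym (*-assoc k k′ _)) (sym (*-assoc l l′ _)) (sym (*-assoc l l′ _))
      (solve 5 (λ k l k′ l′ w″ → k ⊗ (l ⊗ l ⊗ l) ⊗ (k′ ⊗ (l′ ⊗ l′ ⊗ l′) ⊗ w″) ⊜
        k ⊗ k′ ⊗ (l ⊗ l′ ⊗ (l ⊗ l′) ⊗ (l ⊗ l′)) ⊗ w″) refl k l k′ l′ w″)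

  -- The vector `v` has degree 3, so the multiplier absorbs l³; `incidence` is linear in x, so the
  -- factor k cancels.
  OnLabel-∼ : ∀ {L L′ z} → L ∼ L′ → OnLabel L z → OnLabel L′ z
  OnLabel-∼ {label _ _ _ _ _} {label x₁ x₂ s t w} (related k l k≢0 l≢0 refl refl refl refl refl)
    (on λ′ u₁ u₂ equation incidence) = on (λ′ * (l * l * l)) u₁ u₂
      (λ i → trans (equation i) (cong (_+ axial u₁ u₂ i) (v-scale i)))
      (*-cancelˡ k≢0 (combine₁ 1# incidence
        (solve 8 (λ k l x₁ x₂ w λ′ u₁ u₂ → k ⊗ (x₂ ⊗ u₁ ⊕ x₁ ⊗ u₂) ⊜ k ⊗ (λ′ ⊗ (l ⊗ l ⊗ l) ⊗ w)
          ⊕ Κ z1 ⊗ (k ⊗ x₂ ⊗ u₁ ⊕ k ⊗ x₁ ⊗ u₂ ⊕ ⊝ (λ′ ⊗ (k ⊗ (l ⊗ l ⊗ l) ⊗ w))))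
          refl k l x₁ x₂ w λ′ u₁ u₂)))
    where
    v-scale : ∀ i → λ′ * v (l * s) (l * t) i ≡ λ′ * (l * l * l) * v s t i
    v-scale = λ
      { 0F → solve 3 (λ m l s → m ⊗ (l ⊗ s ⊗ (l ⊗ s) ⊗ (l ⊗ s)) ⊜ m ⊗ (l ⊗ l ⊗ l) ⊗ (s ⊗ s ⊗ s)) refl λ′ l s
      ; 1F → solve 4 (λ m l s t → m ⊗ (l ⊗ s ⊗ (l ⊗ s) ⊗ (l ⊗ t)) ⊜ m ⊗ (l ⊗ l ⊗ l) ⊗ (s ⊗ s ⊗ t)) refl λ′ l s t
      ; 2F → solve 4 (λ m l s t → m ⊗ (l ⊗ s ⊗ (l ⊗ t ⊗ (l ⊗ t))) ⊜ m ⊗ (l ⊗ l ⊗ l) ⊗ (s ⊗ (t ⊗ t))) refl λ′ l s t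
      ; 3F → solve 3 (λ m l t → m ⊗ (l ⊗ t ⊗ (l ⊗ t) ⊗ (l ⊗ t)) ⊜ m ⊗ (l ⊗ l ⊗ l) ⊗ (t ⊗ t ⊗ t)) refl λ′ l t
      }

  OnLabel-cong : ∀ {L z z′} → z′ ≗ z → OnLabel L z → OnLabel L z′
  OnLabel-cong e (on l u₁ u₂ equation incidence) = on l u₁ u₂ (λ i → trans (e i) (equation i)) incidence

  axial-scale : ∀ k u₁ u₂ i → k * axial u₁ u₂ i ≡ axial (k * u₁) (k * u₂) i
  axial-scale k u₁ u₂ = λ { 0F → zeroʳ k ; 1F → refl ; 2F → refl ; 3F → zeroʳ k }

  OnLabel-scale : ∀ {L z} k → OnLabel L z → OnLabel L (λ i → k * z i)
  OnLabel-scale {label x₁ x₂ s t w} {z} k (on l u₁ u₂ equation incidence) = on (k * l) (k * u₁) (k * u₂)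
    (λ i → begin
      k * z i                                    ≡⟨ cong (k *_) (equation i) ⟩
      k * (l * v s t i + axial u₁ u₂ i)          ≡⟨ solve 4 (λ k l y u → k ⊗ (l ⊗ y ⊕ u) ⊜ k ⊗ l ⊗ y ⊕ k ⊗ u) refl k l _ _ ⟩
      k * l * v s t i + k * axial u₁ u₂ i        ≡⟨ cong (k * l * v s t i +_) (axial-scale k u₁ u₂ i) ⟩
      k * l * v s t i + axial (k * u₁) (k * u₂) i  ∎)
    (combine₁ k incidence (solve 7 (λ k l x₁ x₂ w u₁ u₂ →
      x₂ ⊗ (k ⊗ u₁) ⊕ x₁ ⊗ (k ⊗ u₂) ⊜ k ⊗ l ⊗ w ⊕ k ⊗ (x₂ ⊗ u₁ ⊕ x₁ ⊗ u₂ ⊕ ⊝ (l ⊗ w)))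
      refl k l x₁ x₂ w u₁ u₂))

  infixr 7 _•_
  -- One determinant in the new `w` arises because displacements are moved by det g times a
  -- conjugate of g, the other because `w` is itself a determinant. The det g acquired by the axis
  -- point is dropped, since it only rescales that point.
  _•_ : GL₂ → Label → Label
  gl a b c d _ • label x₁ x₂ s t w =
    label (a * x₁ + b * x₂) (c * x₁ + d * x₂) (a * s + b * t) (c * s + d * t) (det a b c d * det a b c d * w)

  nonsingular : ∀ {a b c d x y} → det a b c d ≢ 0# → NonZero² x y → NonZero² (a * x + b * y) (c * x + d * y)
  nonsingular {a} {b} {c} {d} {x} {y} D≢0 nz with (a * x + b * y) ≟ 0# | (c * x + d * y) ≟ 0#
  ... | no  e≢0 | _       = inj₁ e≢0
  ... | yes _   | no f≢0  = inj₂ f≢0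
  ... | yes e   | yes f with nz
  ...   | inj₁ x≢0 = contradiction (cofactor-zero D≢0 (combine₂ d (- b) e f
          (solve 6 (λ a b c d x y → detᴱ a b c d ⊗ x ⊜ Κ z0 ⊕ d ⊗ (a ⊗ x ⊕ b ⊗ y ⊕ ⊝ Κ z0)
            ⊕ ⊝ b ⊗ (c ⊗ x ⊕ d ⊗ y ⊕ ⊝ Κ z0)) refl a b c d x y))) x≢0
  ...   | inj₂ y≢0 = contradiction (cofactor-zero D≢0 (combine₂ (- c) a e f
          (solve 6 (λ a b c d x y → detᴱ a b c d ⊗ y ⊜ Κ z0 ⊕ ⊝ c ⊗ (a ⊗ x ⊕ b ⊗ y ⊕ ⊝ Κ z0)
            ⊕ a ⊗ (c ⊗ x ⊕ d ⊗ y ⊕ ⊝ Κ z0)) refl a b c d x y))) y≢0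

  Valid-• : ∀ {L} g → Valid L → Valid (g • L)
  Valid-• (gl a b c d D≢0) (valid x≢0 y≢0 w≢0) =
    valid (nonsingular D≢0 x≢0) (nonsingular D≢0 y≢0) (*-nonzero (*-nonzero D≢0 D≢0) w≢0)

  OnLabel-• : ∀ {L z} g → OnLabel L z → OnLabel (g • L) (z · 𝕄[ g ])
  OnLabel-• {label x₁ x₂ s t w} {z} (gl a b c d D≢0) (on l u₁ u₂ equation incidence) =
    on l (D * (a * u₁ + - (b * u₂))) (D * (d * u₂ + - (c * u₁)))
      (λ i → begin
        (z · 𝕄 a b c d) i
          ≡⟨ ·-congˡ _ (λ j → l * v s t j + 1# * axial u₁ u₂ j) (𝕄 a b c d)
               (λ j → trans (equation j) (cong (l * v s t j +_) (sym (*-identityˡ _)))) i ⟩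
        ((λ j → l * v s t j + 1# * axial u₁ u₂ j) · 𝕄 a b c d) i
          ≡⟨ ·-linear l 1# (v s t) (axial u₁ u₂) (𝕄 a b c d) i ⟩
        l * (v s t · 𝕄 a b c d) i + 1# * (axial u₁ u₂ · 𝕄 a b c d) i
          ≡⟨ cong₂ (λ y u → l * y + u) (v·𝕄 s t a b c d i)
               (trans (*-identityˡ _) (axial·𝕄 u₁ u₂ a b c d i)) ⟩
        l * v (a * s + b * t) (c * s + d * t) i + axial (D * (a * u₁ + - (b * u₂))) (D * (d * u₂ + - (c * u₁))) i ∎)
      (combine₁ (D * D) incidence (solve 10 (λ a b c d x₁ x₂ u₁ u₂ l w → let D = detᴱ a b c d in
        (c ⊗ x₁ ⊕ d ⊗ x₂) ⊗ (D ⊗ (a ⊗ u₁ ⊕ ⊝ (b ⊗ u₂))) ⊕ (a ⊗ x₁ ⊕ b ⊗ x₂) ⊗ (D ⊗ (d ⊗ u₂ ⊕ ⊝ (c ⊗ u₁))) ⊜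
        l ⊗ (D ⊗ D ⊗ w) ⊕ D ⊗ D ⊗ (x₂ ⊗ u₁ ⊕ x₁ ⊗ u₂ ⊕ ⊝ (l ⊗ w)))
        refl a b c d x₁ x₂ u₁ u₂ l w))
    where D = det a b c d

  -- Both x and y are scaled by det g. This agrees with `w`, which gains (det g)² twice and has
  -- total degree 1 + 3.
  adj-• : ∀ g L → adj g • g • L ∼ L
  adj-• (gl a b c d D≢0) (label x₁ x₂ s t w) = related D D D≢0 D≢0 (fst x₁ x₂) (snd x₁ x₂) (fst s t) (snd s t)
    (solve 5 (λ a b c d w → let D = detᴱ a b c d ; D′ = detᴱ d (⊝ b) (⊝ c) a in
      D′ ⊗ D′ ⊗ (D ⊗ D ⊗ w) ⊜ D ⊗ (D ⊗ D ⊗ D) ⊗ w) refl a b c d w)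
    where
    D = det a b c d
    fst : ∀ x y → d * (a * x + b * y) + - b * (c * x + d * y) ≡ D * x
    fst x y = solve 6 (λ a b c d x y → d ⊗ (a ⊗ x ⊕ b ⊗ y) ⊕ ⊝ b ⊗ (c ⊗ x ⊕ d ⊗ y) ⊜ detᴱ a b c d ⊗ x) refl a b c d x y
    snd : ∀ x y → - c * (a * x + b * y) + a * (c * x + d * y) ≡ D * y
    snd x y = solve 6 (λ a b c d x y → ⊝ c ⊗ (a ⊗ x ⊕ b ⊗ y) ⊕ a ⊗ (c ⊗ x ⊕ d ⊗ y) ⊜ detᴱ a b c d ⊗ y) refl a b c d x y

  OnLabel-•⁻ : ∀ {L z} g → OnLabel (g • L) (z · 𝕄[ g ]) → OnLabel L z
  OnLabel-•⁻ {L} {z} g onL = OnLabel-cong (λ i → sym (undo-𝕄 g z i)) (OnLabel-scale (det⁻³ g) onL′)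
    where
    onL′ : OnLabel L ((z · 𝕄[ g ]) · 𝕄[ adj g ])
    onL′ = OnLabel-∼ (adj-• g L) (OnLabel-• (adj g) onL)

  Represents : Line → Label → Set c
  Represents ℓ L = ∀ X → X ∈ ℓ ⇔ OnLabel L (coords X)

  ∈-image : ∀ X ℓ φ → X ∈ ℓ ⟪ φ ⟫ᴸ ⇔ (X ⟪ inverseᴾ φ ⟫ᴾ) ∈ ℓ
  ∈-image X (line P Q _) φ = mk⇔
    (λ (α , β , e) → α , β , λ i → begin
      (coords X · matrix⁻ φ) i
        ≡⟨ ·-congˡ (coords X) _ (matrix⁻ φ) e i ⟩
      ((λ j → α * (coords P · matrix φ) j + β * (coords Q · matrix φ) j) · matrix⁻ φ) i
        ≡⟨ ·-linear α β (coords P · matrix φ) (coords Q · matrix φ) (matrix⁻ φ) i ⟩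
      α * ((coords P · matrix φ) · matrix⁻ φ) i + β * ((coords Q · matrix φ) · matrix⁻ φ) i
        ≡⟨ cong₂ (λ x y → α * x + β * y) (cancelʳ φ (coords P) i) (cancelʳ φ (coords Q) i) ⟩
      α * coords P i + β * coords Q i ∎)
    (λ (α , β , e) → α , β , λ i → begin
      coords X i
        ≡⟨ cancelˡ φ (coords X) i ⟨
      ((coords X · matrix⁻ φ) · matrix φ) i
        ≡⟨ ·-congˡ (coords X · matrix⁻ φ) _ (matrix φ) e i ⟩
      ((λ j → α * coords P j + β * coords Q j) · matrix φ) i
        ≡⟨ ·-linear α β (coords P) (coords Q) (matrix φ) i ⟩
      α * (coords P · matrix φ) i + β * (coords Q · matrix φ) i ∎)

  represents-image : ∀ {ℓ L} φ g → Represents ℓ L → matrix φ ∝ᴹ 𝕄[ g ] → Represents (ℓ ⟪ φ ⟫ᴸ) (g • L)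
  represents-image {ℓ} {L} φ g rep (k , k≢0 , φ≡kg) X with inverse k k≢0
  ... | k⁻¹ , kk⁻¹≡1 = mk⇔
    (λ X∈ → OnLabel-cong X≡kzg (OnLabel-scale k
      (OnLabel-• g (Equivalence.to (rep Z) (Equivalence.to (∈-image X ℓ φ) X∈)))))
    (λ onL → Equivalence.from (∈-image X ℓ φ) (Equivalence.from (rep Z)
      (OnLabel-•⁻ g (OnLabel-cong (λ i → unscale kk⁻¹≡1 (X≡kzg i)) (OnLabel-scale k⁻¹ onL)))))
    where
    Z = X ⟪ inverseᴾ φ ⟫ᴾ
    X≡kzg : ∀ i → coords X i ≡ k * (coords Z · 𝕄[ g ]) i
    X≡kzg i = begin
      coords X i                                 ≡⟨ cancelˡ φ (coords X) i ⟨
      (coords Z · matrix φ) i                    ≡⟨ ·-congʳ (coords Z) _ _ φ≡kg i ⟩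
      (coords Z · (λ i j → k * 𝕄[ g ] i j)) i    ≡⟨ ·-scaleʳ k (coords Z) 𝕄[ g ] i ⟩
      k * (coords Z · 𝕄[ g ]) i                  ∎

  abstract
    represents-∼ : ∀ {ℓ L L′} → L ∼ L′ → Represents ℓ L → Represents ℓ L′
    represents-∼ L∼L′ rep X = mk⇔
      (OnLabel-∼ L∼L′ ∘ Equivalence.to (rep X))
      (Equivalence.from (rep X) ∘ OnLabel-∼ (∼-sym L∼L′))

  abstract
    represents-≈ : ∀ {ℓ m L} → m ≈ᴸ ℓ → Represents ℓ L → Represents m L
    represents-≈ m≈ℓ rep X = mk⇔
      (Equivalence.to (rep X) ∘ Equivalence.to (m≈ℓ X))
      (Equivalence.from (m≈ℓ X) ∘ Equivalence.from (rep X))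

  abstract
    same-label⇒≈ : ∀ {ℓ m L} → Represents ℓ L → Represents m L → ℓ ≈ᴸ m
    same-label⇒≈ rep rep′ X = mk⇔
      (Equivalence.from (rep′ X) ∘ Equivalence.to (rep X))
      (Equivalence.from (rep X) ∘ Equivalence.to (rep′ X))

  abstract
    parallel : ∀ {x y x′ y′} → NonZero² x y → x * y′ ≡ y * x′ → ∃[ k ] (x′ ≡ k * x × y′ ≡ k * y)
    parallel {x} {y} {x′} {y′} (inj₁ x≢0) e with inverse x x≢0
    ... | i , xi≡1 = x′ * i ,
      combine₁ (- x′) xi≡1 (solve 3 (λ x x′ i → x′ ⊜ x′ ⊗ i ⊗ x ⊕ ⊝ x′ ⊗ (x ⊗ i ⊕ ⊝ Κ z1)) refl x x′ i) ,
      combine₂ i (- y′) e xi≡1 (solve 5 (λ x y x′ y′ i →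
        y′ ⊜ x′ ⊗ i ⊗ y ⊕ i ⊗ (x ⊗ y′ ⊕ ⊝ (y ⊗ x′)) ⊕ ⊝ y′ ⊗ (x ⊗ i ⊕ ⊝ Κ z1)) refl x y x′ y′ i)
    parallel {x} {y} {x′} {y′} (inj₂ y≢0) e with parallel (inj₁ y≢0) (sym e)
    ... | k , e₁ , e₂ = k , e₂ , e₁

  parallel-factor≢0 : ∀ {k x y x′ y′} → NonZero² x′ y′ → x′ ≡ k * x → y′ ≡ k * y → k ≢ 0#
  parallel-factor≢0 (inj₁ x′≢0) refl _ refl = x′≢0 (zeroˡ _)
  parallel-factor≢0 (inj₂ y′≢0) _ refl refl = y′≢0 (zeroˡ _)

  abstract
    -- Scaled by `w`, such a vector realises any prescribed `w` by an actual displacement; this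
    -- produces a point of the line off the axis.
    dual : ∀ {x y} → NonZero² x y → ∃[ u ] ∃[ u′ ] y * u + x * u′ ≡ 1#
    dual {x} {y} (inj₁ x≢0) with inverse x x≢0
    ... | i , xi≡1 = 0# , i , trans (solve 3 (λ x y i → y ⊗ Κ z0 ⊕ x ⊗ i ⊜ x ⊗ i) refl x y i) xi≡1
    dual {x} {y} (inj₂ y≢0) with inverse y y≢0
    ... | i , yi≡1 = i , 0# , trans (solve 3 (λ x y i → y ⊗ i ⊕ x ⊗ Κ z0 ⊜ y ⊗ i) refl x y i) yi≡1

  v≢𝟘 : ∀ {s t} → NonZero² s t → v s t 0F ≢ 0# ⊎ v s t 3F ≢ 0#
  v≢𝟘 (inj₁ s≢0) = inj₁ (s≢0 ∘ cube≡0)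
  v≢𝟘 (inj₂ t≢0) = inj₂ (t≢0 ∘ cube≡0)

  axisPoint : ∀ {x₁ x₂} → NonZero² x₁ x₂ → Point
  axisPoint {x₁} {x₂} x≢0 = point (axial x₁ (- x₂)) λ e → nonzero′ x≢0 (e 1F) (e 2F)
    where
    nonzero′ : NonZero² x₁ x₂ → x₁ ≡ 0# → - x₂ ≡ 0# → ⊥
    nonzero′ (inj₁ x₁≢0) e _ = x₁≢0 e
    nonzero′ (inj₂ x₂≢0) _ e = x₂≢0 (trans (sym (-‿involutive x₂)) (trans (cong -_ e) -0#≈0#))

  axisPoint-on : ∀ {x₁ x₂ s t w} (x≢0 : NonZero² x₁ x₂) → OnLabel (label x₁ x₂ s t w) (coords (axisPoint x≢0))
  axisPoint-on {x₁} {x₂} {w = w} x≢0 = on 0# x₁ (- x₂)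
    (λ i → solve 2 (λ y u → u ⊜ Κ z0 ⊗ y ⊕ u) refl _ _)
    (solve 3 (λ x₁ x₂ w → x₂ ⊗ x₁ ⊕ x₁ ⊗ ⊝ x₂ ⊜ Κ z0 ⊗ w) refl x₁ x₂ w)

  abstract
    point-off-axis : ∀ {L} → let open Label L in Valid L →
      ∃[ X ] ∃[ u₁ ] ∃[ u₂ ] (coords X ≗ λ i → v s t i + axial u₁ u₂ i) × x₂ * u₁ + x₁ * u₂ ≡ w
    point-off-axis {label x₁ x₂ s t w} (valid x≢0 y≢0 w≢0) with dual x≢0
    ... | u₁ , u₂ , e = point z (λ z≗𝟘 → z≢𝟘 (v≢𝟘 y≢0) z≗𝟘) , w * u₁ , w * u₂ , (λ i → refl) ,
      combine₁ w e (solve 5 (λ x₁ x₂ u₁ u₂ w →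
        x₂ ⊗ (w ⊗ u₁) ⊕ x₁ ⊗ (w ⊗ u₂) ⊜ w ⊕ w ⊗ (x₂ ⊗ u₁ ⊕ x₁ ⊗ u₂ ⊕ ⊝ Κ z1)) refl x₁ x₂ u₁ u₂ w)
      where
      z : Vec⁴
      z i = v s t i + axial (w * u₁) (w * u₂) i
      z≢𝟘 : v s t 0F ≢ 0# ⊎ v s t 3F ≢ 0# → ¬ (z ≗ 𝟘)
      z≢𝟘 (inj₁ nz) e = nz (trans (sym (+-identityʳ _)) (e 0F))
      z≢𝟘 (inj₂ nz) e = nz (trans (sym (+-identityʳ _)) (e 3F))

  -- Only the cubic part contributes to coordinates 0 and 3, so these detect whether the multiplier
  -- vanishes.
  off-axis-multiplier : ∀ {L z} → (z 0F ≢ 0# ⊎ z 3F ≢ 0#) → (o : OnLabel L z) → OnLabel.l o ≢ 0#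
  off-axis-multiplier (inj₁ z≢0) (on l u₁ u₂ equation _) refl =
    z≢0 (trans (equation 0F) (trans (+-identityʳ _) (zeroˡ _)))
  off-axis-multiplier (inj₂ z≢0) (on l u₁ u₂ equation _) refl =
    z≢0 (trans (equation 3F) (trans (+-identityʳ _) (zeroˡ _)))

  axis-multiplier : ∀ {L z} → NonZero² (Label.s L) (Label.t L) → z 0F ≡ 0# → z 3F ≡ 0# →
    (o : OnLabel L z) → OnLabel.l o ≡ 0#
  axis-multiplier {label _ _ s t _} y≢0 z₀≡0 z₃≡0 (on l u₁ u₂ equation _) with l ≟ 0#
  ... | yes l≡0 = l≡0
  ... | no  l≢0 with v≢𝟘 y≢0
  ...   | inj₁ nz = contradiction (trans (sym (trans (equation 0F) (+-identityʳ _))) z₀≡0) (*-nonzero l≢0 nz)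
  ...   | inj₂ nz = contradiction (trans (sym (trans (equation 3F) (+-identityʳ _))) z₃≡0) (*-nonzero l≢0 nz)

-- Projectivities preserving the cubic

module CubicStabilizer {c : Level} {q : ℕ} (𝔽 : FiniteField c q)
  (1+1+1≡0 : CharacteristicThree 𝔽) where

  open FiniteField 𝔽
  open FieldArithmetic 𝔽 1+1+1≡0
  open TwistedCubic 𝔽 renaming (_⊗_ to _⊗ᴹ_)
  open CubicGroup 𝔽 1+1+1≡0
  open LineLabels 𝔽 1+1+1≡0
  open ≡-Reasoning

  -- The homogeneous form of `OnCubic`: it treats the point at infinity like the others and applies
  -- to bare vectors such as matrix rows.
  IsCubic : Vec⁴ → Set c
  IsCubic z = ∃[ k ] ∃[ s ] ∃[ t ] (k ≢ 0# × NonZero² s t × (∀ i → z i ≡ k * v s t i))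

  OnCubic⇒IsCubic : ∀ {X} → OnCubic X → IsCubic (coords X)
  OnCubic⇒IsCubic (just t , k , k≢0 , e) = k , t , 1# , k≢0 , inj₂ 1≢0 , λ i → trans (e i) (cong (k *_) (v≡ i))
    where
    v≡ : ∀ i → coords (cubicPoint (just t)) i ≡ v t 1# i
    v≡ = λ
      { 0F → refl
      ; 1F → sym (*-identityʳ _)
      ; 2F → solve 1 (λ t → t ⊜ t ⊗ (Κ z1 ⊗ Κ z1)) refl t
      ; 3F → solve 0 (Κ z1 ⊜ Κ z1 ⊗ Κ z1 ⊗ Κ z1) refl
      }
  OnCubic⇒IsCubic (∞ , k , k≢0 , e) = k , 1# , 0# , k≢0 , inj₁ 1≢0 , λ i → trans (e i) (cong (k *_) (v≡ i))
    where
    v≡ : ∀ i → coords (cubicPoint ∞) i ≡ v 1# 0# i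
    v≡ = λ
      { 0F → solve 0 (Κ z1 ⊜ Κ z1 ⊗ Κ z1 ⊗ Κ z1) refl
      ; 1F → solve 0 (Κ z0 ⊜ Κ z1 ⊗ Κ z1 ⊗ Κ z0) refl
      ; 2F → solve 0 (Κ z0 ⊜ Κ z1 ⊗ (Κ z0 ⊗ Κ z0)) refl
      ; 3F → solve 0 (Κ z0 ⊜ Κ z0 ⊗ Κ z0 ⊗ Κ z0) refl
      }

  IsCubic⇒OnCubic : ∀ {X} → IsCubic (coords X) → OnCubic X
  IsCubic⇒OnCubic {X} (k , s , t , k≢0 , nz , e) with t ≟ 0#
  IsCubic⇒OnCubic {X} (k , s , t , k≢0 , inj₂ t≢0 , e) | yes t≡0 = contradiction t≡0 t≢0
  IsCubic⇒OnCubic {X} (k , s , t , k≢0 , inj₁ s≢0 , e) | yes refl =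
    ∞ , k * (s * s * s) , *-nonzero k≢0 (*-nonzero (*-nonzero s≢0 s≢0) s≢0) , λ
      { 0F → trans (e 0F) (sym (*-identityʳ _))
      ; 1F → trans (e 1F) (solve 2 (λ k s → k ⊗ (s ⊗ s ⊗ Κ z0) ⊜ k ⊗ (s ⊗ s ⊗ s) ⊗ Κ z0) refl k s)
      ; 2F → trans (e 2F) (solve 2 (λ k s → k ⊗ (s ⊗ (Κ z0 ⊗ Κ z0)) ⊜ k ⊗ (s ⊗ s ⊗ s) ⊗ Κ z0) refl k s)
      ; 3F → trans (e 3F) (solve 2 (λ k s → k ⊗ (Κ z0 ⊗ Κ z0 ⊗ Κ z0) ⊜ k ⊗ (s ⊗ s ⊗ s) ⊗ Κ z0) refl k s)
      }
  IsCubic⇒OnCubic {X} (k , s , t , k≢0 , nz , e) | no t≢0 with inverse t t≢0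
  -- The multipliers factor r - 1 out of r³ - 1, r² - 1 and r - 1, where r = t i.
  ... | i , ti≡1 = just (s * i) , k * (t * t * t) , *-nonzero k≢0 (*-nonzero (*-nonzero t≢0 t≢0) t≢0) , λ
      { 0F → trans (e 0F) (combine₁ (- (k * (s * s * s) * (r * r + r + 1#))) ti≡1
          (solve 4 (λ k s t i → let r = t ⊗ i ; σ = s ⊗ i in k ⊗ (s ⊗ s ⊗ s) ⊜
            k ⊗ (t ⊗ t ⊗ t) ⊗ (σ ⊗ σ ⊗ σ) ⊕ ⊝ (k ⊗ (s ⊗ s ⊗ s) ⊗ (r ⊗ r ⊕ r ⊕ Κ z1)) ⊗ (r ⊕ ⊝ Κ z1)) refl k s t i))
      ; 1F → trans (e 1F) (combine₁ (- (k * (s * s * t) * (r + 1#))) ti≡1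
          (solve 4 (λ k s t i → let r = t ⊗ i ; σ = s ⊗ i in k ⊗ (s ⊗ s ⊗ t) ⊜
            k ⊗ (t ⊗ t ⊗ t) ⊗ (σ ⊗ σ) ⊕ ⊝ (k ⊗ (s ⊗ s ⊗ t) ⊗ (r ⊕ Κ z1)) ⊗ (r ⊕ ⊝ Κ z1)) refl k s t i))
      ; 2F → trans (e 2F) (combine₁ (- (k * (s * (t * t)))) ti≡1
          (solve 4 (λ k s t i → let r = t ⊗ i ; σ = s ⊗ i in k ⊗ (s ⊗ (t ⊗ t)) ⊜
            k ⊗ (t ⊗ t ⊗ t) ⊗ σ ⊕ ⊝ (k ⊗ (s ⊗ (t ⊗ t))) ⊗ (r ⊕ ⊝ Κ z1)) refl k s t i))
      ; 3F → trans (e 3F) (sym (*-identityʳ _))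
      }
    where r = t * i

  IsCubic-cong : ∀ {z z′} → z ≗ z′ → IsCubic z → IsCubic z′
  IsCubic-cong z≗z′ (k , s , t , k≢0 , nz , e) = k , s , t , k≢0 , nz , λ i → trans (sym (z≗z′ i)) (e i)

  IsCubic-scale : ∀ {z} κ → κ ≢ 0# → IsCubic z → IsCubic (λ i → κ * z i)
  IsCubic-scale κ κ≢0 (k , s , t , k≢0 , nz , e) =
    κ * k , s , t , *-nonzero κ≢0 k≢0 , nz , λ i → trans (cong (κ *_) (e i)) (sym (*-assoc κ k _))

  IsCubic-𝕄 : ∀ {z} g → IsCubic z → IsCubic (z · 𝕄[ g ])
  IsCubic-𝕄 {z} (gl a b c d D≢0) (k , s , t , k≢0 , nz , e) =
    k , a * s + b * t , c * s + d * t , k≢0 , nonsingular D≢0 nz , λ i → begin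
      (z · 𝕄 a b c d) i                       ≡⟨ ·-congˡ z (λ j → k * v s t j) (𝕄 a b c d) e i ⟩
      ((λ j → k * v s t j) · 𝕄 a b c d) i     ≡⟨ scale-· k (v s t) (𝕄 a b c d) i ⟩
      k * (v s t · 𝕄 a b c d) i               ≡⟨ cong (k *_) (v·𝕄 s t a b c d i) ⟩
      k * v (a * s + b * t) (c * s + d * t) i ∎

  InG-projectivity : ∀ g → InG (projectivity g)
  InG-projectivity g X = mk⇔
    (λ X∈𝒞 → IsCubic⇒OnCubic {X ⟪ projectivity g ⟫ᴾ} (IsCubic-𝕄 g (OnCubic⇒IsCubic {X} X∈𝒞)))
    from
    where
    from : OnCubic (X ⟪ projectivity g ⟫ᴾ) → OnCubic X
    from X∈𝒞 = IsCubic⇒OnCubic {X} (IsCubic-cong (undo-𝕄 g (coords X)) (IsCubic-scale (det⁻³ g) (det⁻³≢0 g) cubic′))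
      where
      cubic′ : IsCubic ((coords X · 𝕄[ g ]) · 𝕄[ adj g ])
      cubic′ = IsCubic-𝕄 (adj g) (OnCubic⇒IsCubic {X ⟪ projectivity g ⟫ᴾ} X∈𝒞)

  IsCubic-image : ∀ {z} φ → InG φ → ¬ (z ≗ 𝟘) → IsCubic z → IsCubic (z · matrix φ)
  IsCubic-image {z} φ φ∈G z≢𝟘 cubic = OnCubic⇒IsCubic {Z ⟪ φ ⟫ᴾ} (Equivalence.to (φ∈G Z) (IsCubic⇒OnCubic {Z} cubic))
    where Z = point z z≢𝟘

  e₀ e₃ : Vec⁴
  e₀ = ⟨ 1# , 0# , 0# , 0# ⟩
  e₃ = ⟨ 0# , 0# , 0# , 1# ⟩

  e₀·≗ : ∀ M → e₀ · M ≗ M 0F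
  e₀·≗ M j = solve 4 (λ m₀ m₁ m₂ m₃ → dotᴱ (Κ z1) (Κ z0) (Κ z0) (Κ z0) m₀ m₁ m₂ m₃ ⊜ m₀) refl
    (M 0F j) (M 1F j) (M 2F j) (M 3F j)

  e₃·≗ : ∀ M → e₃ · M ≗ M 3F
  e₃·≗ M j = solve 4 (λ m₀ m₁ m₂ m₃ → dotᴱ (Κ z0) (Κ z0) (Κ z0) (Κ z1) m₀ m₁ m₂ m₃ ⊜ m₃) refl
    (M 0F j) (M 1F j) (M 2F j) (M 3F j)

  E₀ E₃ : Point
  E₀ = point e₀ (λ e → 1≢0 (e 0F))
  E₃ = point e₃ (λ e → 1≢0 (e 3F))

  E₀E₃ : Line
  E₀E₃ = line E₀ E₃ λ (k , _ , e) → 1≢0 (trans (e 0F) (zeroʳ k))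

  v-cubic : ∀ {s t} → NonZero² s t → IsCubic (v s t)
  v-cubic nz = 1# , _ , _ , 1≢0 , nz , λ i → sym (*-identityˡ _)

  v-nonzero : ∀ {s t} → NonZero² s t → ¬ (v s t ≗ 𝟘)
  v-nonzero nz e with v≢𝟘 nz
  ... | inj₁ s³≢0 = s³≢0 (e 0F)
  ... | inj₂ t³≢0 = t³≢0 (e 3F)

  row₀-cubic : ∀ φ → InG φ → IsCubic (matrix φ 0F)
  row₀-cubic φ φ∈G = IsCubic-cong (e₀·≗ (matrix φ)) (IsCubic-image φ φ∈G (nonzero E₀)
    (OnCubic⇒IsCubic {E₀} (∞ , 1# , 1≢0 , λ i → sym (*-identityˡ _))))

  row₃-cubic : ∀ φ → InG φ → IsCubic (matrix φ 3F)
  row₃-cubic φ φ∈G = IsCubic-cong (e₃·≗ (matrix φ)) (IsCubic-image φ φ∈G (nonzero E₃)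
    (IsCubic-cong (λ
      { 0F → solve 0 (Κ z0 ⊗ Κ z0 ⊗ Κ z0 ⊜ Κ z0) refl
      ; 1F → solve 0 (Κ z0 ⊗ Κ z0 ⊗ Κ z1 ⊜ Κ z0) refl
      ; 2F → solve 0 (Κ z0 ⊗ (Κ z1 ⊗ Κ z1) ⊜ Κ z0) refl
      ; 3F → solve 0 (Κ z1 ⊗ Κ z1 ⊗ Κ z1 ⊜ Κ z1) refl
      }) (v-cubic {0#} {1#} (inj₂ 1≢0))))

  IsCubic-equations : ∀ {z} → IsCubic z → z 0F * z 2F ≡ z 1F * z 1F × z 1F * z 3F ≡ z 2F * z 2F
  IsCubic-equations (k , s , t , _ , _ , e) =
    (begin
      _                                    ≡⟨ cong₂ _*_ (e 0F) (e 2F) ⟩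
      k * (s * s * s) * (k * (s * (t * t)))  ≡⟨ solve 3 (λ k s t → k ⊗ (s ⊗ s ⊗ s) ⊗ (k ⊗ (s ⊗ (t ⊗ t)))
                                                 ⊜ k ⊗ (s ⊗ s ⊗ t) ⊗ (k ⊗ (s ⊗ s ⊗ t))) refl k s t ⟩
      k * (s * s * t) * (k * (s * s * t))    ≡⟨ cong₂ _*_ (e 1F) (e 1F) ⟨
      _                                    ∎) ,
    (begin
      _                                      ≡⟨ cong₂ _*_ (e 1F) (e 3F) ⟩
      k * (s * s * t) * (k * (t * t * t))      ≡⟨ solve 3 (λ k s t → k ⊗ (s ⊗ s ⊗ t) ⊗ (k ⊗ (t ⊗ t ⊗ t))
                                                   ⊜ k ⊗ (s ⊗ (t ⊗ t)) ⊗ (k ⊗ (s ⊗ (t ⊗ t)))) refl k s t ⟩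
      k * (s * (t * t)) * (k * (s * (t * t)))  ≡⟨ cong₂ _*_ (e 2F) (e 2F) ⟨
      _                                      ∎)

  IsCubic⇒≢𝟘 : ∀ {z} → IsCubic z → ¬ (z ≗ 𝟘)
  IsCubic⇒≢𝟘 (k , s , t , k≢0 , nz , e) z≗𝟘 =
    v-nonzero nz (λ i → cofactor-zero k≢0 (trans (sym (e i)) (z≗𝟘 i)))

  column-nonzero : ∀ φ → ¬ (∀ i → matrix φ i 1F ≡ 0#)
  column-nonzero φ col≡0 = 1≢0 (trans (sym (invˡ φ 1F 1F)) (begin
    (matrix⁻ φ 1F · matrix φ) 1F
      ≡⟨ cong₂ (λ x y → m 0F * x + y) (col≡0 0F) (cong₂ (λ x y → m 1F * x + y) (col≡0 1F)
           (cong₂ (λ x y → m 2F * x + (m 3F * y + 0#)) (col≡0 2F) (col≡0 3F))) ⟩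
    m 0F * 0# + (m 1F * 0# + (m 2F * 0# + (m 3F * 0# + 0#)))
      ≡⟨ solve 4 (λ m₀ m₁ m₂ m₃ → dotᴱ m₀ m₁ m₂ m₃ (Κ z0) (Κ z0) (Κ z0) (Κ z0) ⊜ Κ z0) refl (m 0F) (m 1F) (m 2F) (m 3F) ⟩
    0# ∎))
    where m = matrix⁻ φ 1F

  -- The conics x₀x₂ = x₁² and x₁x₃ = x₂² contain the image of every point of the cubic;
  -- in terms of the parameter this gives polynomials of degree at most 5 with q roots.
  fixes-E₀E₃⇒diagonal : 6 ≤ q → ∀ φ → InG φ → let m = matrix φ in
    m 0F 1F ≡ 0# → m 0F 2F ≡ 0# → m 0F 3F ≡ 0# → m 3F 0F ≡ 0# → m 3F 1F ≡ 0# → m 3F 2F ≡ 0# →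
    ∃[ r ] r ≢ 0# × m ∝ᴹ 𝕄 r 0# 0# 1#
  fixes-E₀E₃⇒diagonal 6≤q φ φ∈G m₀₁ m₀₂ m₀₃ m₃₀ m₃₁ m₃₂ =
    r , r≢0 , n , n≢0 , entries
    where
    m = matrix φ
    m00 = m 0F 0F ; m10 = m 1F 0F ; m20 = m 2F 0F
    m11 = m 1F 1F ; m21 = m 2F 1F
    m12 = m 1F 2F ; m22 = m 2F 2F
    m13 = m 1F 3F ; m23 = m 2F 3F
    n = m 3F 3F

    m00≢0 : m00 ≢ 0#
    m00≢0 e = IsCubic⇒≢𝟘 (row₀-cubic φ φ∈G) λ { 0F → e ; 1F → m₀₁ ; 2F → m₀₂ ; 3F → m₀₃ }

    n≢0 : n ≢ 0#
    n≢0 e = IsCubic⇒≢𝟘 (row₃-cubic φ φ∈G) λ { 0F → m₃₀ ; 1F → m₃₁ ; 2F → m₃₂ ; 3F → e }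

    image : F → Vec⁴
    image t = v t 1# · m

    image₀ : ∀ t → image t 0F ≡ m00 * (t * t * t) + m10 * (t * t) + m20 * t
    image₀ t = combine₁ 1# m₃₀ (solve 5 (λ t a b c d →
      dotᴱ (t ⊗ t ⊗ t) (t ⊗ t ⊗ Κ z1) (t ⊗ (Κ z1 ⊗ Κ z1)) (Κ z1 ⊗ Κ z1 ⊗ Κ z1) a b c d ⊜
      a ⊗ (t ⊗ t ⊗ t) ⊕ b ⊗ (t ⊗ t) ⊕ c ⊗ t ⊕ Κ z1 ⊗ (d ⊕ ⊝ Κ z0)) refl t m00 m10 m20 (m 3F 0F))

    image₁ : ∀ t → image t 1F ≡ m11 * (t * t) + m21 * t
    image₁ t = combine₂ (t * t * t) 1# m₀₁ m₃₁ (solve 5 (λ t a b c d →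
      dotᴱ (t ⊗ t ⊗ t) (t ⊗ t ⊗ Κ z1) (t ⊗ (Κ z1 ⊗ Κ z1)) (Κ z1 ⊗ Κ z1 ⊗ Κ z1) a b c d ⊜
      b ⊗ (t ⊗ t) ⊕ c ⊗ t ⊕ t ⊗ t ⊗ t ⊗ (a ⊕ ⊝ Κ z0) ⊕ Κ z1 ⊗ (d ⊕ ⊝ Κ z0)) refl t (m 0F 1F) m11 m21 (m 3F 1F))

    image₂ : ∀ t → image t 2F ≡ m12 * (t * t) + m22 * t
    image₂ t = combine₂ (t * t * t) 1# m₀₂ m₃₂ (solve 5 (λ t a b c d →
      dotᴱ (t ⊗ t ⊗ t) (t ⊗ t ⊗ Κ z1) (t ⊗ (Κ z1 ⊗ Κ z1)) (Κ z1 ⊗ Κ z1 ⊗ Κ z1) a b c d ⊜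
      b ⊗ (t ⊗ t) ⊕ c ⊗ t ⊕ t ⊗ t ⊗ t ⊗ (a ⊕ ⊝ Κ z0) ⊕ Κ z1 ⊗ (d ⊕ ⊝ Κ z0)) refl t (m 0F 2F) m12 m22 (m 3F 2F))

    image₃ : ∀ t → image t 3F ≡ m13 * (t * t) + m23 * t + n
    image₃ t = combine₁ (t * t * t) m₀₃ (solve 5 (λ t a b c d →
      dotᴱ (t ⊗ t ⊗ t) (t ⊗ t ⊗ Κ z1) (t ⊗ (Κ z1 ⊗ Κ z1)) (Κ z1 ⊗ Κ z1 ⊗ Κ z1) a b c d ⊜
      b ⊗ (t ⊗ t) ⊕ c ⊗ t ⊕ d ⊕ t ⊗ t ⊗ t ⊗ (a ⊕ ⊝ Κ z0)) refl t (m 0F 3F) m13 m23 n)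

    image-equations : ∀ t → image t 0F * image t 2F ≡ image t 1F * image t 1F ×
                            image t 1F * image t 3F ≡ image t 2F * image t 2F
    image-equations t = IsCubic-equations (IsCubic-image φ φ∈G (v-nonzero {t} (inj₂ 1≢0)) (v-cubic (inj₂ 1≢0)))

    -- Coefficients in t of x₀x₂ - x₁² and x₁x₃ - x₂² along the image. The cross terms of the
    -- squares appear with a plus sign because - 2 = 1. The six coefficients of the first list
    -- account for the bound 6 ≤ q.
    conic₁ conic₂ : List F
    conic₁ = 0# ∷ 0# ∷ m20 * m22 + - (m21 * m21) ∷ m10 * m22 + m20 * m12 + m11 * m21 ∷
             m10 * m12 + m00 * m22 + - (m11 * m11) ∷ m00 * m12 ∷ []
    conic₂ = 0# ∷ m21 * n ∷ m11 * n + m21 * m23 + - (m22 * m22) ∷ m11 * m23 + m21 * m13 + m12 * m22 ∷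
             m11 * m13 + - (m12 * m12) ∷ []

    conic₁-vanishes : ∀ t → eval conic₁ t ≡ 0#
    conic₁-vanishes t = combine₁ 1#
      (trans (cong₂ _*_ (sym (image₀ t)) (sym (image₂ t)))
        (trans (proj₁ (image-equations t)) (cong₂ _*_ (image₁ t) (image₁ t))))
      (solve 8 (λ t a b c d e f g →
        Κ z0 ⊕ t ⊗ (Κ z0 ⊕ t ⊗ (c ⊗ g ⊕ ⊝ (e ⊗ e) ⊕ t ⊗ (b ⊗ g ⊕ c ⊗ f ⊕ d ⊗ e ⊕ t ⊗
          (b ⊗ f ⊕ a ⊗ g ⊕ ⊝ (d ⊗ d) ⊕ t ⊗ (a ⊗ f ⊕ t ⊗ Κ z0))))) ⊜
        Κ z0 ⊕ Κ z1 ⊗ ((a ⊗ (t ⊗ t ⊗ t) ⊕ b ⊗ (t ⊗ t) ⊕ c ⊗ t) ⊗ (f ⊗ (t ⊗ t) ⊕ g ⊗ t) ⊕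
          ⊝ ((d ⊗ (t ⊗ t) ⊕ e ⊗ t) ⊗ (d ⊗ (t ⊗ t) ⊕ e ⊗ t)))) refl t m00 m10 m20 m11 m21 m12 m22)

    conic₂-vanishes : ∀ t → eval conic₂ t ≡ 0#
    conic₂-vanishes t = combine₁ 1#
      (trans (cong₂ _*_ (sym (image₁ t)) (sym (image₃ t)))
        (trans (proj₂ (image-equations t)) (cong₂ _*_ (image₂ t) (image₂ t))))
      (solve 8 (λ t n d e f g h i →
        Κ z0 ⊕ t ⊗ (e ⊗ n ⊕ t ⊗ (d ⊗ n ⊕ e ⊗ i ⊕ ⊝ (g ⊗ g) ⊕ t ⊗ (d ⊗ i ⊕ e ⊗ h ⊕ f ⊗ g ⊕ t ⊗
          (d ⊗ h ⊕ ⊝ (f ⊗ f) ⊕ t ⊗ Κ z0)))) ⊜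
        Κ z0 ⊕ Κ z1 ⊗ ((d ⊗ (t ⊗ t) ⊕ e ⊗ t) ⊗ (h ⊗ (t ⊗ t) ⊕ i ⊗ t ⊕ n) ⊕
          ⊝ ((f ⊗ (t ⊗ t) ⊕ g ⊗ t) ⊗ (f ⊗ (t ⊗ t) ⊕ g ⊗ t)))) refl t n m11 m21 m12 m22 m13 m23)

    coefficients₁ : ∀ i → lookup conic₁ i ≡ 0#
    coefficients₁ = vanishing-polynomial conic₁ 6≤q conic₁-vanishes

    coefficients₂ : ∀ i → lookup conic₂ i ≡ 0#
    coefficients₂ = vanishing-polynomial conic₂ (ℕ.≤-trans (ℕ.n≤1+n 5) 6≤q) conic₂-vanishes

    -- The top coefficient of `conic₁` and the linear one of `conic₂` are single products with a
    -- nonzero factor, which starts the elimination. Invertibility then makes m11 nonzero, and the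
    -- other off-diagonal entries fall in turn.
    m12≡0 : m12 ≡ 0#
    m12≡0 = cofactor-zero m00≢0 (coefficients₁ 5F)

    m21≡0 : m21 ≡ 0#
    m21≡0 = cofactor-zero n≢0 (trans (*-comm n m21) (coefficients₂ 1F))

    m11≢0 : m11 ≢ 0#
    m11≢0 e = column-nonzero φ λ { 0F → m₀₁ ; 1F → e ; 2F → m21≡0 ; 3F → m₃₁ }

    m13≡0 : m13 ≡ 0#
    m13≡0 = cofactor-zero m11≢0 (combine₂ 1# m12 (coefficients₂ 4F) m12≡0
      (solve 3 (λ a b c → a ⊗ b ⊜ Κ z0 ⊕ Κ z1 ⊗ (a ⊗ b ⊕ ⊝ (c ⊗ c) ⊕ ⊝ Κ z0) ⊕ c ⊗ (c ⊕ ⊝ Κ z0)) refl m11 m13 m12))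

    m23≡0 : m23 ≡ 0#
    m23≡0 = cofactor-zero m11≢0 (combine₃ 1# (- m13) (- m22) (coefficients₂ 3F) m21≡0 m12≡0
      (solve 6 (λ a b c d f g → a ⊗ b ⊜ Κ z0 ⊕ Κ z1 ⊗ (a ⊗ b ⊕ c ⊗ d ⊕ f ⊗ g ⊕ ⊝ Κ z0)
        ⊕ ⊝ d ⊗ (c ⊕ ⊝ Κ z0) ⊕ ⊝ g ⊗ (f ⊕ ⊝ Κ z0)) refl m11 m23 m21 m13 m12 m22))

    m11n≡m22² : m11 * n ≡ m22 * m22
    m11n≡m22² = combine₂ 1# (- m23) (coefficients₂ 2F) m21≡0
      (solve 5 (λ a n b d g → a ⊗ n ⊜ g ⊗ g ⊕ Κ z1 ⊗ (a ⊗ n ⊕ b ⊗ d ⊕ ⊝ (g ⊗ g) ⊕ ⊝ Κ z0)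
        ⊕ ⊝ d ⊗ (b ⊕ ⊝ Κ z0)) refl m11 n m21 m23 m22)

    m00m22≡m11² : m00 * m22 ≡ m11 * m11
    m00m22≡m11² = combine₂ 1# (- m10) (coefficients₁ 4F) m12≡0
      (solve 5 (λ a b f g d → a ⊗ g ⊜ d ⊗ d ⊕ Κ z1 ⊗ (b ⊗ f ⊕ a ⊗ g ⊕ ⊝ (d ⊗ d) ⊕ ⊝ Κ z0)
        ⊕ ⊝ b ⊗ (f ⊕ ⊝ Κ z0)) refl m00 m10 m12 m22 m11)

    m22≢0 : m22 ≢ 0#
    m22≢0 = factor≢0ʳ (λ e → *-nonzero m11≢0 m11≢0 (trans (sym m00m22≡m11²) e))

    m10≡0 : m10 ≡ 0#
    m10≡0 = cofactor-zero m22≢0 (combine₃ 1# (- m20) (- m11) (coefficients₁ 3F) m12≡0 m21≡0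
      (solve 6 (λ g b c f d h → g ⊗ b ⊜ Κ z0 ⊕ Κ z1 ⊗ (b ⊗ g ⊕ c ⊗ f ⊕ d ⊗ h ⊕ ⊝ Κ z0)
        ⊕ ⊝ c ⊗ (f ⊕ ⊝ Κ z0) ⊕ ⊝ d ⊗ (h ⊕ ⊝ Κ z0)) refl m22 m10 m20 m12 m11 m21))

    m20≡0 : m20 ≡ 0#
    m20≡0 = cofactor-zero m22≢0 (combine₂ 1# m21 (coefficients₁ 2F) m21≡0
      (solve 3 (λ g c h → g ⊗ c ⊜ Κ z0 ⊕ Κ z1 ⊗ (c ⊗ g ⊕ ⊝ (h ⊗ h) ⊕ ⊝ Κ z0) ⊕ h ⊗ (h ⊕ ⊝ Κ z0)) refl m22 m20 m21))

    m22⁻¹ = proj₁ (inverse m22 m22≢0)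
    m22m22⁻¹≡1 : m22 * m22⁻¹ ≡ 1#
    m22m22⁻¹≡1 = proj₂ (inverse m22 m22≢0)
    -- The surviving coefficients put the diagonal in geometric progression, n times (r³ , r² , r ,
    -- 1).
    r = m11 * m22⁻¹

    r≢0 : r ≢ 0#
    r≢0 = *-nonzero m11≢0 (inverse-nonzero m22m22⁻¹≡1)

    m22≡nr : m22 ≡ n * r
    m22≡nr = combine₂ (- m22⁻¹) (- m22) m11n≡m22² m22m22⁻¹≡1
      (solve 4 (λ g i d n → g ⊜ n ⊗ (d ⊗ i) ⊕ ⊝ i ⊗ (d ⊗ n ⊕ ⊝ (g ⊗ g)) ⊕ ⊝ g ⊗ (g ⊗ i ⊕ ⊝ Κ z1)) refl m22 m22⁻¹ m11 n)

    m11≡m22r : m11 ≡ m22 * r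
    m11≡m22r = combine₁ (- m11) m22m22⁻¹≡1
      (solve 3 (λ g i d → d ⊜ g ⊗ (d ⊗ i) ⊕ ⊝ d ⊗ (g ⊗ i ⊕ ⊝ Κ z1)) refl m22 m22⁻¹ m11)

    m00≡m11r : m00 ≡ m11 * r
    m00≡m11r = combine₂ m22⁻¹ (- m00) m00m22≡m11² m22m22⁻¹≡1
      (solve 4 (λ g i d a → a ⊜ d ⊗ (d ⊗ i) ⊕ i ⊗ (a ⊗ g ⊕ ⊝ (d ⊗ d)) ⊕ ⊝ a ⊗ (g ⊗ i ⊕ ⊝ Κ z1)) refl m22 m22⁻¹ m11 m00)

    entries : ∀ i j → m i j ≡ n * 𝕄 r 0# 0# 1# i j
    entries = λ
      { 0F 0F → trans m00≡m11r (combine₂ r (r * r) m11≡m22r m22≡nr (solve 4 (λ r n d g →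
          d ⊗ r ⊜ n ⊗ (r ⊗ r ⊗ r) ⊕ r ⊗ (d ⊕ ⊝ (g ⊗ r)) ⊕ r ⊗ r ⊗ (g ⊕ ⊝ (n ⊗ r))) refl r n m11 m22))
      ; 0F 1F → trans m₀₁ (solve 2 (λ r n → Κ z0 ⊜ n ⊗ (r ⊗ r ⊗ Κ z0)) refl r n)
      ; 0F 2F → trans m₀₂ (solve 2 (λ r n → Κ z0 ⊜ n ⊗ (r ⊗ (Κ z0 ⊗ Κ z0))) refl r n)
      ; 0F 3F → trans m₀₃ (solve 1 (λ n → Κ z0 ⊜ n ⊗ (Κ z0 ⊗ Κ z0 ⊗ Κ z0)) refl n)
      ; 1F 0F → trans m10≡0 (sym (zeroʳ n))
      ; 1F 1F → trans m11≡m22r (combine₁ r m22≡nr (solve 3 (λ r n g →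
          g ⊗ r ⊜ n ⊗ (r ⊗ detᴱ r (Κ z0) (Κ z0) (Κ z1)) ⊕ r ⊗ (g ⊕ ⊝ (n ⊗ r))) refl r n m22))
      ; 1F 2F → trans m12≡0 (solve 2 (λ r n → Κ z0 ⊜ n ⊗ ⊝ (Κ z0 ⊗ detᴱ r (Κ z0) (Κ z0) (Κ z1))) refl r n)
      ; 1F 3F → trans m13≡0 (sym (zeroʳ n))
      ; 2F 0F → trans m20≡0 (sym (zeroʳ n))
      ; 2F 1F → trans m21≡0 (solve 2 (λ r n → Κ z0 ⊜ n ⊗ ⊝ (Κ z0 ⊗ detᴱ r (Κ z0) (Κ z0) (Κ z1))) refl r n)
      ; 2F 2F → trans m22≡nr (solve 2 (λ r n → n ⊗ r ⊜ n ⊗ (Κ z1 ⊗ detᴱ r (Κ z0) (Κ z0) (Κ z1))) refl r n)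
      ; 2F 3F → trans m23≡0 (sym (zeroʳ n))
      ; 3F 0F → trans m₃₀ (solve 1 (λ n → Κ z0 ⊜ n ⊗ (Κ z0 ⊗ Κ z0 ⊗ Κ z0)) refl n)
      ; 3F 1F → trans m₃₁ (solve 1 (λ n → Κ z0 ⊜ n ⊗ (Κ z0 ⊗ Κ z0 ⊗ Κ z1)) refl n)
      ; 3F 2F → trans m₃₂ (solve 1 (λ n → Κ z0 ⊜ n ⊗ (Κ z0 ⊗ (Κ z1 ⊗ Κ z1))) refl n)
      ; 3F 3F → solve 1 (λ n → n ⊜ n ⊗ (Κ z1 ⊗ Κ z1 ⊗ Κ z1)) refl n
      }

  v-multiple : ∀ k s t i → v (k * s) (k * t) i ≡ k * k * k * v s t i
  v-multiple k s t = λ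
    { 0F → solve 2 (λ k s → k ⊗ s ⊗ (k ⊗ s) ⊗ (k ⊗ s) ⊜ k ⊗ k ⊗ k ⊗ (s ⊗ s ⊗ s)) refl k s
    ; 1F → solve 3 (λ k s t → k ⊗ s ⊗ (k ⊗ s) ⊗ (k ⊗ t) ⊜ k ⊗ k ⊗ k ⊗ (s ⊗ s ⊗ t)) refl k s t
    ; 2F → solve 3 (λ k s t → k ⊗ s ⊗ (k ⊗ t ⊗ (k ⊗ t)) ⊜ k ⊗ k ⊗ k ⊗ (s ⊗ (t ⊗ t))) refl k s t
    ; 3F → solve 2 (λ k t → k ⊗ t ⊗ (k ⊗ t) ⊗ (k ⊗ t) ⊜ k ⊗ k ⊗ k ⊗ (t ⊗ t ⊗ t)) refl k t
    }

  -- Proportional parameters would send the distinct points `E₀` and `E₃` to one point, while the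
  -- image of the line joining them is again presented by two distinct points.
  rows-independent : ∀ φ {k s t k′ s′ t′} → k ≢ 0# → NonZero² s t → k′ ≢ 0# → NonZero² s′ t′ →
    (∀ i → matrix φ 0F i ≡ k * v s t i) → (∀ i → matrix φ 3F i ≡ k′ * v s′ t′ i) → det s s′ t t′ ≢ 0#
  rows-independent φ {k} {s} {t} {k′} {s′} {t′} k≢0 nz k′≢0 nz′ e e′ D≡0
    with parallel nz′ (combine₁ (- 1#) D≡0 (solve 4 (λ s t s′ t′ →
           s′ ⊗ t ⊜ t′ ⊗ s ⊕ ⊝ Κ z1 ⊗ (detᴱ s s′ t t′ ⊕ ⊝ Κ z0)) refl s t s′ t′))
       | inverse k′ k′≢0
  ... | m , refl , refl | k′⁻¹ , k′k′⁻¹≡1 = Line.distinct (E₀E₃ ⟪ φ ⟫ᴸ)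
    ( k * m³ * k′⁻¹
    , *-nonzero (*-nonzero k≢0 (*-nonzero (*-nonzero m≢0 m≢0) m≢0)) (inverse-nonzero k′k′⁻¹≡1)
    , λ i → begin
        (e₀ · matrix φ) i                       ≡⟨ e₀·≗ (matrix φ) i ⟩
        matrix φ 0F i                           ≡⟨ e i ⟩
        k * v (m * s′) (m * t′) i               ≡⟨ cong (k *_) (v-multiple m s′ t′ i) ⟩
        k * (m³ * v s′ t′ i)                    ≡⟨ combine₁ (- (k * (m³ * v s′ t′ i))) k′k′⁻¹≡1
          (solve 5 (λ k m y k′ i → k ⊗ (m ⊗ y) ⊜ k ⊗ m ⊗ i ⊗ (k′ ⊗ y) ⊕ ⊝ (k ⊗ (m ⊗ y)) ⊗ (k′ ⊗ i ⊕ ⊝ Κ z1))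
            refl k m³ (v s′ t′ i) k′ k′⁻¹) ⟩
        k * m³ * k′⁻¹ * (k′ * v s′ t′ i)        ≡⟨ cong (k * m³ * k′⁻¹ *_) (trans (e₃·≗ (matrix φ) i) (e′ i)) ⟨
        k * m³ * k′⁻¹ * (e₃ · matrix φ) i       ∎)
    where
    m³ = m * m * m
    m≢0 : m ≢ 0#
    m≢0 = parallel-factor≢0 nz refl refl

  InG-⨾ : ∀ φ ψ → InG φ → InG ψ → InG (φ ⨾ ψ)
  InG-⨾ φ ψ φ∈G ψ∈G X = mk⇔
    (λ X∈𝒞 → move {X ⟪ φ ⟫ᴾ ⟪ ψ ⟫ᴾ} {X ⟪ φ ⨾ ψ ⟫ᴾ} (·-assoc (coords X) (matrix φ) (matrix ψ))
      (Equivalence.to (ψ∈G (X ⟪ φ ⟫ᴾ)) (Equivalence.to (φ∈G X) X∈𝒞)))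
    (λ X∈𝒞 → Equivalence.from (φ∈G X) (Equivalence.from (ψ∈G (X ⟪ φ ⟫ᴾ))
      (move {X ⟪ φ ⨾ ψ ⟫ᴾ} {X ⟪ φ ⟫ᴾ ⟪ ψ ⟫ᴾ} (λ i → sym (·-assoc (coords X) (matrix φ) (matrix ψ) i)) X∈𝒞)))
    where
    move : ∀ {Y Z : Point} → coords Y ≗ coords Z → OnCubic Y → OnCubic Z
    move Y≗Z (t , k , k≢0 , e) = t , k , k≢0 , λ i → trans (sym (Y≗Z i)) (e i)

  -- G_q acts transitively on pairs of cubic points, so it suffices to treat projectivities
  -- that fix E₀ and E₃.
  cubic-rows⇒𝕄 : 6 ≤ q → ∀ ψ → InG ψ → IsCubic (matrix ψ 0F) → IsCubic (matrix ψ 3F) →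
    ∃[ g ] matrix ψ ∝ᴹ 𝕄[ g ]
  cubic-rows⇒𝕄 6≤q ψ ψ∈G (k₀ , s₀ , t₀ , k₀≢0 , nz₀ , e₀≡) (k₃ , s₃ , t₃ , k₃≢0 , nz₃ , e₃≡) = compose diagonal
    where
    D≢0 : det s₀ s₃ t₀ t₃ ≢ 0#
    D≢0 = rows-independent ψ k₀≢0 nz₀ k₃≢0 nz₃ e₀≡ e₃≡
    D = det s₀ s₃ t₀ t₃
    -- The columns are the parameters of the images of `E₀` and `E₃`, so following ψ by `adj g`
    -- brings both images back.
    g = gl s₀ s₃ t₀ t₃ D≢0
    φ = ψ ⨾ projectivity (adj g)

    κ = det⁻³ g

    row : ∀ r k s t → (∀ j → matrix ψ r j ≡ k * v s t j) →
      ∀ i → matrix φ r i ≡ k * v (t₃ * s + - s₃ * t) (- t₀ * s + s₀ * t) i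
    row r k s t e i = begin
      (matrix ψ r · 𝕄[ adj g ]) i              ≡⟨ ·-congˡ (matrix ψ r) (λ j → k * v s t j) 𝕄[ adj g ] e i ⟩
      ((λ j → k * v s t j) · 𝕄[ adj g ]) i     ≡⟨ scale-· k (v s t) 𝕄[ adj g ] i ⟩
      k * (v s t · 𝕄[ adj g ]) i               ≡⟨ cong (k *_) (v·𝕄 s t t₃ (- s₃) (- t₀) s₀ i) ⟩
      k * v (t₃ * s + - s₃ * t) (- t₀ * s + s₀ * t) i ∎

    row₀ : ∀ i → matrix φ 0F i ≡ k₀ * v D 0# i
    row₀ i = trans (row 0F k₀ s₀ t₀ e₀≡ i) (cong₂ (λ s t → k₀ * v s t i)
      (solve 4 (λ a b c d → d ⊗ a ⊕ ⊝ b ⊗ c ⊜ detᴱ a b c d) refl s₀ s₃ t₀ t₃)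
      (solve 2 (λ a c → ⊝ c ⊗ a ⊕ a ⊗ c ⊜ Κ z0) refl s₀ t₀))

    row₃ : ∀ i → matrix φ 3F i ≡ k₃ * v 0# D i
    row₃ i = trans (row 3F k₃ s₃ t₃ e₃≡ i) (cong₂ (λ s t → k₃ * v s t i)
      (solve 2 (λ b d → d ⊗ b ⊕ ⊝ b ⊗ d ⊜ Κ z0) refl s₃ t₃)
      (solve 4 (λ a b c d → ⊝ c ⊗ b ⊕ a ⊗ d ⊜ detᴱ a b c d) refl s₀ s₃ t₀ t₃))

    diagonal : ∃[ r ] r ≢ 0# × matrix φ ∝ᴹ 𝕄 r 0# 0# 1#
    diagonal = fixes-E₀E₃⇒diagonal 6≤q φ (InG-⨾ ψ (projectivity (adj g)) ψ∈G (InG-projectivity (adj g)))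
          (trans (row₀ 1F) (solve 2 (λ k d → k ⊗ (d ⊗ d ⊗ Κ z0) ⊜ Κ z0) refl k₀ D))
          (trans (row₀ 2F) (solve 2 (λ k d → k ⊗ (d ⊗ (Κ z0 ⊗ Κ z0)) ⊜ Κ z0) refl k₀ D))
          (trans (row₀ 3F) (solve 1 (λ k → k ⊗ (Κ z0 ⊗ Κ z0 ⊗ Κ z0) ⊜ Κ z0) refl k₀))
          (trans (row₃ 0F) (solve 1 (λ k → k ⊗ (Κ z0 ⊗ Κ z0 ⊗ Κ z0) ⊜ Κ z0) refl k₃))
          (trans (row₃ 1F) (solve 2 (λ k d → k ⊗ (Κ z0 ⊗ Κ z0 ⊗ d) ⊜ Κ z0) refl k₃ D))
          (trans (row₃ 2F) (solve 2 (λ k d → k ⊗ (Κ z0 ⊗ (d ⊗ d)) ⊜ Κ z0) refl k₃ D))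

    compose : ∃[ r ] r ≢ 0# × matrix φ ∝ᴹ 𝕄 r 0# 0# 1# → ∃[ h ] matrix ψ ∝ᴹ 𝕄[ h ]
    compose (r , r≢0 , n , n≢0 , φ≡) = h , κ * n , *-nonzero (det⁻³≢0 g) n≢0 , λ i j → begin
        matrix ψ i j                                            ≡⟨ undo-adj g (matrix ψ i) j ⟨
        κ * (matrix φ i · 𝕄[ g ]) j                             ≡⟨ cong (κ *_) (·-congˡ (matrix φ i) _ 𝕄[ g ] (φ≡ i) j) ⟩
        κ * ((λ j → n * 𝕄 r 0# 0# 1# i j) · 𝕄[ g ]) j           ≡⟨ cong (κ *_) (scale-· n (𝕄 r 0# 0# 1# i) 𝕄[ g ] j) ⟩
        κ * (n * (𝕄 r 0# 0# 1# i · 𝕄[ g ]) j)                   ≡⟨ *-assoc κ n _ ⟨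
        κ * n * (𝕄 r 0# 0# 1# i · 𝕄[ g ]) j                     ≡⟨ cong (κ * n *_) (𝕄⊗𝕄 r 0# 0# 1# s₀ s₃ t₀ t₃ i j) ⟩
        κ * n * 𝕄[ h ] i j                                      ∎
      where
      h = gl (s₀ * r + s₃ * 0#) (s₀ * 0# + s₃ * 1#) (t₀ * r + t₃ * 0#) (t₀ * 0# + t₃ * 1#) λ e →
        *-nonzero r≢0 D≢0 (trans (solve 5 (λ r a b c d → r ⊗ detᴱ a b c d ⊜
          detᴱ (a ⊗ r ⊕ b ⊗ Κ z0) (a ⊗ Κ z0 ⊕ b ⊗ Κ z1) (c ⊗ r ⊕ d ⊗ Κ z0) (c ⊗ Κ z0 ⊕ d ⊗ Κ z1))
          refl r s₀ s₃ t₀ t₃) e)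

  abstract
    InG⇒𝕄 : 6 ≤ q → ∀ ψ → InG ψ → ∃[ g ] matrix ψ ∝ᴹ 𝕄[ g ]
    InG⇒𝕄 6≤q ψ ψ∈G = cubic-rows⇒𝕄 6≤q ψ ψ∈G (row₀-cubic ψ ψ∈G) (row₃-cubic ψ ψ∈G)

-- External lines meeting the axis are the lines with a valid label

module ExternalLines {c : Level} {q : ℕ} (𝔽 : FiniteField c q)
  (1+1+1≡0 : CharacteristicThree 𝔽) where

  open FiniteField 𝔽
  open FieldArithmetic 𝔽 1+1+1≡0
  open TwistedCubic 𝔽 renaming (_⊗_ to _⊗ᴹ_)
  open CubicGroup 𝔽 1+1+1≡0
  open LineLabels 𝔽 1+1+1≡0
  open CubicStabilizer 𝔽 1+1+1≡0
  open ≡-Reasoning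

  -- The multiplier of an axis point is 0, so `incidence` says that the determinant of the two axis
  -- points vanishes.
  same-axis-point : ∀ {x₁ x₂ s t w} (x≢0 : NonZero² x₁ x₂) → NonZero² s t → ∀ {x₁′ x₂′} →
    OnLabel (label x₁′ x₂′ s t w) (coords (axisPoint x≢0)) → x₁′ * x₂ ≡ x₂′ * x₁
  same-axis-point {x₁} {x₂} {w = w} x≢0 y≢0 {x₁′} {x₂′} o = on-axis o (axis-multiplier y≢0 refl refl o)
    where
    on-axis : (o : OnLabel (label x₁′ x₂′ _ _ w) (coords (axisPoint x≢0))) → OnLabel.l o ≡ 0# → x₁′ * x₂ ≡ x₂′ * x₁
    on-axis (on l u₁ u₂ e f) refl = combine₃ (- x₂′) (- x₁′) (- 1#) (e 1F) (e 2F) f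
      (solve 9 (λ x₁ x₂ x₁′ x₂′ u₁ u₂ w v₁ v₂ → x₁′ ⊗ x₂ ⊜ x₂′ ⊗ x₁
        ⊕ ⊝ x₂′ ⊗ (x₁ ⊕ ⊝ (Κ z0 ⊗ v₁ ⊕ u₁)) ⊕ ⊝ x₁′ ⊗ (⊝ x₂ ⊕ ⊝ (Κ z0 ⊗ v₂ ⊕ u₂))
        ⊕ ⊝ Κ z1 ⊗ (x₂′ ⊗ u₁ ⊕ x₁′ ⊗ u₂ ⊕ ⊝ (Κ z0 ⊗ w))) refl x₁ x₂ x₁′ x₂′ u₁ u₂ w _ _)

  abstract
    -- The axis point gives x up to k. For a point off the axis the outer coordinates read s³ = l
    -- s′³ and t³ = l t′³, and a cube root m of l gives y = m y′. The cubic parts then cancel, the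
    -- displacements agree, and their determinants with the axis points compare `w` with `w′`.
    label-unique : ∀ {ℓ L L′} → Valid L → Valid L′ → Represents ℓ L → Represents ℓ L′ → L ∼ L′
    label-unique {ℓ} {label x₁ x₂ s t w} {label x₁′ x₂′ s′ t′ w′} val@(valid x≢0 y≢0 w≢0) (valid x′≢0 y′≢0 w′≢0) rep rep′
      with parallel x′≢0 (same-axis-point x≢0 y′≢0 (Equivalence.to (rep′ (axisPoint x≢0)) (Equivalence.from (rep (axisPoint x≢0)) (axisPoint-on x≢0))))
         | point-off-axis val
    ... | k , refl , refl | X , U₁ , U₂ , X≗ , f
      = from-on (Equivalence.to (rep′ X) (Equivalence.from (rep X) X-on))
      where
      k≢0 : k ≢ 0#
      k≢0 = parallel-factor≢0 x≢0 refl refl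
      X-on : OnLabel (label x₁ x₂ s t w) (coords X)
      X-on = on 1# U₁ U₂ (λ i → trans (X≗ i) (cong (_+ axial U₁ U₂ i) (sym (*-identityˡ _))))
        (trans f (sym (*-identityˡ w)))
      from-on : OnLabel (label x₁′ x₂′ s′ t′ w′) (coords X) → label x₁ x₂ s t w ∼ label x₁′ x₂′ s′ t′ w′
      from-on (on l u₁ u₂ e f′) with cubeRoot l
      ... | m , refl = related k m k≢0 (parallel-factor≢0 y≢0 s≡ms′ t≡mt′) refl refl s≡ms′ t≡mt′ w≡
        where
        X≡ : ∀ i → v s t i + axial U₁ U₂ i ≡ m * m * m * v s′ t′ i + axial u₁ u₂ i
        X≡ i = trans (sym (X≗ i)) (e i)
        s≡ms′ : s ≡ m * s′
        s≡ms′ = cube-injective (combine₁ 1# (X≡ 0F) (solve 3 (λ s m s′ → s ⊗ s ⊗ s ⊜ m ⊗ s′ ⊗ (m ⊗ s′) ⊗ (m ⊗ s′)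
          ⊕ Κ z1 ⊗ (s ⊗ s ⊗ s ⊕ Κ z0 ⊕ ⊝ (m ⊗ m ⊗ m ⊗ (s′ ⊗ s′ ⊗ s′) ⊕ Κ z0))) refl s m s′))
        t≡mt′ : t ≡ m * t′
        t≡mt′ = cube-injective (combine₁ 1# (X≡ 3F) (solve 3 (λ s m s′ → s ⊗ s ⊗ s ⊜ m ⊗ s′ ⊗ (m ⊗ s′) ⊗ (m ⊗ s′)
          ⊕ Κ z1 ⊗ (s ⊗ s ⊗ s ⊕ Κ z0 ⊕ ⊝ (m ⊗ m ⊗ m ⊗ (s′ ⊗ s′ ⊗ s′) ⊕ Κ z0))) refl t m t′))
        X≡′ : ∀ i → m * m * m * v s′ t′ i + axial U₁ U₂ i ≡ m * m * m * v s′ t′ i + axial u₁ u₂ i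
        X≡′ i = trans (cong (_+ axial U₁ U₂ i) (trans (sym (v-multiple m s′ t′ i))
          (cong₂ (λ s t → v s t i) (sym s≡ms′) (sym t≡mt′)))) (X≡ i)
        w≡ : w ≡ k * (m * m * m) * w′
        w≡ = combine₂ (- 1#) k f f′ (combine₂ (k * x₂′) (k * x₁′) (X≡′ 1F) (X≡′ 2F)
          (solve 12 (λ w k m w′ x₁ x₂ u₁ u₂ U₁ U₂ v₁ v₂ → w ⊜ k ⊗ (m ⊗ m ⊗ m) ⊗ w′
            ⊕ ⊝ Κ z1 ⊗ (k ⊗ x₂ ⊗ U₁ ⊕ k ⊗ x₁ ⊗ U₂ ⊕ ⊝ w)
            ⊕ k ⊗ (x₂ ⊗ u₁ ⊕ x₁ ⊗ u₂ ⊕ ⊝ (m ⊗ m ⊗ m ⊗ w′))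
            ⊕ k ⊗ x₂ ⊗ (m ⊗ m ⊗ m ⊗ v₁ ⊕ U₁ ⊕ ⊝ (m ⊗ m ⊗ m ⊗ v₁ ⊕ u₁))
            ⊕ k ⊗ x₁ ⊗ (m ⊗ m ⊗ m ⊗ v₂ ⊕ U₂ ⊕ ⊝ (m ⊗ m ⊗ m ⊗ v₂ ⊕ u₂)))
            refl w k m w′ x₁′ x₂′ u₁ u₂ U₁ U₂ (v s′ t′ 1F) (v s′ t′ 2F)))

  -- The osculating planes at 0 and at infinity are x₀ = 0 and x₃ = 0.
  OnAxis⇒ : ∀ {X} → OnAxis X → coords X 0F ≡ 0# × coords X 3F ≡ 0#
  OnAxis⇒ {X} onAxis = combine₁ 1# (onAxis (just 0#)) (solve 4 (λ x₀ x₁ x₂ x₃ → let 3ᴱ = Κ z1 ⊕ Κ z1 ⊕ Κ z1 ; t = Κ z0 in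
      x₀ ⊜ Κ z0 ⊕ Κ z1 ⊗ (x₀ ⊕ ⊝ (3ᴱ ⊗ t ⊗ x₁) ⊕ 3ᴱ ⊗ (t ⊗ t) ⊗ x₂ ⊕ ⊝ (t ⊗ t ⊗ t ⊗ x₃) ⊕ ⊝ Κ z0))
      refl (coords X 0F) (coords X 1F) (coords X 2F) (coords X 3F))
    , onAxis ∞

  ⇒OnAxis : ∀ {X} → coords X 0F ≡ 0# → coords X 3F ≡ 0# → OnAxis X
  ⇒OnAxis {X} x₀≡0 x₃≡0 (just t) = combine₂ 1# (- (t * t * t)) x₀≡0 x₃≡0
    (solve 5 (λ x₀ x₁ x₂ x₃ t → let 3ᴱ = Κ z1 ⊕ Κ z1 ⊕ Κ z1 in
      x₀ ⊕ ⊝ (3ᴱ ⊗ t ⊗ x₁) ⊕ 3ᴱ ⊗ (t ⊗ t) ⊗ x₂ ⊕ ⊝ (t ⊗ t ⊗ t ⊗ x₃) ⊜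
      Κ z0 ⊕ Κ z1 ⊗ (x₀ ⊕ ⊝ Κ z0) ⊕ ⊝ (t ⊗ t ⊗ t) ⊗ (x₃ ⊕ ⊝ Κ z0))
      refl (coords X 0F) (coords X 1F) (coords X 2F) (coords X 3F) t)
  ⇒OnAxis x₀≡0 x₃≡0 ∞ = x₃≡0

  -- A cubic point on a labelled line could only be v (s , t), forcing w = 0.
  label⇒external : ∀ {L z} → Valid L → OnLabel L z → ¬ IsCubic z
  label⇒external {label x₁ x₂ s t w} {z} (valid x≢0 y≢0 w≢0) o@(on l u₁ u₂ e f) (k , s′ , t′ , k≢0 , y′≢0 , z≡)
    with inverse k k≢0
  -- With ν³ = l / k, the outer coordinates give (s′ , t′) = ν (s , t). Hence u vanishes and l w =
  -- 0.
  ... | k⁻¹ , kk⁻¹≡1 with cubeRoot (l * k⁻¹)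
  ... | ν , ν³≡l/k = *-nonzero (off-axis-multiplier z≢0 o) w≢0 (combine₃ (- 1#) (- x₂) (- x₁) f (u≡0 1F) (u≡0 2F)
        (solve 6 (λ l w x₁ x₂ u₁ u₂ → l ⊗ w ⊜ Κ z0 ⊕ ⊝ Κ z1 ⊗ (x₂ ⊗ u₁ ⊕ x₁ ⊗ u₂ ⊕ ⊝ (l ⊗ w))
          ⊕ ⊝ x₂ ⊗ (⊝ u₁ ⊕ ⊝ Κ z0) ⊕ ⊝ x₁ ⊗ (⊝ u₂ ⊕ ⊝ Κ z0)) refl l w x₁ x₂ u₁ u₂))
    where
    z≢0 : z 0F ≢ 0# ⊎ z 3F ≢ 0#
    z≢0 with v≢𝟘 y′≢0
    ... | inj₁ nz = inj₁ (λ z≡0 → *-nonzero k≢0 nz (trans (sym (z≡ 0F)) z≡0))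
    ... | inj₂ nz = inj₂ (λ z≡0 → *-nonzero k≢0 nz (trans (sym (z≡ 3F)) z≡0))
    kν³≡l : k * (ν * ν * ν) ≡ l
    kν³≡l = combine₂ k l ν³≡l/k kk⁻¹≡1 (solve 4 (λ k l i ν → k ⊗ (ν ⊗ ν ⊗ ν) ⊜ l
      ⊕ k ⊗ (ν ⊗ ν ⊗ ν ⊕ ⊝ (l ⊗ i)) ⊕ l ⊗ (k ⊗ i ⊕ ⊝ Κ z1)) refl k l k⁻¹ ν)
    v≡ : ∀ i → k * v s′ t′ i ≡ l * v s t i + axial u₁ u₂ i
    v≡ i = trans (sym (z≡ i)) (e i)
    root : ∀ {x y} → k * (x * x * x) ≡ l * (y * y * y) + 0# → x ≡ ν * y
    root {x} {y} h = cube-injective (*-cancelˡ k≢0 (combine₂ 1# (- (y * y * y)) h kν³≡l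
      (solve 5 (λ k l ν x y → k ⊗ (x ⊗ x ⊗ x) ⊜ k ⊗ (ν ⊗ y ⊗ (ν ⊗ y) ⊗ (ν ⊗ y))
        ⊕ Κ z1 ⊗ (k ⊗ (x ⊗ x ⊗ x) ⊕ ⊝ (l ⊗ (y ⊗ y ⊗ y) ⊕ Κ z0)) ⊕ ⊝ (y ⊗ y ⊗ y) ⊗ (k ⊗ (ν ⊗ ν ⊗ ν) ⊕ ⊝ l))
        refl k l ν x y)))
    u≡0 : ∀ i → - axial u₁ u₂ i ≡ 0#
    u≡0 i = combine₂ 1# (- v s t i) (v≡ i) kν³≡l (trans (sym (combine₁ k (trans
        (cong₂ (λ s t → v s t i) (root (v≡ 0F)) (root (v≡ 3F))) (v-multiple ν s t i))
        (solve 6 (λ k l m y y′ u → Κ z0 ⊕ Κ z1 ⊗ (k ⊗ y′ ⊕ ⊝ (l ⊗ y ⊕ u)) ⊕ ⊝ y ⊗ (k ⊗ m ⊕ ⊝ l)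
          ⊜ ⊝ u ⊕ k ⊗ (y′ ⊕ ⊝ (m ⊗ y)))
          refl k l (ν * ν * ν) (v s t i) (v s′ t′ i) (axial u₁ u₂ i)))) refl)

  abstract
    label⇒ExternalMeetingAxis : ∀ {ℓ L} → Valid L → Represents ℓ L → ExternalMeetingAxis ℓ
    label⇒ExternalMeetingAxis {ℓ} {L} val@(valid x≢0 y≢0 w≢0) rep = record
      { external  = λ X X∈ℓ onC → label⇒external val (Equivalence.to (rep X) X∈ℓ) (OnCubic⇒IsCubic {X} onC)
      ; meetsAxis = axisPoint x≢0 , Equivalence.from (rep (axisPoint x≢0)) (axisPoint-on x≢0) , ⇒OnAxis {axisPoint x≢0} refl refl
      ; notAxis   = notAxis
      }
      where
      notAxis : ¬ (∀ X → X ∈ ℓ ⇔ OnAxis X)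
      notAxis ℓ⇔axis with point-off-axis val
      ... | X , U₁ , U₂ , X≗ , f with OnAxis⇒ {X} (Equivalence.to (ℓ⇔axis X) (Equivalence.from (rep X)
              (on 1# U₁ U₂ (λ i → trans (X≗ i) (cong (_+ axial U₁ U₂ i) (sym (*-identityˡ _))))
                (trans f (sym (*-identityˡ _))))))
      ...   | z₀≡0 , z₃≡0 with v≢𝟘 y≢0
      ...     | inj₁ nz = nz (trans (sym (+-identityʳ _)) (trans (sym (X≗ 0F)) z₀≡0))
      ...     | inj₂ nz = nz (trans (sym (+-identityʳ _)) (trans (sym (X≗ 3F)) z₃≡0))

  Spanned : Line → Vec⁴ → Vec⁴ → Set c
  Spanned ℓ a b = ∀ X → X ∈ ℓ ⇔ (∃[ γ ] ∃[ δ ] ∀ i → coords X i ≡ γ * a i + δ * b i)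

  -- Cube roots of the outer coordinates of `b` give the cubic point in the plane of the axis and
  -- `b`; the rest of `b` is the displacement. Externality enters only in w ≠ 0.
  label-of-span : ∀ {ℓ a b} → Spanned ℓ a b → (∀ X → X ∈ ℓ → ¬ OnCubic X) →
    a 0F ≡ 0# → a 3F ≡ 0# → NonZero² (a 1F) (a 2F) → NonZero² (b 0F) (b 3F) →
    ∃[ L ] Valid L × Represents ℓ L
  label-of-span {ℓ} {a} {b} span external a₀≡0 a₃≡0 a≢0 b≢0 with cubeRoot (b 0F) | cubeRoot (b 3F)
  ... | s , s³≡b₀ | t , t³≡b₃ = label (a 1F) (- a 2F) s t w , valid x≢0 y≢0 w≢0 , rep
    where
    u₁ = b 1F + - (s * s * t)
    u₂ = b 2F + - (s * (t * t))
    w = - a 2F * u₁ + a 1F * u₂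
    root≢0 : ∀ {x y} → x * x * x ≡ y → y ≢ 0# → x ≢ 0#
    root≢0 x³≡y y≢0 refl = y≢0 (trans (sym x³≡y) (zeroʳ _))
    x≢0 : NonZero² (a 1F) (- a 2F)
    x≢0 = map₂⊎ (λ a₂≢0 e → a₂≢0 (trans (sym (-‿involutive _)) (trans (cong -_ e) -0#≈0#))) a≢0
    y≢0 : NonZero² s t
    y≢0 = map⊎ (root≢0 s³≡b₀) (root≢0 t³≡b₃) b≢0
    b≡ : ∀ i → b i ≡ v s t i + axial u₁ u₂ i
    b≡ = λ
      { 0F → trans (sym s³≡b₀) (sym (+-identityʳ _))
      ; 1F → solve 2 (λ b y → b ⊜ y ⊕ (b ⊕ ⊝ y)) refl _ _
      ; 2F → solve 2 (λ b y → b ⊜ y ⊕ (b ⊕ ⊝ y)) refl _ _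
      ; 3F → trans (sym t³≡b₃) (sym (+-identityʳ _))
      }
    a≡ : ∀ i → a i ≡ axial (a 1F) (a 2F) i
    a≡ = λ { 0F → a₀≡0 ; 1F → refl ; 2F → refl ; 3F → a₃≡0 }
    combination : ∀ γ δ i → γ * a i + δ * b i ≡ δ * v s t i + axial (γ * a 1F + δ * u₁) (γ * a 2F + δ * u₂) i
    combination γ δ i = begin
      γ * a i + δ * b i
        ≡⟨ cong₂ (λ x y → γ * x + δ * y) (a≡ i) (b≡ i) ⟩
      γ * axial (a 1F) (a 2F) i + δ * (v s t i + axial u₁ u₂ i)
        ≡⟨ solve 5 (λ γ δ y p u → γ ⊗ p ⊕ δ ⊗ (y ⊕ u) ⊜ δ ⊗ y ⊕ (γ ⊗ p ⊕ δ ⊗ u)) refl γ δ _ _ _ ⟩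
      δ * v s t i + (γ * axial (a 1F) (a 2F) i + δ * axial u₁ u₂ i)
        ≡⟨ cong (δ * v s t i +_) (axial-sum i) ⟩
      δ * v s t i + axial (γ * a 1F + δ * u₁) (γ * a 2F + δ * u₂) i ∎
      where
      axial-sum : ∀ i → γ * axial (a 1F) (a 2F) i + δ * axial u₁ u₂ i ≡ axial (γ * a 1F + δ * u₁) (γ * a 2F + δ * u₂) i
      axial-sum = λ
        { 0F → solve 2 (λ γ δ → γ ⊗ Κ z0 ⊕ δ ⊗ Κ z0 ⊜ Κ z0) refl γ δ
        ; 1F → refl
        ; 2F → refl
        ; 3F → solve 2 (λ γ δ → γ ⊗ Κ z0 ⊕ δ ⊗ Κ z0 ⊜ Κ z0) refl γ δ
        }
    w≢0 : w ≢ 0#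
    -- If w = 0, the displacement is κ a, so b - κ a is the cubic vector `v s t` on the line.
    w≢0 w≡0 with parallel a≢0 (combine₁ 1# w≡0 (solve 4 (λ a₁ a₂ u₁ u₂ →
        a₁ ⊗ u₂ ⊜ a₂ ⊗ u₁ ⊕ Κ z1 ⊗ (⊝ a₂ ⊗ u₁ ⊕ a₁ ⊗ u₂ ⊕ ⊝ Κ z0)) refl (a 1F) (a 2F) u₁ u₂))
    ... | κ , u₁≡ , u₂≡ = external V
        (Equivalence.from (span V) (- κ , 1# , λ i → sym (trans (combination (- κ) 1# i) (trans
          (cong (1# * v s t i +_) (axial-cong (vanish u₁≡) (vanish u₂≡) i)) (drop i)))))
        (IsCubic⇒OnCubic {V} (v-cubic y≢0))
      where
      V = point (v s t) (v-nonzero y≢0)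
      vanish : ∀ {a u} → u ≡ κ * a → - κ * a + 1# * u ≡ 0#
      vanish {a} {u} e = combine₁ 1# e (solve 3 (λ κ a u → ⊝ κ ⊗ a ⊕ Κ z1 ⊗ u ⊜ Κ z0 ⊕ Κ z1 ⊗ (u ⊕ ⊝ (κ ⊗ a))) refl κ a u)
      drop : ∀ i → 1# * v s t i + axial 0# 0# i ≡ v s t i
      drop = λ
        { 0F → trans (+-identityʳ _) (*-identityˡ _)
        ; 1F → trans (+-identityʳ _) (*-identityˡ _)
        ; 2F → trans (+-identityʳ _) (*-identityˡ _)
        ; 3F → trans (+-identityʳ _) (*-identityˡ _)
        }
    rep : Represents ℓ (label (a 1F) (- a 2F) s t w)
    rep X = mk⇔ to from
      where
      to : X ∈ ℓ → OnLabel (label (a 1F) (- a 2F) s t w) (coords X)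
      to X∈ with Equivalence.to (span X) X∈
      ... | γ , δ , e = on δ (γ * a 1F + δ * u₁) (γ * a 2F + δ * u₂) (λ i → trans (e i) (combination γ δ i))
        (solve 6 (λ γ δ a₁ a₂ u₁ u₂ → ⊝ a₂ ⊗ (γ ⊗ a₁ ⊕ δ ⊗ u₁) ⊕ a₁ ⊗ (γ ⊗ a₂ ⊕ δ ⊗ u₂) ⊜
          δ ⊗ (⊝ a₂ ⊗ u₁ ⊕ a₁ ⊗ u₂)) refl γ δ (a 1F) (a 2F) u₁ u₂)
      from : OnLabel (label (a 1F) (- a 2F) s t w) (coords X) → X ∈ ℓ
      from (on l p₁ p₂ e f) with parallel {x′ = p₁ + - (l * u₁)} {y′ = p₂ + - (l * u₂)} a≢0 (combine₁ 1# f
          (solve 7 (λ l p₁ p₂ a₁ a₂ u₁ u₂ → a₁ ⊗ (p₂ ⊕ ⊝ (l ⊗ u₂)) ⊜ a₂ ⊗ (p₁ ⊕ ⊝ (l ⊗ u₁))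
            ⊕ Κ z1 ⊗ (⊝ a₂ ⊗ p₁ ⊕ a₁ ⊗ p₂ ⊕ ⊝ (l ⊗ (⊝ a₂ ⊗ u₁ ⊕ a₁ ⊗ u₂)))) refl l p₁ p₂ (a 1F) (a 2F) u₁ u₂))
      ... | κ , e₁ , e₂ = Equivalence.from (span X) (κ , l , λ i → trans (e i) (trans
          (cong (l * v s t i +_) (axial-cong (shift e₁) (shift e₂) i)) (sym (combination κ l i))))
        where
        shift : ∀ {p u a} → p + - (l * u) ≡ κ * a → p ≡ κ * a + l * u
        shift {p} {u} {a} h = combine₁ 1# h (solve 5 (λ p l u κ a →
          p ⊜ κ ⊗ a ⊕ l ⊗ u ⊕ Κ z1 ⊗ (p ⊕ ⊝ (l ⊗ u) ⊕ ⊝ (κ ⊗ a))) refl p l u κ a)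

  span-exchange : ∀ {ℓ p q a α β} → Spanned ℓ p q → (∀ i → a i ≡ α * p i + β * q i) → β ≢ 0# → Spanned ℓ a p
  span-exchange {p = p} {q} {a} {α} {β} span a≡ β≢0 X with inverse β β≢0
  ... | β⁻¹ , ββ⁻¹≡1 = mk⇔
    (λ X∈ → let (γ , δ , e) = Equivalence.to (span X) X∈ in
      δ * β⁻¹ , γ + - (δ * β⁻¹ * α) , λ i → trans (e i) (combine₂ (- (δ * β⁻¹)) (- (δ * q i)) (a≡ i) ββ⁻¹≡1
        (solve 8 (λ γ δ i α β p q a → γ ⊗ p ⊕ δ ⊗ q ⊜ δ ⊗ i ⊗ a ⊕ (γ ⊕ ⊝ (δ ⊗ i ⊗ α)) ⊗ p
          ⊕ ⊝ (δ ⊗ i) ⊗ (a ⊕ ⊝ (α ⊗ p ⊕ β ⊗ q)) ⊕ ⊝ (δ ⊗ q) ⊗ (β ⊗ i ⊕ ⊝ Κ z1))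
          refl γ δ β⁻¹ α β (p i) (q i) (a i))))
    (λ (γ , δ , e) → Equivalence.from (span X) (γ * α + δ , γ * β , λ i → trans (e i) (combine₁ γ (a≡ i)
      (solve 7 (λ γ δ α β p q a → γ ⊗ a ⊕ δ ⊗ p ⊜ (γ ⊗ α ⊕ δ) ⊗ p ⊕ γ ⊗ β ⊗ q
        ⊕ γ ⊗ (a ⊕ ⊝ (α ⊗ p ⊕ β ⊗ q))) refl γ δ α β (p i) (q i) (a i)))))

  -- Two distinct points of the axis span it, so one of any two points spanning ℓ is off the axis.
  axis-if-spanned : ∀ P Q d → let ℓ = line P Q d in OnAxis P → OnAxis Q → ∀ X → X ∈ ℓ ⇔ OnAxis X
  axis-if-spanned P Q d P-axis Q-axis X with OnAxis⇒ {P} P-axis | OnAxis⇒ {Q} Q-axis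
  ... | p₀≡0 , p₃≡0 | q₀≡0 , q₃≡0 = mk⇔ to from
    where
    p = coords P
    r = coords Q
    x = coords X
    to : X ∈ line P Q d → OnAxis X
    to (α , β , e) = ⇒OnAxis {X} (trans (e 0F) (zero-combination p₀≡0 q₀≡0)) (trans (e 3F) (zero-combination p₃≡0 q₃≡0))
      where
      zero-combination : ∀ {a b} → a ≡ 0# → b ≡ 0# → α * a + β * b ≡ 0#
      zero-combination refl refl = solve 2 (λ α β → α ⊗ Κ z0 ⊕ β ⊗ Κ z0 ⊜ Κ z0) refl α β
    p≢0 : NonZero² (p 1F) (p 2F)
    p≢0 with p 1F ≟ 0# | p 2F ≟ 0#
    ... | no nz | _ = inj₁ nz
    ... | yes _ | no nz = inj₂ nz
    ... | yes e | yes e′ = contradiction (λ { 0F → p₀≡0 ; 1F → e ; 2F → e′ ; 3F → p₃≡0 }) (nonzero P)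
    D = p 1F * r 2F + - (p 2F * r 1F)
    D≢0 : D ≢ 0#
    D≢0 D≡0 with parallel p≢0 (difference-zero D≡0)
    ... | k , r₁≡ , r₂≡ = nonproportional (k ≟ 0#)
      where
      r≡ : ∀ i → r i ≡ k * p i
      r≡ = λ { 0F → trans q₀≡0 (sym (trans (cong (k *_) p₀≡0) (zeroʳ k))) ; 1F → r₁≡ ; 2F → r₂≡
             ; 3F → trans q₃≡0 (sym (trans (cong (k *_) p₃≡0) (zeroʳ k))) }
      nonproportional : Dec (k ≡ 0#) → ⊥
      nonproportional (yes refl) = nonzero Q (λ i → trans (r≡ i) (zeroˡ _))
      nonproportional (no k≢0) with inverse k k≢0
      ... | k⁻¹ , kk⁻¹≡1 = d (k⁻¹ , inverse-nonzero kk⁻¹≡1 , λ i → unscale kk⁻¹≡1 (r≡ i))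
    from : OnAxis X → X ∈ line P Q d
    from X-axis with inverse D D≢0 | OnAxis⇒ {X} X-axis
    ... | i , Di≡1 | x₀≡0 , x₃≡0 = α , β , λ
        { 0F → trans x₀≡0 (sym (zero-combination p₀≡0 q₀≡0))
        ; 1F → combine₁ (- x 1F) Di≡1 (solve 7 (λ p₁ p₂ r₁ r₂ x₁ x₂ i → x₁ ⊜
            i ⊗ (x₁ ⊗ r₂ ⊕ ⊝ (x₂ ⊗ r₁)) ⊗ p₁ ⊕ i ⊗ (p₁ ⊗ x₂ ⊕ ⊝ (p₂ ⊗ x₁)) ⊗ r₁
            ⊕ ⊝ x₁ ⊗ ((p₁ ⊗ r₂ ⊕ ⊝ (p₂ ⊗ r₁)) ⊗ i ⊕ ⊝ Κ z1)) refl (p 1F) (p 2F) (r 1F) (r 2F) (x 1F) (x 2F) i)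
        ; 2F → combine₁ (- x 2F) Di≡1 (solve 7 (λ p₁ p₂ r₁ r₂ x₁ x₂ i → x₂ ⊜
            i ⊗ (x₁ ⊗ r₂ ⊕ ⊝ (x₂ ⊗ r₁)) ⊗ p₂ ⊕ i ⊗ (p₁ ⊗ x₂ ⊕ ⊝ (p₂ ⊗ x₁)) ⊗ r₂
            ⊕ ⊝ x₂ ⊗ ((p₁ ⊗ r₂ ⊕ ⊝ (p₂ ⊗ r₁)) ⊗ i ⊕ ⊝ Κ z1)) refl (p 1F) (p 2F) (r 1F) (r 2F) (x 1F) (x 2F) i)
        ; 3F → trans x₃≡0 (sym (zero-combination p₃≡0 q₃≡0))
        }
      where
      -- Cramer's rule in the two middle coordinates.
      α = i * (x 1F * r 2F + - (x 2F * r 1F))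
      β = i * (p 1F * x 2F + - (p 2F * x 1F))
      zero-combination : ∀ {a b} → a ≡ 0# → b ≡ 0# → α * a + β * b ≡ 0#
      zero-combination refl refl = solve 2 (λ α β → α ⊗ Κ z0 ⊕ β ⊗ Κ z0 ⊜ Κ z0) refl α β

  abstract
    -- Let `a` be the point of the line on the axis and P a presenting point off it. The other
    -- presenting point must occur in `a`, as otherwise `a` would be a multiple of P; so `a` can be
    -- exchanged for it, and `a` and P span the line.
    ExternalMeetingAxis⇒label : ∀ {ℓ} → ExternalMeetingAxis ℓ → ∃[ L ] Valid L × Represents ℓ L
    ExternalMeetingAxis⇒label {ℓ@(line P Q d)} ext with ExternalMeetingAxis.meetsAxis ext
    ... | A , (α , β , a≡) , A-axis with OnAxis⇒ {A} A-axis
    ... | a₀≡0 , a₃≡0 = cases (off-axis? P) (off-axis? Q)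
      where
      open ExternalMeetingAxis ext
      a : Vec⁴
      a = coords A
      a≢0 : NonZero² (a 1F) (a 2F)
      a≢0 with a 1F ≟ 0# | a 2F ≟ 0#
      ... | no nz | _ = inj₁ nz
      ... | yes _ | no nz = inj₂ nz
      ... | yes e | yes e′ = contradiction (λ { 0F → a₀≡0 ; 1F → e ; 2F → e′ ; 3F → a₃≡0 }) (nonzero A)
      off-axis? : ∀ X → NonZero² (coords X 0F) (coords X 3F) ⊎ OnAxis X
      off-axis? X with coords X 0F ≟ 0# | coords X 3F ≟ 0#
      ... | no nz | _ = inj₁ (inj₁ nz)
      ... | yes _ | no nz = inj₁ (inj₂ nz)
      ... | yes e | yes e′ = inj₂ (⇒OnAxis {X} e e′)
      result : ∀ {p r α β} → Spanned ℓ p r → (∀ i → a i ≡ α * p i + β * r i) → NonZero² (p 0F) (p 3F) →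
        ∃[ L ] Valid L × Represents ℓ L
      result {p} {r} {α} {β} span a≡ p-off =
        label-of-span {ℓ} {a} {p} (span-exchange {ℓ} {p} {r} {a} {α} {β} span a≡ β≢0) external a₀≡0 a₃≡0 a≢0 p-off
        where
        β≢0 : β ≢ 0#
        β≢0 refl = nonzero A λ i → trans (a≡αp i) (trans (cong (_* p i) (α≡0 p-off)) (zeroˡ _))
          where
          a≡αp : ∀ i → a i ≡ α * p i
          a≡αp i = trans (a≡ i) (solve 3 (λ α p r → α ⊗ p ⊕ Κ z0 ⊗ r ⊜ α ⊗ p) refl α (p i) (r i))
          α≡0 : NonZero² (p 0F) (p 3F) → α ≡ 0#
          α≡0 (inj₁ nz) = cofactor-zero nz (trans (*-comm _ α) (trans (sym (a≡αp 0F)) a₀≡0))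
          α≡0 (inj₂ nz) = cofactor-zero nz (trans (*-comm _ α) (trans (sym (a≡αp 3F)) a₃≡0))
      cases : NonZero² (coords P 0F) (coords P 3F) ⊎ OnAxis P → NonZero² (coords Q 0F) (coords Q 3F) ⊎ OnAxis Q →
        ∃[ L ] Valid L × Represents ℓ L
      cases (inj₁ P-off)  _             = result (λ X → mk⇔ id id) a≡ P-off
      cases (inj₂ _)      (inj₁ Q-off)  = result
        (λ X → mk⇔ (λ (γ , δ , e) → δ , γ , λ i → trans (e i) (+-comm _ _))
                   (λ (γ , δ , e) → δ , γ , λ i → trans (e i) (+-comm _ _)))
        (λ i → trans (a≡ i) (+-comm _ _)) Q-off
      cases (inj₂ P-axis) (inj₂ Q-axis) = contradiction (axis-if-spanned P Q d P-axis Q-axis) notAxis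

-- The three orbits, their sizes and their disjointness

module Orbits {c : Level} {q : ℕ} (𝔽 : FiniteField c q)
  (1+1+1≡0 : CharacteristicThree 𝔽) (6≤q : 6 ≤ q) where

  open FiniteField 𝔽
  open FieldArithmetic 𝔽 1+1+1≡0
  open TwistedCubic 𝔽 renaming (_⊗_ to _⊗ᴹ_)
  open CubicGroup 𝔽 1+1+1≡0
  open LineLabels 𝔽 1+1+1≡0
  open CubicStabilizer 𝔽 1+1+1≡0
  open ExternalLines 𝔽 1+1+1≡0
  open ≡-Reasoning

  L₁ : Label
  L₁ = label 1# 0# 0# 1# 1#

  -- `R₃ r` is v (1 , 0) displaced by (0 , r), and v (1 , 0) has the parameter of the axis point
  -- `P₀ᴬ`. The line `ℓ₂` is the case r = 1.
  L₃ : F → Label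
  L₃ r = label 1# 0# 1# 0# r

  L₁-valid : Valid L₁
  L₁-valid = valid (inj₁ 1≢0) (inj₂ 1≢0) 1≢0

  L₃-valid : ∀ {r} → r ≢ 0# → Valid (L₃ r)
  L₃-valid r≢0 = valid (inj₁ 1≢0) (inj₁ 1≢0) r≢0

  abstract
    represents-ℓ₁ : Represents ℓ₁ L₁
    represents-ℓ₁ X = mk⇔
      (λ (α , β , e) → on β α β (λ i → trans (e i) (agree α β i))
        (solve 2 (λ α β → Κ z0 ⊗ α ⊕ Κ z1 ⊗ β ⊜ β ⊗ Κ z1) refl α β))
      (λ (on l u₁ u₂ e f) → u₁ , l , λ i → trans (e i) (trans
        (cong (λ u → l * v 0# 1# i + axial u₁ u i) (combine₁ 1# f (solve 3 (λ l u₁ u₂ →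
          u₂ ⊜ l ⊕ Κ z1 ⊗ (Κ z0 ⊗ u₁ ⊕ Κ z1 ⊗ u₂ ⊕ ⊝ (l ⊗ Κ z1))) refl l u₁ u₂)))
        (sym (agree u₁ l i))))
      where
      agree : ∀ α β i → α * coords P₀ᴬ i + β * coords R₁ i ≡ β * v 0# 1# i + axial α β i
      agree α β = λ
        { 0F → solve 2 (λ α β → α ⊗ Κ z0 ⊕ β ⊗ Κ z0 ⊜ β ⊗ (Κ z0 ⊗ Κ z0 ⊗ Κ z0) ⊕ Κ z0) refl α β
        ; 1F → solve 2 (λ α β → α ⊗ Κ z1 ⊕ β ⊗ Κ z0 ⊜ β ⊗ (Κ z0 ⊗ Κ z0 ⊗ Κ z1) ⊕ α) refl α β
        ; 2F → solve 2 (λ α β → α ⊗ Κ z0 ⊕ β ⊗ Κ z1 ⊜ β ⊗ (Κ z0 ⊗ (Κ z1 ⊗ Κ z1)) ⊕ β) refl α β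
        ; 3F → solve 2 (λ α β → α ⊗ Κ z0 ⊕ β ⊗ Κ z1 ⊜ β ⊗ (Κ z1 ⊗ Κ z1 ⊗ Κ z1) ⊕ Κ z0) refl α β
        }

  abstract
    represents-ℓ₃ : ∀ r → Represents (ℓ₃ r) (L₃ r)
    represents-ℓ₃ r X = mk⇔
      (λ (α , β , e) → on β α (β * r) (λ i → trans (e i) (agree α β i))
        (solve 3 (λ α β r → Κ z0 ⊗ α ⊕ Κ z1 ⊗ (β ⊗ r) ⊜ β ⊗ r) refl α β r))
      (λ (on l u₁ u₂ e f) → u₁ , l , λ i → trans (e i) (trans
        (cong (λ u → l * v 1# 0# i + axial u₁ u i) (combine₁ 1# f (solve 4 (λ l u₁ u₂ r →
          u₂ ⊜ l ⊗ r ⊕ Κ z1 ⊗ (Κ z0 ⊗ u₁ ⊕ Κ z1 ⊗ u₂ ⊕ ⊝ (l ⊗ r))) refl l u₁ u₂ r)))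
        (sym (agree u₁ l i))))
      where
      agree : ∀ α β i → α * coords P₀ᴬ i + β * coords (R₃ r) i ≡ β * v 1# 0# i + axial α (β * r) i
      agree α β = λ
        { 0F → solve 2 (λ α β → α ⊗ Κ z0 ⊕ β ⊗ Κ z1 ⊜ β ⊗ (Κ z1 ⊗ Κ z1 ⊗ Κ z1) ⊕ Κ z0) refl α β
        ; 1F → solve 2 (λ α β → α ⊗ Κ z1 ⊕ β ⊗ Κ z0 ⊜ β ⊗ (Κ z1 ⊗ Κ z1 ⊗ Κ z0) ⊕ α) refl α β
        ; 2F → solve 3 (λ α β r → α ⊗ Κ z0 ⊕ β ⊗ r ⊜ β ⊗ (Κ z1 ⊗ (Κ z0 ⊗ Κ z0)) ⊕ β ⊗ r) refl α β r
        ; 3F → solve 2 (λ α β → α ⊗ Κ z0 ⊕ β ⊗ Κ z0 ⊜ β ⊗ (Κ z0 ⊗ Κ z0 ⊗ Κ z0) ⊕ Κ z0) refl α β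
        }

  abstract
    represents-projectivity : ∀ {ℓ L} g → Represents ℓ L → Represents (ℓ ⟪ projectivity g ⟫ᴸ) (g • L)
    represents-projectivity {ℓ} g rep =
      represents-image {ℓ} (projectivity g) g rep (∝ᴹ-refl {𝕄[ g ]})

  abstract
    orbit⇒label : ∀ {ℓ L m} → Represents ℓ L → Orbit ℓ m → ∃[ g ] Represents m (g • L)
    orbit⇒label {ℓ} {m = m} rep (φ , φ∈G , m≈ℓφ) with InG⇒𝕄 6≤q φ φ∈G
    ... | g , φ∝g = g , represents-≈ {ℓ ⟪ φ ⟫ᴸ} {m} m≈ℓφ (represents-image {ℓ} φ g rep φ∝g)

  abstract
    label⇒orbit : ∀ {ℓ L m L′} g → Represents ℓ L → Represents m L′ → g • L ∼ L′ → Orbit ℓ m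
    label⇒orbit {ℓ} {m = m} g rep rep′ gL∼L′ = projectivity g , InG-projectivity g ,
      same-label⇒≈ {m} {ℓ ⟪ projectivity g ⟫ᴸ} rep′ 
      (represents-∼ {ℓ ⟪ projectivity g ⟫ᴸ} gL∼L′ (represents-projectivity {ℓ} g rep))

  -- The family `G` is a transversal for the cosets of the stabilizer. Its two conditions concern
  -- labels, hence equations between scalars.
  orbit-size : ∀ {ℓ L n} {T : Set} → T ↔ Fin n → (G : T → GL₂) → Valid L → Represents ℓ L →
    (∀ g → ∃[ t ] G t • L ∼ g • L) → (∀ {t t′} → G t • L ∼ G t′ • L → t ≡ t′) → HasSize (orbitSetoid ℓ) n
  orbit-size {ℓ} {L} {T = T} T↔Fin G L-valid rep G-surjective G-injective =
    Compose.inverse (bijection⇒inverse (orbitSetoid ℓ) member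
      (λ {t} {t′} → member-injective {t} {t′}) member-surjective) T↔Fin
    where
    member : T → Setoid.Carrier (orbitSetoid ℓ)
    member t = ℓ ⟪ projectivity (G t) ⟫ᴸ , projectivity (G t) , InG-projectivity (G t) ,
      Setoid.refl lineSetoid {ℓ ⟪ projectivity (G t) ⟫ᴸ}
    member-represented : ∀ t → Represents (proj₁ (member t)) (G t • L)
    member-represented t = represents-projectivity {ℓ} (G t) rep
    member-injective : ∀ {t t′} → proj₁ (member t) ≈ᴸ proj₁ (member t′) → t ≡ t′
    member-injective {t} {t′} t≈t′ = G-injective (label-unique {proj₁ (member t)}
      (Valid-• (G t) L-valid) (Valid-• (G t′) L-valid) (member-represented t)
      (represents-≈ {proj₁ (member t′)} {proj₁ (member t)} t≈t′ (member-represented t′)))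
    member-surjective : ∀ m → ∃[ t ] proj₁ (member t) ≈ᴸ proj₁ m
    member-surjective (m , m∈orbit) with orbit⇒label {ℓ} {m = m} rep m∈orbit
    ... | g , rep-m with G-surjective g
    ... | t , Gt∼g = t , same-label⇒≈ {proj₁ (member t)} {m}
      (represents-∼ {proj₁ (member t)} Gt∼g (member-represented t)) rep-m

  abstract
    -- This is `transversal` for the trivial group, fixing 0 and choosing everything else.
    nonzero-elements : ∃[ k ] q ≡ suc (k ℕ.* 1) × Σ (Fin k → F) λ h →
      Injective _≡_ _≡_ h × (∀ i → h i ≢ 0#) × (∀ x → x ≢ 0# → ∃[ i ] h i ≡ x)
    nonzero-elements = transversal 0# (λ x → ¬? (x ≟ 0#)) (λ _ x → x) (λ _ x → x)
      (λ _ _ → refl) (λ _ _ → refl) (λ _ 0≢0 → 0≢0 refl) (λ x x≢0 → 0F , x≢0) unique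
      where
      unique : ∀ x {i j : Fin 1} → x ≢ 0# → x ≢ 0# → i ≡ j
      unique _ {0F} {0F} _ _ = refl

  -- Normalised representatives (px , py) of the q + 1 points of the projective line, each
  -- with a vector (jx , jy) completing it to a basis of determinant 1.
  px py jx jy : Fin (suc q) → F
  px 0F          = 1#
  px (Fin.suc i) = element i
  py 0F          = 0#
  py (Fin.suc i) = 1#
  jx 0F          = 0#
  jx (Fin.suc i) = - 1#
  jy 0F          = 1#
  jy (Fin.suc i) = 0#

  unimodular : ∀ p → px p * jy p + - (jx p * py p) ≡ 1#
  unimodular 0F          = solve 0 (Κ z1 ⊗ Κ z1 ⊕ ⊝ (Κ z0 ⊗ Κ z0) ⊜ Κ z1) refl
  unimodular (Fin.suc i) = solve 1 (λ e → e ⊗ Κ z0 ⊕ ⊝ (⊝ Κ z1 ⊗ Κ z1) ⊜ Κ z1) refl (element i)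

  abstract
    normalise-point : ∀ {x y} → NonZero² x y → ∃[ p ] ∃[ k ] k ≢ 0# × x ≡ k * px p × y ≡ k * py p
    normalise-point {x} {y} nz with y ≟ 0#
    normalise-point {x} {y} (inj₁ x≢0) | yes refl = 0F , x , x≢0 , sym (*-identityʳ x) , sym (zeroʳ x)
    normalise-point {x} {y} (inj₂ y≢0) | yes y≡0  = contradiction y≡0 y≢0
    normalise-point {x} {y} nz         | no y≢0 with inverse y y≢0
    ... | i , yi≡1 = Fin.suc (index (x * i)) , y , y≢0 ,
      trans (combine₁ (- x) yi≡1 (solve 3 (λ x y i → x ⊜ y ⊗ (x ⊗ i) ⊕ ⊝ x ⊗ (y ⊗ i ⊕ ⊝ Κ z1)) refl x y i))
        (cong (y *_) (sym (element-index (x * i)))) ,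
      sym (*-identityʳ y)

  normalised-unique : ∀ p p′ {a b} → a ≢ 0# → b ≢ 0# → a * px p ≡ b * px p′ → a * py p ≡ b * py p′ → p ≡ p′ × a ≡ b
  normalised-unique 0F 0F a≢0 b≢0 e f = refl , trans (sym (*-identityʳ _)) (trans e (*-identityʳ _))
  normalised-unique 0F (Fin.suc j) a≢0 b≢0 e f =
    contradiction (trans (sym (*-identityʳ _)) (trans (sym f) (zeroʳ _))) b≢0
  normalised-unique (Fin.suc i) 0F a≢0 b≢0 e f =
    contradiction (trans (sym (*-identityʳ _)) (trans f (zeroʳ _))) a≢0
  normalised-unique (Fin.suc i) (Fin.suc j) a≢0 b≢0 e f
    with trans (sym (*-identityʳ _)) (trans f (*-identityʳ _))
  ... | refl = cong Fin.suc (element-injective (*-cancelˡ a≢0 e)) , refl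

  -- A normal form for invertible matrices up to scalars: the first column names a projective point,
  -- and the scalar is used to give the second column coefficient 1 on (jx , jy). The determinant is
  -- w, and the triples (p , u , w) number (q + 1) q (q - 1).
  frame₁ : ∀ p u {w} → w ≢ 0# → GL₂
  frame₁ p u {w} w≢0 = gl (w * px p) (jx p + u * px p) (w * py p) (jy p + u * py p) λ e → w≢0
    (combine₂ 1# (- w) e (unimodular p) (solve 6 (λ w u x y j j′ → w ⊜ Κ z0
      ⊕ Κ z1 ⊗ (detᴱ (w ⊗ x) (j ⊕ u ⊗ x) (w ⊗ y) (j′ ⊕ u ⊗ y) ⊕ ⊝ Κ z0)
      ⊕ ⊝ w ⊗ (x ⊗ j′ ⊕ ⊝ (j ⊗ y) ⊕ ⊝ Κ z1)) refl w u (px p) (py p) (jx p) (jy p)))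

  frame₁-surjective : ∀ {L} → let open Label L in Valid L → det x₁ s x₂ t ≢ 0# →
    ∃[ p ] ∃[ u ] ∃[ w₀ ] Σ (w₀ ≢ 0#) λ w₀≢0 → frame₁ p u w₀≢0 • L₁ ∼ L
  frame₁-surjective {label x₁ x₂ s t w} (valid x≢0 y≢0 w≢0) D≢0 with normalise-point x≢0
  ... | p , k , k≢0 , refl , refl = p , u , w₀ , w₀≢0 , ∼-sym (related (k * w₀⁻¹) δ
      (*-nonzero k≢0 (inverse-nonzero w₀w₀⁻¹≡1)) δ≢0 (x≡ (px p) _) (x≡ (py p) _) s≡ t≡ w≡)
    where
    x = px p ; y = py p ; j = jx p ; j′ = jy p
    -- In the basis of the normalised point and its companion (j , j′), the vector (s , t) has
    -- coefficient δ on the companion and δ u on the point.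
    δ = x * t + - (y * s)
    δ≢0 : δ ≢ 0#
    δ≢0 e = D≢0 (combine₁ k e (solve 5 (λ k x y s t → detᴱ (k ⊗ x) s (k ⊗ y) t ⊜ Κ z0
      ⊕ k ⊗ (x ⊗ t ⊕ ⊝ (y ⊗ s) ⊕ ⊝ Κ z0)) refl k x y s t))
    kδ³≢0 : k * (δ * δ * δ) ≢ 0#
    kδ³≢0 = *-nonzero k≢0 (*-nonzero (*-nonzero δ≢0 δ≢0) δ≢0)
    δ⁻¹ = proj₁ (inverse δ δ≢0)
    δδ⁻¹≡1 : δ * δ⁻¹ ≡ 1#
    δδ⁻¹≡1 = proj₂ (inverse δ δ≢0)
    i = proj₁ (inverse _ kδ³≢0)
    kδ³i≡1 : k * (δ * δ * δ) * i ≡ 1#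
    kδ³i≡1 = proj₂ (inverse _ kδ³≢0)
    -- The scale factors must be k / w₀ on the axis point and δ on the cubic point; then w = (k /
    -- w₀) δ³ w₀² forces w₀ = w / (k δ³).
    w₀ = w * i
    w₀≢0 : w₀ ≢ 0#
    w₀≢0 = *-nonzero w≢0 (inverse-nonzero kδ³i≡1)
    w₀⁻¹ = proj₁ (inverse w₀ w₀≢0)
    w₀w₀⁻¹≡1 : w₀ * w₀⁻¹ ≡ 1#
    w₀w₀⁻¹≡1 = proj₂ (inverse w₀ w₀≢0)
    u = δ⁻¹ * (j′ * s + - (j * t))
    δu : δ * u ≡ j′ * s + - (j * t)
    δu = combine₁ (j′ * s + - (j * t)) δδ⁻¹≡1
      (solve 3 (λ δ i n → δ ⊗ (i ⊗ n) ⊜ n ⊕ n ⊗ (δ ⊗ i ⊕ ⊝ Κ z1)) refl δ δ⁻¹ (j′ * s + - (j * t)))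
    x≡ : ∀ x b → k * x ≡ k * w₀⁻¹ * (w₀ * x * 1# + b * 0#)
    x≡ x b = combine₁ (- (k * x)) w₀w₀⁻¹≡1 (solve 5 (λ k w i x b →
      k ⊗ x ⊜ k ⊗ i ⊗ (w ⊗ x ⊗ Κ z1 ⊕ b ⊗ Κ z0) ⊕ ⊝ (k ⊗ x) ⊗ (w ⊗ i ⊕ ⊝ Κ z1)) refl k w₀ w₀⁻¹ x b)
    s≡ : s ≡ δ * (w₀ * x * 0# + (j + u * x) * 1#)
    s≡ = combine₂ (- x) (- s) δu (unimodular p) (solve 8 (λ s t w x y j j′ u → let δ = x ⊗ t ⊕ ⊝ (y ⊗ s) in
      s ⊜ δ ⊗ (w ⊗ x ⊗ Κ z0 ⊕ (j ⊕ u ⊗ x) ⊗ Κ z1) ⊕ ⊝ x ⊗ (δ ⊗ u ⊕ ⊝ (j′ ⊗ s ⊕ ⊝ (j ⊗ t)))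
        ⊕ ⊝ s ⊗ (x ⊗ j′ ⊕ ⊝ (j ⊗ y) ⊕ ⊝ Κ z1)) refl s t w₀ x y j j′ u)
    t≡ : t ≡ δ * (w₀ * y * 0# + (j′ + u * y) * 1#)
    t≡ = combine₂ (- y) (- t) δu (unimodular p) (solve 8 (λ s t w x y j j′ u → let δ = x ⊗ t ⊕ ⊝ (y ⊗ s) in
      t ⊜ δ ⊗ (w ⊗ y ⊗ Κ z0 ⊕ (j′ ⊕ u ⊗ y) ⊗ Κ z1) ⊕ ⊝ y ⊗ (δ ⊗ u ⊕ ⊝ (j′ ⊗ s ⊕ ⊝ (j ⊗ t)))
        ⊕ ⊝ t ⊗ (x ⊗ j′ ⊕ ⊝ (j ⊗ y) ⊕ ⊝ Κ z1)) refl s t w₀ x y j j′ u)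
    w≡kδ³w₀ : w ≡ k * (δ * δ * δ) * w₀
    w≡kδ³w₀ = combine₁ (- w) kδ³i≡1
      (solve 3 (λ w m i → w ⊜ m ⊗ (w ⊗ i) ⊕ ⊝ w ⊗ (m ⊗ i ⊕ ⊝ Κ z1)) refl w (k * (δ * δ * δ)) i)
    D² = det (w₀ * x) (j + u * x) (w₀ * y) (j′ + u * y) * det (w₀ * x) (j + u * x) (w₀ * y) (j′ + u * y)
    D²≡w₀² : D² ≡ w₀ * w₀
    D²≡w₀² = combine₁ (w₀ * w₀ * (x * j′ + - (j * y) + 1#)) (unimodular p)
      (solve 6 (λ w u x y j j′ → let D = detᴱ (w ⊗ x) (j ⊕ u ⊗ x) (w ⊗ y) (j′ ⊕ u ⊗ y) ; e = x ⊗ j′ ⊕ ⊝ (j ⊗ y) in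
        D ⊗ D ⊜ w ⊗ w ⊕ w ⊗ w ⊗ (e ⊕ Κ z1) ⊗ (e ⊕ ⊝ Κ z1)) refl w₀ u x y j j′)
    w≡ : w ≡ k * w₀⁻¹ * (δ * δ * δ) * (D² * 1#)
    w≡ = combine₃ 1# (- (k * (δ * δ * δ) * w₀)) (- (k * w₀⁻¹ * (δ * δ * δ))) w≡kδ³w₀ w₀w₀⁻¹≡1 D²≡w₀²
      (solve 6 (λ w k d w₀ i D → w ⊜ k ⊗ i ⊗ d ⊗ (D ⊗ Κ z1) ⊕ Κ z1 ⊗ (w ⊕ ⊝ (k ⊗ d ⊗ w₀))
        ⊕ ⊝ (k ⊗ d ⊗ w₀) ⊗ (w₀ ⊗ i ⊕ ⊝ Κ z1) ⊕ ⊝ (k ⊗ i ⊗ d) ⊗ (D ⊕ ⊝ (w₀ ⊗ w₀)))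
        refl w k (δ * δ * δ) w₀ w₀⁻¹ D²)

  -- Normalised first columns give p = p′ and w = k w′. The determinant of the common point with the
  -- second columns is 1 on both sides, so l = 1 and u = u′. The last label entry then reads w² = k
  -- w′² = w w′.
  frame₁-injective : ∀ {p u w p′ u′ w′} {w≢0 : w ≢ 0#} {w′≢0 : w′ ≢ 0#} →
    frame₁ p u w≢0 • L₁ ∼ frame₁ p′ u′ w′≢0 • L₁ → p ≡ p′ × u ≡ u′ × w ≡ w′
  frame₁-injective {p} {u} {w} {p′} {u′} {w′} {w≢0} {w′≢0} (related k l k≢0 l≢0 e₁ e₂ e₃ e₄ e₅) =
    same-point (normalised-unique p p′ w≢0 (*-nonzero k≢0 w′≢0) (simplify e₁) (simplify e₂))
    where
    simplify : ∀ {x b x′ b′} → w * x * 1# + b * 0# ≡ k * (w′ * x′ * 1# + b′ * 0#) → w * x ≡ k * w′ * x′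
    simplify {x} {b} {x′} {b′} e = combine₁ 1# e (solve 7 (λ w x b k w′ x′ b′ → w ⊗ x ⊜ k ⊗ w′ ⊗ x′
      ⊕ Κ z1 ⊗ (w ⊗ x ⊗ Κ z1 ⊕ b ⊗ Κ z0 ⊕ ⊝ (k ⊗ (w′ ⊗ x′ ⊗ Κ z1 ⊕ b′ ⊗ Κ z0)))) refl w x b k w′ x′ b′)
    second : ∀ {a b a′ b′} → a * 0# + b * 1# ≡ l * (a′ * 0# + b′ * 1#) → b ≡ l * b′
    second {a} {b} {a′} {b′} e = combine₁ 1# e (solve 5 (λ a b l a′ b′ → b ⊜ l ⊗ b′
      ⊕ Κ z1 ⊗ (a ⊗ Κ z0 ⊕ b ⊗ Κ z1 ⊕ ⊝ (l ⊗ (a′ ⊗ Κ z0 ⊕ b′ ⊗ Κ z1)))) refl a b l a′ b′)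
    same-point : p ≡ p′ × w ≡ k * w′ → p ≡ p′ × u ≡ u′ × w ≡ w′
    same-point (refl , w≡kw′) = refl , u≡u′ , *-cancelˡ w≢0 ww≡ww′
      where
      x = px p ; y = py p ; j = jx p ; j′ = jy p
      1≡l : 1# ≡ l
      1≡l = combine₁ (l + - 1#) (unimodular p) (combine₂ (- y) x (second e₃) (second e₄)
        (solve 7 (λ l u u′ x y j j′ → let e = x ⊗ j′ ⊕ ⊝ (j ⊗ y) in Κ z1 ⊜ l ⊕ (l ⊕ ⊝ Κ z1) ⊗ (e ⊕ ⊝ Κ z1)
          ⊕ ⊝ y ⊗ (j ⊕ u ⊗ x ⊕ ⊝ (l ⊗ (j ⊕ u′ ⊗ x))) ⊕ x ⊗ (j′ ⊕ u ⊗ y ⊕ ⊝ (l ⊗ (j′ ⊕ u′ ⊗ y))))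
          refl l u u′ x y j j′))
      u≡u′ : u ≡ u′
      u≡u′ = combine₂ (- u′) (u′ * l + - u) 1≡l (unimodular p) (combine₂ j′ (- j) (second e₃) (second e₄)
        (solve 7 (λ l u u′ x y j j′ → let e = x ⊗ j′ ⊕ ⊝ (j ⊗ y) in u ⊜ u′
          ⊕ ⊝ u′ ⊗ (Κ z1 ⊕ ⊝ l) ⊕ (u′ ⊗ l ⊕ ⊝ u) ⊗ (e ⊕ ⊝ Κ z1)
          ⊕ j′ ⊗ (j ⊕ u ⊗ x ⊕ ⊝ (l ⊗ (j ⊕ u′ ⊗ x))) ⊕ ⊝ j ⊗ (j′ ⊕ u ⊗ y ⊕ ⊝ (l ⊗ (j′ ⊕ u′ ⊗ y))))
          refl l u u′ x y j j′))
      D² : F → F → F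
      D² w u = det (w * x) (j + u * x) (w * y) (j′ + u * y) * det (w * x) (j + u * x) (w * y) (j′ + u * y)
      D²≡w² : ∀ w u → D² w u ≡ w * w
      D²≡w² w u = combine₁ (w * w * (x * j′ + - (j * y) + 1#)) (unimodular p)
        (solve 6 (λ w u x y j j′ → let D = detᴱ (w ⊗ x) (j ⊕ u ⊗ x) (w ⊗ y) (j′ ⊕ u ⊗ y) ; e = x ⊗ j′ ⊕ ⊝ (j ⊗ y) in
          D ⊗ D ⊜ w ⊗ w ⊕ w ⊗ w ⊗ (e ⊕ Κ z1) ⊗ (e ⊕ ⊝ Κ z1)) refl w u x y j j′)
      ww≡ww′ : w * w ≡ w * w′
      ww≡ww′ = begin
        w * w                               ≡⟨ trans (*-identityʳ _) (D²≡w² w u) ⟨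
        D² w u * 1#                         ≡⟨ e₅ ⟩
        k * (l * l * l) * (D² w′ u′ * 1#)   ≡⟨ cong₂ (λ m d → k * (m * m * m) * (d * 1#)) (sym 1≡l) (D²≡w² w′ u′) ⟩
        k * (1# * 1# * 1#) * (w′ * w′ * 1#) ≡⟨ solve 2 (λ k w → k ⊗ (Κ z1 ⊗ Κ z1 ⊗ Κ z1) ⊗ (w ⊗ w ⊗ Κ z1) ⊜ k ⊗ w ⊗ w) refl k w′ ⟩
        k * w′ * w′                         ≡⟨ cong (_* w′) w≡kw′ ⟨
        w * w′                              ∎

  L₁-orbit-independent : ∀ g → let open Label (g • L₁) in det x₁ s x₂ t ≢ 0#
  L₁-orbit-independent (gl a b c d D≢0) e = D≢0 (trans (solve 4 (λ a b c d → detᴱ a b c d ⊜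
    detᴱ (a ⊗ Κ z1 ⊕ b ⊗ Κ z0) (a ⊗ Κ z0 ⊕ b ⊗ Κ z1) (c ⊗ Κ z1 ⊕ d ⊗ Κ z0) (c ⊗ Κ z0 ⊕ d ⊗ Κ z1)) refl a b c d) e)

  size-ℓ₁ : HasSize (orbitSetoid ℓ₁) (q ℕ.^ 3 ℕ.∸ q)
  size-ℓ₁ with nonzero-elements
  ... | k , q≡ , h , h-injective , h≢0 , h-surjective =
    subst (HasSize (orbitSetoid ℓ₁)) (count k q q≡) (orbit-size {ℓ₁}
      {T = Fin (suc q) × Fin q × Fin k}
      (Compose.inverse (Identity.inverse _ ×-↔ Symmetry.inverse *↔×) (Symmetry.inverse *↔×))
      (λ (p , i , j) → frame₁ p (element i) (h≢0 j)) L₁-valid represents-ℓ₁ surjective injective)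
    where
    count : ∀ k q → q ≡ suc (k ℕ.* 1) → suc q ℕ.* (q ℕ.* k) ≡ q ℕ.^ 3 ℕ.∸ q
    count k q refl rewrite ℕ.*-identityʳ k =
      -- Truncated subtraction is avoided by verifying the identity after adding q.
      trans (sym (ℕ.m+n∸n≡m (suc (suc k) ℕ.* (suc k ℕ.* k)) (suc k))) (cong (ℕ._∸ suc k) (identity k))
      where
      identity : ∀ k → suc (suc k) ℕ.* (suc k ℕ.* k) ℕ.+ suc k ≡ suc k ℕ.* (suc k ℕ.* (suc k ℕ.* 1))
      identity = ℕ-solve-∀
    surjective : ∀ g → ∃[ (p , i , j) ] frame₁ p (element i) (h≢0 j) • L₁ ∼ g • L₁
    surjective g with frame₁-surjective (Valid-• g L₁-valid) (L₁-orbit-independent g)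
    ... | p , u , w₀ , w₀≢0 , f∼g with h-surjective w₀ w₀≢0
    ... | j , refl = (p , index u , j) , subst (λ u → frame₁ p u (h≢0 j) • L₁ ∼ g • L₁) (sym (element-index u)) f∼g
    injective : ∀ {t t′ : Fin (suc q) × Fin q × Fin k} → let (p , i , j) = t ; (p′ , i′ , j′) = t′ in
      frame₁ p (element i) (h≢0 j) • L₁ ∼ frame₁ p′ (element i′) (h≢0 j′) • L₁ → t ≡ t′
    injective {_ , _ , j} {_ , _ , j′} t∼t′ with frame₁-injective {w≢0 = h≢0 j} {w′≢0 = h≢0 j′} t∼t′
    ... | p≡p′ , u≡u′ , w≡w′ = cong₂ _,_ p≡p′ (cong₂ _,_ (element-injective u≡u′) (h-injective w≡w′))

  -- On `L₃ r` the first column supplies both x and y, and the second enters only through the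
  -- squared determinant e². Hence one column direction and a sign choice of e suffice.
  frame₃ : ∀ p {e} → e ≢ 0# → GL₂
  frame₃ p {e} e≢0 = gl (px p) (e * jx p) (py p) (e * jy p) λ h → e≢0
    (combine₂ 1# (- e) h (unimodular p) (solve 5 (λ e x y j j′ → e ⊜ Κ z0
      ⊕ Κ z1 ⊗ (detᴱ x (e ⊗ j) y (e ⊗ j′) ⊕ ⊝ Κ z0) ⊕ ⊝ e ⊗ (x ⊗ j′ ⊕ ⊝ (j ⊗ y) ⊕ ⊝ Κ z1))
      refl e (px p) (py p) (jx p) (jy p)))

  frame₃-det² : ∀ p e → let D = det (px p) (e * jx p) (py p) (e * jy p) in D * D ≡ e * e
  frame₃-det² p e = combine₁ (e * e * (px p * jy p + - (jx p * py p) + 1#)) (unimodular p)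
    (solve 5 (λ e x y j j′ → let D = detᴱ x (e ⊗ j) y (e ⊗ j′) ; n = x ⊗ j′ ⊕ ⊝ (j ⊗ y) in
      D ⊗ D ⊜ e ⊗ e ⊕ e ⊗ e ⊗ (n ⊕ Κ z1) ⊗ (n ⊕ ⊝ Κ z1)) refl e (px p) (py p) (jx p) (jy p))

  frame₃-surjective : ∀ {r x y e w} → NonZero² x y → e ≢ 0# → w ≡ r * (e * e) →
    ∃[ p ] ∃[ e₀ ] Positive e₀ × (∀ (e₀≢0 : e₀ ≢ 0#) → frame₃ p e₀≢0 • L₃ r ∼ label x y x y w)
  frame₃-surjective {r} {x} {y} {e} {w} nz e≢0 w≡re² with normalise-point nz
  ... | p , k , k≢0 , refl , refl with inverse k k≢0
  -- Both scale factors equal k, so w = k⁴ r e₀², which asks for e₀² = (e / k²)².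
  ... | k⁻¹ , kk⁻¹≡1 with square-of-Positive (*-nonzero (*-nonzero e≢0 (inverse-nonzero kk⁻¹≡1)) (inverse-nonzero kk⁻¹≡1))
  ... | e₀ , e₀>0 , e₀²≡ = p , e₀ , e₀>0 , λ e₀≢0 → ∼-sym (related k k k≢0 k≢0
      (x≡ (px p) _) (x≡ (py p) _) (x≡ (px p) _) (x≡ (py p) _)
      (trans w≡re² (combine₃ (- (k * k * k * k * r)) (- (k * k * k * k * r)) (- (r * (e * e) * (n * n * n + n * n + n + 1#)))
        (frame₃-det² p e₀) e₀²≡ kk⁻¹≡1
        (solve 6 (λ r e k i D E → let n = k ⊗ i in
          r ⊗ (e ⊗ e) ⊜ k ⊗ (k ⊗ k ⊗ k) ⊗ (D ⊗ r) ⊕ ⊝ (k ⊗ k ⊗ k ⊗ k ⊗ r) ⊗ (D ⊕ ⊝ E)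
            ⊕ ⊝ (k ⊗ k ⊗ k ⊗ k ⊗ r) ⊗ (E ⊕ ⊝ (e ⊗ i ⊗ i ⊗ (e ⊗ i ⊗ i)))
            ⊕ ⊝ (r ⊗ (e ⊗ e) ⊗ (n ⊗ n ⊗ n ⊕ n ⊗ n ⊕ n ⊕ Κ z1)) ⊗ (n ⊕ ⊝ Κ z1))
          refl r e k k⁻¹ _ (e₀ * e₀)))))
    where
    n = k * k⁻¹
    x≡ : ∀ x b → k * x ≡ k * (x * 1# + b * 0#)
    x≡ x b = solve 3 (λ k x b → k ⊗ x ⊜ k ⊗ (x ⊗ Κ z1 ⊕ b ⊗ Κ z0)) refl k x b

  first-column : ∀ {x b k x′ b′} → x * 1# + b * 0# ≡ k * (x′ * 1# + b′ * 0#) → 1# * x ≡ k * x′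
  first-column {x} {b} {k} {x′} {b′} e = combine₁ 1# e (solve 5 (λ x b k x′ b′ → Κ z1 ⊗ x ⊜ k ⊗ x′
    ⊕ Κ z1 ⊗ (x ⊗ Κ z1 ⊕ b ⊗ Κ z0 ⊕ ⊝ (k ⊗ (x′ ⊗ Κ z1 ⊕ b′ ⊗ Κ z0)))) refl x b k x′ b′)

  frame₃-injective : ∀ {r} → r ≢ 0# → ∀ {p e p′ e′} {e≢0 : e ≢ 0#} {e′≢0 : e′ ≢ 0#} →
    frame₃ p e≢0 • L₃ r ∼ frame₃ p′ e′≢0 • L₃ r → p ≡ p′ × e * e ≡ e′ * e′
  frame₃-injective {r} r≢0 {p} {e} {p′} {e′} (related k l k≢0 l≢0 e₁ e₂ e₃ e₄ e₅)
    with normalised-unique p p′ 1≢0 k≢0 (first-column e₁) (first-column e₂)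
       | normalised-unique p p′ 1≢0 l≢0 (first-column e₃) (first-column e₄)
  ... | p≡p′ , refl | _ , refl = p≡p′ , *-cancelˡ r≢0 (begin
      r * (e * e)                            ≡⟨ cong (r *_) (frame₃-det² p e) ⟨
      r * (D² p e)                           ≡⟨ *-comm r (D² p e) ⟩
      D² p e * r                             ≡⟨ e₅ ⟩
      1# * (1# * 1# * 1#) * (D² p′ e′ * r)   ≡⟨ cong (λ d → 1# * (1# * 1# * 1#) * (d * r)) (frame₃-det² p′ e′) ⟩
      1# * (1# * 1# * 1#) * (e′ * e′ * r)    ≡⟨ solve 2 (λ r e → Κ z1 ⊗ (Κ z1 ⊗ Κ z1 ⊗ Κ z1) ⊗ (e ⊗ e ⊗ r) ⊜ r ⊗ (e ⊗ e)) refl r e′ ⟩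
      r * (e′ * e′)                          ∎)
    where
    D² : Fin (suc q) → F → F
    D² p e = det (px p) (e * jx p) (py p) (e * jy p) * det (px p) (e * jx p) (py p) (e * jy p)

  size-ℓ₃ : ∀ {r} → r ≢ 0# → HasSize (orbitSetoid (ℓ₃ r)) ((q ℕ.^ 2 ℕ.∸ 1) ℕ./ 2)
  size-ℓ₃ {r} r≢0 with signs
  ... | k , q≡ , h , h-injective , h>0 , h-surjective =
    subst (HasSize (orbitSetoid (ℓ₃ r))) (count k q q≡) (orbit-size {ℓ₃ r}
      {T = Fin (suc q) × Fin k} (Symmetry.inverse *↔×)
      (λ (p , i) → frame₃ p (h≢0 i)) (L₃-valid r≢0) (represents-ℓ₃ r) surjective injective)
    where
    h≢0 : ∀ i → h i ≢ 0#
    h≢0 i = Positive⇒≢0 (h>0 i)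
    count : ∀ k q → q ≡ suc (k ℕ.* 2) → suc q ℕ.* k ≡ (q ℕ.^ 2 ℕ.∸ 1) ℕ./ 2
    count k q refl = sym (trans (cong (λ n → (n ℕ.∸ 1) ℕ./ 2) (identity k)) (ℕ.m*n/n≡m (suc (suc (k ℕ.* 2)) ℕ.* k) 2))
      where
      identity : ∀ k → suc (k ℕ.* 2) ℕ.* (suc (k ℕ.* 2) ℕ.* 1) ≡ suc (suc (suc (k ℕ.* 2)) ℕ.* k ℕ.* 2)
      identity = ℕ-solve-∀
    surjective : ∀ g → ∃[ (p , i) ] frame₃ p (h≢0 i) • L₃ r ∼ g • L₃ r
    surjective g with frame₃-surjective {r} (Valid.x≢0 (Valid-• g (L₃-valid r≢0))) (∥∥≢0 g) (*-comm (∥ g ∥ * ∥ g ∥) r)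
    ... | p , e₀ , e₀>0 , f∼g with h-surjective e₀ e₀>0
    ... | i , refl = (p , i) , f∼g (h≢0 i)
    injective : ∀ {t t′ : Fin (suc q) × Fin k} → let (p , i) = t ; (p′ , i′) = t′ in
      frame₃ p (h≢0 i) • L₃ r ∼ frame₃ p′ (h≢0 i′) • L₃ r → t ≡ t′
    injective {_ , i} {_ , i′} t∼t′ with frame₃-injective r≢0 {e≢0 = h≢0 i} {e′≢0 = h≢0 i′} t∼t′
    ... | p≡p′ , e²≡e′² = cong₂ _,_ p≡p′ (h-injective (square-injective-on-Positive (h>0 i) (h>0 i′) e²≡e′²))

  -- Independence of x and y survives the group and rescaling, while every g applied to `L₃ r` keeps
  -- x = y.
  ¬Orbit₁∩Orbit₃ : ∀ {r} → r ≢ 0# → ∀ ℓ → ¬ (Orbit ℓ₁ ℓ × Orbit (ℓ₃ r) ℓ)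
  ¬Orbit₁∩Orbit₃ {r} r≢0 ℓ (o₁ , o₃) with orbit⇒label {ℓ₁} {m = ℓ} represents-ℓ₁ o₁ | orbit⇒label {ℓ₃ r} {m = ℓ} (represents-ℓ₃ r) o₃
  ... | g , rep | g′ , rep′
    with label-unique {ℓ} (Valid-• g L₁-valid) (Valid-• g′ (L₃-valid r≢0)) rep rep′
  ... | related k l _ _ e₁ e₂ e₃ e₄ _ = L₁-orbit-independent g
    (dependent (Label.x₁ (g • L₁)) (Label.x₂ (g • L₁)) (Label.s (g • L₁)) (Label.t (g • L₁)) e₁ e₂ e₃ e₄)
    where
    dependent : ∀ x₁ x₂ s t {x y} → x₁ ≡ k * x → x₂ ≡ k * y → s ≡ l * x → t ≡ l * y → det x₁ s x₂ t ≡ 0#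
    dependent _ _ _ _ {x} {y} refl refl refl refl =
      solve 4 (λ k l x y → detᴱ (k ⊗ x) (l ⊗ x) (k ⊗ y) (l ⊗ y) ⊜ Κ z0) refl k l x y

  common-factor : ∀ {x y k l} → NonZero² x y → k * x ≡ l * x → k * y ≡ l * y → k ≡ l
  common-factor (inj₁ x≢0) e _ = *-cancelˡ x≢0 (trans (*-comm _ _) (trans e (*-comm _ _)))
  common-factor (inj₂ y≢0) _ e = *-cancelˡ y≢0 (trans (*-comm _ _) (trans e (*-comm _ _)))

  NonSquare⇒≢0 : ∀ {ρ} → NonSquare ρ → ρ ≢ 0#
  NonSquare⇒≢0 ns refl = ns 0# (zeroˡ 0#)

  -- Both labels have x = y, so k = l, and comparing the last entries gives (det g)² = k⁴ (det g′)²
  -- ρ. Then ρ would be the square of det g / (k² det g′).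
  ¬Orbit₂∩Orbit₃ : ∀ {ρ} → NonSquare ρ → ∀ ℓ → ¬ (Orbit ℓ₂ ℓ × Orbit (ℓ₃ ρ) ℓ)
  ¬Orbit₂∩Orbit₃ {ρ} ns ℓ (o₂ , o₃) with orbit⇒label {ℓ₂} {m = ℓ} (represents-ℓ₃ 1#) o₂ | orbit⇒label {ℓ₃ ρ} {m = ℓ} (represents-ℓ₃ ρ) o₃
  ... | g , rep | g′ , rep′
    with label-unique {ℓ} (Valid-• g (L₃-valid 1≢0)) (Valid-• g′ (L₃-valid (NonSquare⇒≢0 ns))) rep rep′
  ... | related k l k≢0 l≢0 e₁ e₂ e₃ e₄ e₅
    with common-factor (Valid.x≢0 (Valid-• g′ (L₃-valid (NonSquare⇒≢0 ns)))) (trans (sym e₁) e₃) (trans (sym e₂) e₄)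
       | inverse (k * k * ∥ g′ ∥) (*-nonzero (*-nonzero k≢0 k≢0) (∥∥≢0 g′))
  ... | refl | i , mi≡1 = ns (∥ g ∥ * i) (combine₂ (i * i) (ρ * (k * k * ∥ g′ ∥ * i + 1#)) e₅ mi≡1
    (solve 5 (λ D D′ k i ρ → D ⊗ i ⊗ (D ⊗ i) ⊜ ρ ⊕ i ⊗ i ⊗ (D ⊗ D ⊗ Κ z1 ⊕ ⊝ (k ⊗ (k ⊗ k ⊗ k) ⊗ (D′ ⊗ D′ ⊗ ρ)))
      ⊕ ρ ⊗ (k ⊗ k ⊗ D′ ⊗ i ⊕ Κ z1) ⊗ (k ⊗ k ⊗ D′ ⊗ i ⊕ ⊝ Κ z1)) refl ∥ g ∥ ∥ g′ ∥ k i ρ))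

  -- Dividing y by l makes it equal to x, at the cost of a factor l³ in `w`.
  coincident⇒orbit₃ : ∀ {r ℓ x₁ x₂ s t w e l} → Represents ℓ (label x₁ x₂ s t w) → NonZero² x₁ x₂ → e ≢ 0# → l ≢ 0# →
    s ≡ l * x₁ → t ≡ l * x₂ → w ≡ l * l * l * (r * (e * e)) → Orbit (ℓ₃ r) ℓ
  coincident⇒orbit₃ {r} {ℓ} {x₁} {x₂} {e = e} {l} rep x≢0 e≢0 l≢0 s≡ t≡ w≡ with frame₃-surjective {r} x≢0 e≢0 refl
  ... | p , e₀ , e₀>0 , f∼ = label⇒orbit {ℓ₃ r} {m = ℓ} (frame₃ p (Positive⇒≢0 e₀>0)) (represents-ℓ₃ r) rep
    (∼-trans (f∼ (Positive⇒≢0 e₀>0)) (∼-sym (related 1# l 1≢0 l≢0 (sym (*-identityˡ x₁)) (sym (*-identityˡ x₂))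
      s≡ t≡ (trans w≡ (cong (_* (r * (e * e))) (sym (*-identityˡ _)))))))

  abstract
    -- The determinant of x and y separates the large orbit. If it vanishes, y = l x, and the square
    -- class of w / l³ decides between the other two.
    label⇒orbits : ∀ {ρ ℓ L} → NonSquare ρ → Valid L → Represents ℓ L → Orbit ℓ₁ ℓ ⊎ Orbit ℓ₂ ℓ ⊎ Orbit (ℓ₃ ρ) ℓ
    label⇒orbits {ρ} {ℓ} {label x₁ x₂ s t w} ns L-valid@(valid x≢0 y≢0 w≢0) rep with det x₁ s x₂ t ≟ 0#
    ... | no D≢0 with frame₁-surjective L-valid D≢0
    ...   | p , u , w₀ , w₀≢0 , f∼L = inj₁ (label⇒orbit {ℓ₁} {m = ℓ} (frame₁ p u w₀≢0) represents-ℓ₁ rep f∼L)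
    label⇒orbits {ρ} {ℓ} {label x₁ x₂ s t w} ns (valid x≢0 y≢0 w≢0) rep | yes D≡0
      with parallel x≢0 (combine₁ 1# D≡0 (solve 4 (λ x₁ x₂ s t →
        x₁ ⊗ t ⊜ x₂ ⊗ s ⊕ Κ z1 ⊗ (detᴱ x₁ s x₂ t ⊕ ⊝ Κ z0)) refl x₁ x₂ s t))
    ... | l , s≡ , t≡ with parallel-factor≢0 y≢0 s≡ t≡
    ... | l≢0 with inverse (l * l * l) (*-nonzero (*-nonzero l≢0 l≢0) l≢0)
    ... | i , l³i≡1 with square-classes ns (w * i)
    ... | e , inj₁ wi≡e² = inj₂ (inj₁ (coincident⇒orbit₃ {1#} {ℓ} rep x≢0 (e≢0 wi≡e²) l≢0 s≡ t≡
            (trans (combine₁ (- w) l³i≡1 (solve 3 (λ w m i → w ⊜ m ⊗ (w ⊗ i) ⊕ ⊝ w ⊗ (m ⊗ i ⊕ ⊝ Κ z1)) refl w (l * l * l) i))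
              (cong (l * l * l *_) (trans wi≡e² (sym (*-identityˡ _)))))))
      where
      e≢0 : w * i ≡ e * e → e ≢ 0#
      e≢0 wi≡e² refl = *-nonzero w≢0 (inverse-nonzero l³i≡1) (trans wi≡e² (zeroˡ 0#))
    ... | e , inj₂ wi≡ρe² = inj₂ (inj₂ (coincident⇒orbit₃ {ρ} {ℓ} rep x≢0 (e≢0 wi≡ρe²) l≢0 s≡ t≡
            (trans (combine₁ (- w) l³i≡1 (solve 3 (λ w m i → w ⊜ m ⊗ (w ⊗ i) ⊕ ⊝ w ⊗ (m ⊗ i ⊕ ⊝ Κ z1)) refl w (l * l * l) i))
              (cong (l * l * l *_) wi≡ρe²))))
      where
      e≢0 : w * i ≡ ρ * (e * e) → e ≢ 0#
      e≢0 wi≡ρe² refl = *-nonzero w≢0 (inverse-nonzero l³i≡1) (trans wi≡ρe² (trans (cong (ρ *_) (zeroˡ 0#)) (zeroʳ ρ)))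

  orbit⇒external : ∀ {ℓ L m} → Valid L → Represents ℓ L → Orbit ℓ m → ExternalMeetingAxis m
  orbit⇒external {ℓ} {m = m} L-valid rep o with orbit⇒label {ℓ} {m = m} rep o
  ... | g , rep-m = label⇒ExternalMeetingAxis {m} (Valid-• g L-valid) rep-m

  orbit-decomposition : ∀ {ρ} → NonSquare ρ → OrbitDecomposition ℓ₁ ℓ₂ (ℓ₃ ρ)
  orbit-decomposition {ρ} ns = record
    { covers     = λ ℓ → mk⇔ (to ℓ) (from ℓ)
    ; disjoint₁₂ = ¬Orbit₁∩Orbit₃ 1≢0
    ; disjoint₁₃ = ¬Orbit₁∩Orbit₃ ρ≢0
    ; disjoint₂₃ = ¬Orbit₂∩Orbit₃ ns
    ; size₁      = size-ℓ₁
    ; size₂      = size-ℓ₃ 1≢0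
    ; size₃      = size-ℓ₃ ρ≢0
    }
    where
    ρ≢0 : ρ ≢ 0#
    ρ≢0 = NonSquare⇒≢0 ns
    to : ∀ ℓ → ExternalMeetingAxis ℓ → Orbit ℓ₁ ℓ ⊎ Orbit ℓ₂ ℓ ⊎ Orbit (ℓ₃ ρ) ℓ
    to ℓ external with ExternalMeetingAxis⇒label {ℓ} external
    ... | L , L-valid , rep = label⇒orbits {ℓ = ℓ} ns L-valid rep
    from : ∀ ℓ → Orbit ℓ₁ ℓ ⊎ Orbit ℓ₂ ℓ ⊎ Orbit (ℓ₃ ρ) ℓ → ExternalMeetingAxis ℓ
    from ℓ (inj₁ o)        = orbit⇒external {ℓ₁} {m = ℓ} L₁-valid represents-ℓ₁ o
    from ℓ (inj₂ (inj₁ o)) = orbit⇒external {ℓ₂} {m = ℓ} (L₃-valid 1≢0) (represents-ℓ₃ 1#) o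
    from ℓ (inj₂ (inj₂ o)) = orbit⇒external {ℓ₃ ρ} {m = ℓ} (L₃-valid ρ≢0) (represents-ℓ₃ ρ) o

-- Stabilizers of the representative lines

module Stabilizers {c : Level} {q : ℕ} (𝔽 : FiniteField c q)
  (1+1+1≡0 : CharacteristicThree 𝔽) (6≤q : 6 ≤ q) where

  open FiniteField 𝔽
  open FieldArithmetic 𝔽 1+1+1≡0
  open TwistedCubic 𝔽 renaming (_⊗_ to _⊗ᴹ_)
  open CubicGroup 𝔽 1+1+1≡0
  open LineLabels 𝔽 1+1+1≡0
  open CubicStabilizer 𝔽 1+1+1≡0
  open ExternalLines 𝔽 1+1+1≡0
  open Orbits 𝔽 1+1+1≡0 6≤q
  open ≡-Reasoning

  fixes⇒∼ : ∀ {ℓ L} ψ g → Valid L → Represents ℓ L → matrix ψ ∝ᴹ 𝕄[ g ] → Fixes ψ ℓ → g • L ∼ L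
  fixes⇒∼ {ℓ} ψ g L-valid rep ψ∝g fixes = label-unique {ℓ ⟪ ψ ⟫ᴸ} (Valid-• g L-valid) L-valid
    (represents-image {ℓ} ψ g rep ψ∝g) (represents-≈ {ℓ} {ℓ ⟪ ψ ⟫ᴸ} fixes rep)

  ∼⇒fixes : ∀ {ℓ L} ψ g → Represents ℓ L → matrix ψ ∝ᴹ 𝕄[ g ] → g • L ∼ L → Fixes ψ ℓ
  ∼⇒fixes {ℓ} ψ g rep ψ∝g gL∼L = same-label⇒≈ {ℓ ⟪ ψ ⟫ᴸ} {ℓ}
    (represents-∼ {ℓ ⟪ ψ ⟫ᴸ} gL∼L (represents-image {ℓ} ψ g rep ψ∝g)) rep

  ≐⇒∝ᴹ : ∀ {M N} → M ≐ N → M ∝ᴹ N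
  ≐⇒∝ᴹ M≐N = 1# , 1≢0 , λ i j → trans (M≐N i j) (sym (*-identityˡ _))

  -- Fixing the points of (1 , 0) and (0 , 1) makes g diagonal with entries k and l. The condition
  -- on `w` is (k l)² = k l³, so k = l.
  stabilizer-ℓ₁ : ∀ ψ → InG ψ → Fixes ψ ℓ₁ → matrix ψ ∝ᴹ 𝕀
  stabilizer-ℓ₁ ψ ψ∈G fixes with InG⇒𝕄 6≤q ψ ψ∈G
  ... | g , ψ∝g = scalar g ψ∝g (fixes⇒∼ {ℓ₁} ψ g L₁-valid represents-ℓ₁ ψ∝g fixes)
    where
    scalar : ∀ g → matrix ψ ∝ᴹ 𝕄[ g ] → g • L₁ ∼ L₁ → matrix ψ ∝ᴹ 𝕀
    scalar (gl a b c d D≢0) ψ∝g (related k l k≢0 l≢0 e₁ e₂ e₃ e₄ e₅) =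
      ∝ᴹ-trans {matrix ψ} {𝕄 a b c d} {𝕀} ψ∝g
        (k * k * k , *-nonzero (*-nonzero k≢0 k≢0) k≢0 , λ i j →
          trans (𝕄-cong a≡k b≡0 c≡0 (trans d≡l (sym k≡l)) i j) (𝕄-scalar k i j))
      where
      first : ∀ {x y} m → x * 1# + y * 0# ≡ k * m → x ≡ k * m
      first {x} {y} m e = trans (solve 2 (λ x y → x ⊜ x ⊗ Κ z1 ⊕ y ⊗ Κ z0) refl x y) e
      second : ∀ {x y} m → x * 0# + y * 1# ≡ l * m → y ≡ l * m
      second {x} {y} m e = trans (solve 2 (λ x y → y ⊜ x ⊗ Κ z0 ⊕ y ⊗ Κ z1) refl x y) e
      a≡k : a ≡ k
      a≡k = trans (first 1# e₁) (*-identityʳ k)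
      c≡0 : c ≡ 0#
      c≡0 = trans (first 0# e₂) (zeroʳ k)
      b≡0 : b ≡ 0#
      b≡0 = trans (second 0# e₃) (zeroʳ l)
      d≡l : d ≡ l
      d≡l = trans (second 1# e₄) (*-identityʳ l)
      k≡l : k ≡ l
      k≡l = *-cancelˡ (*-nonzero (*-nonzero k≢0 l≢0) l≢0) (begin
        k * l * l * k                                        ≡⟨ solve 2 (λ k l → k ⊗ l ⊗ l ⊗ k ⊜
            detᴱ k (Κ z0) (Κ z0) l ⊗ detᴱ k (Κ z0) (Κ z0) l ⊗ Κ z1) refl k l ⟩
        det k 0# 0# l * det k 0# 0# l * 1#                   ≡⟨ cong (λ D → D * D * 1#) D≡ ⟨
        det a b c d * det a b c d * 1#                       ≡⟨ e₅ ⟩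
        k * (l * l * l) * 1#                                 ≡⟨ solve 2 (λ k l → k ⊗ (l ⊗ l ⊗ l) ⊗ Κ z1 ⊜ k ⊗ l ⊗ l ⊗ l) refl k l ⟩
        k * l * l * l                                        ∎)
        where
        D≡ : det a b c d ≡ det k 0# 0# l
        D≡ = trans (cong₂ (λ a d → det a b c d) a≡k d≡l) (cong₂ (λ b c → det k b c l) b≡0 c≡0)

  𝕄-multiple : ∀ k a b c d → 𝕄 (k * a) (k * b) (k * c) (k * d) ≐ λ i j → k * k * k * 𝕄 a b c d i j
  𝕄-multiple k a b c d = λ
    { 0F j → v-multiple k a c j
    ; 1F 0F → sym (zeroʳ _)
    ; 1F 1F → solve 5 (λ k a b c d → k ⊗ a ⊗ detᴱ (k ⊗ a) (k ⊗ b) (k ⊗ c) (k ⊗ d) ⊜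
        k ⊗ k ⊗ k ⊗ (a ⊗ detᴱ a b c d)) refl k a b c d
    ; 1F 2F → solve 5 (λ k a b c d → ⊝ (k ⊗ c ⊗ detᴱ (k ⊗ a) (k ⊗ b) (k ⊗ c) (k ⊗ d)) ⊜
        k ⊗ k ⊗ k ⊗ ⊝ (c ⊗ detᴱ a b c d)) refl k a b c d
    ; 1F 3F → sym (zeroʳ _)
    ; 2F 0F → sym (zeroʳ _)
    ; 2F 1F → solve 5 (λ k a b c d → ⊝ (k ⊗ b ⊗ detᴱ (k ⊗ a) (k ⊗ b) (k ⊗ c) (k ⊗ d)) ⊜
        k ⊗ k ⊗ k ⊗ ⊝ (b ⊗ detᴱ a b c d)) refl k a b c d
    ; 2F 2F → solve 5 (λ k a b c d → k ⊗ d ⊗ detᴱ (k ⊗ a) (k ⊗ b) (k ⊗ c) (k ⊗ d) ⊜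
        k ⊗ k ⊗ k ⊗ (d ⊗ detᴱ a b c d)) refl k a b c d
    ; 2F 3F → sym (zeroʳ _)
    ; 3F j → v-multiple k b d j
    }

  -- The matrix in the theorem belongs to the upper triangular g = (1 b ; 0 d), whose determinant is
  -- d.
  Ψ≐𝕄 : ∀ b d → Ψ-matrix b d ≐ 𝕄 1# b 0# d
  Ψ≐𝕄 b d = λ
    { 0F 0F → solve 0 (Κ z1 ⊜ Κ z1 ⊗ Κ z1 ⊗ Κ z1) refl
    ; 0F 1F → solve 0 (Κ z0 ⊜ Κ z1 ⊗ Κ z1 ⊗ Κ z0) refl
    ; 0F 2F → solve 0 (Κ z0 ⊜ Κ z1 ⊗ (Κ z0 ⊗ Κ z0)) refl
    ; 0F 3F → solve 0 (Κ z0 ⊜ Κ z0 ⊗ Κ z0 ⊗ Κ z0) refl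
    ; 1F 0F → refl
    ; 1F 1F → solve 2 (λ b d → d ⊜ Κ z1 ⊗ detᴱ (Κ z1) b (Κ z0) d) refl b d
    ; 1F 2F → solve 2 (λ b d → Κ z0 ⊜ ⊝ (Κ z0 ⊗ detᴱ (Κ z1) b (Κ z0) d)) refl b d
    ; 1F 3F → refl
    ; 2F 0F → refl
    ; 2F 1F → solve 2 (λ b d → ⊝ (b ⊗ d) ⊜ ⊝ (b ⊗ detᴱ (Κ z1) b (Κ z0) d)) refl b d
    ; 2F 2F → solve 2 (λ b d → d ⊗ d ⊜ d ⊗ detᴱ (Κ z1) b (Κ z0) d) refl b d
    ; 2F 3F → refl
    ; 3F 0F → refl
    ; 3F 1F → refl
    ; 3F 2F → refl
    ; 3F 3F → refl
    }

  PlusMinusOne⇒square : ∀ {d} → PlusMinusOne d → d * d ≡ 1#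
  PlusMinusOne⇒square (inj₁ refl) = *-identityˡ 1#
  PlusMinusOne⇒square (inj₂ refl) = solve 0 (⊝ Κ z1 ⊗ ⊝ Κ z1 ⊜ Κ z1) refl

  shear : ∀ b {d} → PlusMinusOne d → GL₂
  shear b {d} d≡±1 = gl 1# b 0# d λ e → 1≢0 (trans (sym (PlusMinusOne⇒square d≡±1))
    (trans (cong (_* d) (trans (solve 2 (λ b d → d ⊜ detᴱ (Κ z1) b (Κ z0) d) refl b d) e)) (zeroˡ d)))

  shear-fixes : ∀ r b {d} (d≡±1 : PlusMinusOne d) → shear b d≡±1 • L₃ r ∼ L₃ r
  shear-fixes r b {d} d≡±1 = related 1# 1# 1≢0 1≢0 x≡ y≡ x≡ y≡
    (combine₁ r (PlusMinusOne⇒square d≡±1) (solve 3 (λ r b d → let D = detᴱ (Κ z1) b (Κ z0) d in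
      D ⊗ D ⊗ r ⊜ Κ z1 ⊗ (Κ z1 ⊗ Κ z1 ⊗ Κ z1) ⊗ r ⊕ r ⊗ (d ⊗ d ⊕ ⊝ Κ z1)) refl r b d))
    where
    x≡ : 1# * 1# + b * 0# ≡ 1# * 1#
    x≡ = solve 1 (λ b → Κ z1 ⊗ Κ z1 ⊕ b ⊗ Κ z0 ⊜ Κ z1 ⊗ Κ z1) refl b
    y≡ : 0# * 1# + d * 0# ≡ 1# * 0#
    y≡ = solve 1 (λ d → Κ z0 ⊗ Κ z1 ⊕ d ⊗ Κ z0 ⊜ Κ z1 ⊗ Κ z0) refl d

  HasΨForm : Projectivity → Set c
  HasΨForm ψ = ∃[ b ] ∃[ d ] (PlusMinusOne d × matrix ψ ∝ᴹ Ψ-matrix b d)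

  Ψ⇒fixes-ℓ₃ : ∀ r ψ → HasΨForm ψ → Fixes ψ (ℓ₃ r)
  Ψ⇒fixes-ℓ₃ r ψ (b , d , d≡±1 , ψ∝Ψ) = ∼⇒fixes {ℓ₃ r} ψ (shear b d≡±1) (represents-ℓ₃ r)
    (∝ᴹ-trans {matrix ψ} {Ψ-matrix b d} {𝕄 1# b 0# d} ψ∝Ψ (≐⇒∝ᴹ (Ψ≐𝕄 b d))) (shear-fixes r b d≡±1)

  -- Fixing the point of (1 , 0) makes g upper triangular, with a = k = l. The condition on `w` is
  -- (k d)² r = k⁴ r, so d = k or d = - k; dividing by k leaves first entry 1. As r cancels, the
  -- outcome is the same for every nonzero r.
  fixes-ℓ₃⇒Ψ : ∀ {r} → r ≢ 0# → ∀ ψ → InG ψ → Fixes ψ (ℓ₃ r) → HasΨForm ψ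
  fixes-ℓ₃⇒Ψ {r} r≢0 ψ ψ∈G fixes with InG⇒𝕄 6≤q ψ ψ∈G
  ... | g , ψ∝g = normalise g ψ∝g (fixes⇒∼ {ℓ₃ r} ψ g (L₃-valid r≢0) (represents-ℓ₃ r) ψ∝g fixes)
    where
    normalise : ∀ g → matrix ψ ∝ᴹ 𝕄[ g ] → g • L₃ r ∼ L₃ r → HasΨForm ψ
    normalise (gl a b c d D≢0) ψ∝g (related k l k≢0 l≢0 e₁ e₂ e₃ e₄ e₅) =
      b * i , d * i , [ inj₁ ∘ plus , inj₂ ∘ minus ]′ (≡± d²≡k²) ,
      ∝ᴹ-trans {matrix ψ} {𝕄 a b c d} {Ψ-matrix (b * i) (d * i)} ψ∝g
        (k * k * k , *-nonzero (*-nonzero k≢0 k≢0) k≢0 , λ r s → begin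
          𝕄 a b c d r s                                          ≡⟨ 𝕄-cong
            (trans a≡k (sym (*-identityʳ k))) (rescale b) (trans c≡0 (sym (zeroʳ k))) (rescale d) r s ⟩
          𝕄 (k * 1#) (k * (b * i)) (k * 0#) (k * (d * i)) r s    ≡⟨ 𝕄-multiple k 1# (b * i) 0# (d * i) r s ⟩
          k * k * k * 𝕄 1# (b * i) 0# (d * i) r s                ≡⟨ cong (k * k * k *_) (Ψ≐𝕄 (b * i) (d * i) r s) ⟨
          k * k * k * Ψ-matrix (b * i) (d * i) r s               ∎)
      where
      i = proj₁ (inverse k k≢0)
      ki≡1 : k * i ≡ 1#
      ki≡1 = proj₂ (inverse k k≢0)
      rescale : ∀ x → x ≡ k * (x * i)
      rescale x = combine₁ (- x) ki≡1 (solve 3 (λ x k i → x ⊜ k ⊗ (x ⊗ i) ⊕ ⊝ x ⊗ (k ⊗ i ⊕ ⊝ Κ z1)) refl x k i)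
      first : ∀ {x y} m n → x * 1# + y * 0# ≡ m * n → x ≡ m * n
      first {x} {y} m n e = trans (solve 2 (λ x y → x ⊜ x ⊗ Κ z1 ⊕ y ⊗ Κ z0) refl x y) e
      a≡k : a ≡ k
      a≡k = trans (first k 1# e₁) (*-identityʳ k)
      a≡l : a ≡ l
      a≡l = trans (first l 1# e₃) (*-identityʳ l)
      c≡0 : c ≡ 0#
      c≡0 = trans (first k 0# e₂) (zeroʳ k)
      d²≡k² : d * d ≡ k * k
      d²≡k² = *-cancelˡ (*-nonzero r≢0 (*-nonzero k≢0 k≢0)) (begin
        r * (k * k) * (d * d)                   ≡⟨ solve 4 (λ r k b d → r ⊗ (k ⊗ k) ⊗ (d ⊗ d) ⊜
            detᴱ k b (Κ z0) d ⊗ detᴱ k b (Κ z0) d ⊗ r) refl r k b d ⟩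
        det k b 0# d * det k b 0# d * r         ≡⟨ cong₂ (λ a c → det a b c d * det a b c d * r) a≡k c≡0 ⟨
        det a b c d * det a b c d * r           ≡⟨ e₅ ⟩
        k * (l * l * l) * r                     ≡⟨ cong (λ l → k * (l * l * l) * r) (trans (sym a≡l) a≡k) ⟩
        k * (k * k * k) * r                     ≡⟨ solve 2 (λ r k → k ⊗ (k ⊗ k ⊗ k) ⊗ r ⊜ r ⊗ (k ⊗ k) ⊗ (k ⊗ k)) refl r k ⟩
        r * (k * k) * (k * k)                   ∎)
      plus : d ≡ k → d * i ≡ 1#
      plus d≡k = trans (cong (_* i) d≡k) ki≡1
      minus : d ≡ - k → d * i ≡ - 1#
      minus d≡-k = trans (cong (_* i) d≡-k) (combine₁ (- 1#) ki≡1
        (solve 2 (λ k i → ⊝ k ⊗ i ⊜ ⊝ Κ z1 ⊕ ⊝ Κ z1 ⊗ (k ⊗ i ⊕ ⊝ Κ z1)) refl k i))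

  fixes-ℓ₃⇔Ψ : ∀ {r} → r ≢ 0# → ∀ ψ → InG ψ → Fixes ψ (ℓ₃ r) ⇔ HasΨForm ψ
  fixes-ℓ₃⇔Ψ {r} r≢0 ψ ψ∈G = mk⇔ (fixes-ℓ₃⇒Ψ r≢0 ψ ψ∈G) (Ψ⇒fixes-ℓ₃ r ψ)

  same-stabilizer : ∀ {r r′} → r ≢ 0# → r′ ≢ 0# → ∀ ψ → InG ψ → Fixes ψ (ℓ₃ r) ⇔ Fixes ψ (ℓ₃ r′)
  same-stabilizer {r} {r′} r≢0 r′≢0 ψ ψ∈G = mk⇔
    (Ψ⇒fixes-ℓ₃ r′ ψ ∘ fixes-ℓ₃⇒Ψ r≢0 ψ ψ∈G) (Ψ⇒fixes-ℓ₃ r ψ ∘ fixes-ℓ₃⇒Ψ r′≢0 ψ ψ∈G)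

  sign : Fin 2 → F
  sign j = ± j 1#

  sign≡±1 : ∀ j → PlusMinusOne (sign j)
  sign≡±1 0F = inj₁ refl
  sign≡±1 1F = inj₂ refl

  sign-surjective : ∀ {d} → PlusMinusOne d → ∃[ j ] sign j ≡ d
  sign-surjective (inj₁ refl) = 0F , refl
  sign-surjective (inj₂ refl) = 1F , refl

  sign-injective : ∀ {j j′} → sign j ≡ sign j′ → j ≡ j′
  sign-injective {0F} {0F} _ = refl
  sign-injective {1F} {1F} _ = refl
  sign-injective {0F} {1F} e = contradiction e 1≢-1
  sign-injective {1F} {0F} e = contradiction (sym e) 1≢-1

  -- The first entry 1 removes the scalar, and the last row contains b³ and d³, which determine b
  -- and d by Frobenius.
  Ψ-injective : ∀ {b d b′ d′} → 𝕄 1# b 0# d ∝ᴹ 𝕄 1# b′ 0# d′ → b ≡ b′ × d ≡ d′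
  Ψ-injective {b} {d} {b′} {d′} (k , _ , e) = cube-injective (e≡ (e 3F 0F)) , cube-injective (e≡ (e 3F 3F))
    where
    k≡1 : k ≡ 1#
    k≡1 = combine₁ (- 1#) (e 0F 0F)
      (solve 1 (λ k → let 1ᴱ = Κ z1 ⊗ Κ z1 ⊗ Κ z1 in k ⊜ Κ z1 ⊕ ⊝ Κ z1 ⊗ (1ᴱ ⊕ ⊝ (k ⊗ 1ᴱ))) refl k)
    e≡ : ∀ {x y} → x ≡ k * y → x ≡ y
    e≡ h = trans h (trans (cong (_* _) k≡1) (*-identityˡ _))

  stabilizer-size : HasSize (stabilizerSetoid ℓ₂) (2 ℕ.* q)
  stabilizer-size = Compose.inverse
    (bijection⇒inverse (stabilizerSetoid ℓ₂) element′
      (λ {t} {t′} → element′-injective {t} {t′}) element′-surjective)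
    (Symmetry.inverse *↔×)
    where
    Φ : Fin 2 × Fin q → Projectivity
    Φ (j , i) = projectivity (shear (element i) (sign≡±1 j))
    element′ : Fin 2 × Fin q → Setoid.Carrier (stabilizerSetoid ℓ₂)
    element′ (j , i) = Φ (j , i) , InG-projectivity (shear (element i) (sign≡±1 j)) ,
      ∼⇒fixes {ℓ₃ 1#} (Φ (j , i)) (shear (element i) (sign≡±1 j)) (represents-ℓ₃ 1#)
        (∝ᴹ-refl {𝕄 1# (element i) 0# (sign j)}) (shear-fixes 1# (element i) (sign≡±1 j))
    element′-injective : ∀ {t t′} → matrix (Φ t) ∝ᴹ matrix (Φ t′) → t ≡ t′
    element′-injective {j , i} {j′ , i′} e with Ψ-injective {element i} {sign j} {element i′} {sign j′} e
    ... | b≡ , d≡ = cong₂ _,_ (sign-injective d≡) (element-injective b≡)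
    element′-surjective : ∀ s → ∃[ t ] matrix (Φ t) ∝ᴹ matrix (proj₁ s)
    element′-surjective (ψ , ψ∈G , fixes) = from-Ψ (fixes-ℓ₃⇒Ψ 1≢0 ψ ψ∈G fixes)
      where
      from-Ψ : HasΨForm ψ → ∃[ t ] matrix (Φ t) ∝ᴹ matrix ψ
      from-Ψ (b , d , d≡±1 , ψ∝Ψ) with sign-surjective d≡±1
      ... | j , refl = (j , index b) , ∝ᴹ-sym {matrix ψ} {𝕄 1# (element (index b)) 0# (sign j)}
        (∝ᴹ-trans {matrix ψ} {Ψ-matrix b (sign j)} {𝕄 1# (element (index b)) 0# (sign j)} ψ∝Ψ (≐⇒∝ᴹ λ r s →
          trans (Ψ≐𝕄 b (sign j) r s) (𝕄-cong refl (sym (element-index b)) refl refl r s)))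

open import Data.Nat using (_*_)

theorem7p3 : ∀ {c : Level} (q : ℕ) (𝔽 : FiniteField c q) → 3 ∣ q → 9 ≤ q →
    let open TwistedCubic 𝔽 in
    (∃[ m₁ ] ∃[ m₂ ] ∃[ m₃ ] OrbitDecomposition m₁ m₂ m₃)
    × (∀ ρ → NonSquare ρ → OrbitDecomposition ℓ₁ ℓ₂ (ℓ₃ ρ))
    × (∀ ψ → InG ψ → Fixes ψ ℓ₁ → matrix ψ ∝ᴹ 𝕀)
    × (∀ ρ → NonSquare ρ → ∀ ψ → InG ψ → Fixes ψ ℓ₂ ⇔ Fixes ψ (ℓ₃ ρ))
    × HasSize (stabilizerSetoid ℓ₂) (2 * q)
    × (∀ ψ → InG ψ → Fixes ψ ℓ₂ ⇔ (∃[ b ] ∃[ d ] (PlusMinusOne d × matrix ψ ∝ᴹ Ψ-matrix b d)))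
theorem7p3 q 𝔽 3∣q 9≤q =
    -- No ρ is given in this component, so a nonsquare has to be produced.
    (ℓ₁ , ℓ₂ , ℓ₃ (proj₁ nonsquare-exists) , orbit-decomposition (proj₂ nonsquare-exists))
  , (λ ρ ns → orbit-decomposition ns)
  , stabilizer-ℓ₁
  , (λ ρ ns → same-stabilizer 1≢0 (NonSquare⇒≢0 ns))
  , stabilizer-size
  , fixes-ℓ₃⇔Ψ 1≢0
  where
  open FiniteField 𝔽 using (1≢0)
  open TwistedCubic 𝔽 using (ℓ₁; ℓ₂; ℓ₃)
  1+1+1≡0 : CharacteristicThree 𝔽
  1+1+1≡0 = Cauchy.3∣q⇒1+1+1≡0 𝔽 3∣q
  6≤q : 6 ≤ q
  6≤q = ℕ.≤-trans (ℕ.m≤m+n 6 3) 9≤q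
  open FieldArithmetic 𝔽 1+1+1≡0 using (nonsquare-exists)
  open Orbits 𝔽 1+1+1≡0 6≤q using (orbit-decomposition; NonSquare⇒≢0)
  open Stabilizers 𝔽 1+1+1≡0 6≤q
    using (stabilizer-ℓ₁; same-stabilizer; stabilizer-size; fixes-ℓ₃⇔Ψ)
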